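{- Let $k>1$ and $n\ge 2k+3$, and let $T$ be a $k$-triangulation of the convex $n$-gon. The following are equivalent: (i) $T$ is $k$-colorable; (ii) there is a coloring of the $k$-relevant edges of $T$ with $k$ colors such that no $k$-star contained in $T$ contains three edges of the same color; (iii) $T$ contains no internal $k$-star; (iv) $T$ contains exactly $2k$ $k$-ears; (v) $T$ contains exactly $2k$ edges of each length $k+1,\dots,\lfloor (n-1)/2\rfloor$ (and, if $n$ is even, exactly $k$ edges of length $n/2$); (vi) the set of $k$-relevant edges of $T$ is the union of $k$ pairwise disjoint $k$-accordions.
   Context: $V_n$ is a set of $n$ points on the unit circle labelled counterclockwise by $\mathbb{Z}_n$; $[u,v]$ denotes the straight edge between $u\neq v$, $E_n$ the set of all edges; the length of $[u,v]$ is the cyclic distance between $u$ and $v$. Two edges cross if their open segments intersect; an $\ell$-crossing is a set of $\ell$ pairwise crossing edges. A $k$-triangulation is a maximal subset of $E_n$ with no $(k+1)$-crossing. An edge is $k$-relevant if its length is $>k$ and a $k$-boundary edge if its length is $k$. A $k$-star is a set of edges $\{[s_j,s_{j+k}]: j\in\mathbb{Z}_{2k+1}\}$ with $s_0,\dots,s_{2k}$ distinct points in counterclockwise order; a $k$-star is external if it contains at least one $k$-boundary edge and internal otherwise. A $k$-ear of $T$ is an edge of $T$ of length $k+1$. $T$ is $k$-colorable if its $k$-relevant edges can be colored with $k$ colors so that no two crossing edges have the same color. A $k$-accordion is a set $\{[a_i,b_i] : 1\le i\le n-2k-1\}$ of $n-2k-1$ edges such that $b_1=a_1+k+1$ and,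 for every $2\le i\le n-2k-1$, the edge $[a_i,b_i]$ is either $[a_{i-1},b_{i-1}+1]$ or $[a_{i-1}-1,b_{i-1}]$ (arithmetic in $\mathbb{Z}_n$). -}

module Defs where

open import Data.Nat as ℕ using (ℕ; zero; suc; _+_; _*_; _∸_; _⊓_; ∣_-_∣; _%_)
open import Data.Nat.DivMod using (m%n<n)
open import Data.Fin as Fin using (Fin; toℕ; fromℕ<)
open import Data.Bool using (Bool; true; false; _∨_)
open import Data.Product using (Σ; ∃; ∃-syntax; _×_; _,_)
open import Data.Sum using (_⊎_)
open import Relation.Binary.PropositionalEquality using (_≡_; _≢_)
open import Relation.Nullary using (¬_)
open import Function.Bundles using (_↔_)

-- Points of V_n are the elements of Fin n (= ℤ_n, labelled ccw).

_⊕_ : ∀ {n} → Fin n → ℕ → Fin n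
_⊕_ {suc n} u m = fromℕ< (m%n<n (toℕ u + m) (suc n))

dist : ∀ {n} → Fin n → Fin n → ℕ
dist {n} u v = ∣ toℕ u - toℕ v ∣ ⊓ (n ∸ ∣ toℕ u - toℕ v ∣)

record Edge (n : ℕ) : Set where
  constructor edge
  field
    src tgt : Fin n
    ord     : src Fin.< tgt
open Edge public

EdgeIs : ∀ {n} → Edge n → Fin n → Fin n → Set
EdgeIs e u v = (src e ≡ u × tgt e ≡ v) ⊎ (src e ≡ v × tgt e ≡ u)

len : ∀ {n} → Edge n → ℕ
len e = dist (src e) (tgt e)

-- crossing: the open segments intersect iff the endpoints strictly interleave
Cross : ∀ {n} → Edge n → Edge n → Set
Cross e f =
  (src e Fin.< src f × src f Fin.< tgt e × tgt e Fin.< tgt f) ⊎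
  (src f Fin.< src e × src e Fin.< tgt f × tgt f Fin.< tgt e)

EdgeSet : ℕ → Set
EdgeSet n = Edge n → Bool

_∈E_ : ∀ {n} → Edge n → EdgeSet n → Set
e ∈E T = T e ≡ true

_⊆E_ : ∀ {n} → EdgeSet n → EdgeSet n → Set
S ⊆E T = ∀ e → e ∈E S → e ∈E T

HasCrossing : ∀ {n} → ℕ → EdgeSet n → Set
HasCrossing {n} ℓ T =
  Σ (Fin ℓ → Edge n) λ f → (∀ i → f i ∈E T) × (∀ i j → i ≢ j → Cross (f i) (f j))

IsKTriangulation : ∀ {n} → ℕ → EdgeSet n → Set
IsKTriangulation k T =
  ¬ HasCrossing (suc k) T ×
  (∀ S → T ⊆E S → ¬ HasCrossing (suc k) S → S ⊆E T)

Relevant : ∀ {n} → ℕ → Edge n → Set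
Relevant k e = k ℕ.< len e

HasSize : ∀ {a} {A : Set a} → (A → Set) → ℕ → Set a
HasSize {A = A} P m = Fin m ↔ Σ A P

-- k-stars.  A k-star is given by points s_0,…,s_{2k} in ccw order;
-- up to cyclic relabelling of the indices (which does not change the
-- star) we may and do take s strictly increasing in the labels.

record StarPoints (n k : ℕ) : Set where
  constructor star
  field
    pts  : Fin (suc (2 * k)) → Fin n
    incr : ∀ i j → i Fin.< j → pts i Fin.< pts j

InStar : ∀ {n k} → StarPoints n k → Edge n → Set
InStar {k = k} (star s _) e = ∃[ j ] EdgeIs e (s j) (s (j ⊕ k))

StarIn : ∀ {n k} → StarPoints n k → EdgeSet n → Set
StarIn st T = ∀ e → InStar st e → e ∈E T

Internal : ∀ {n k} → StarPoints n k → Set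
Internal {k = k} st = ∀ e → InStar st e → ¬ (len e ≡ k)

KColorable : ∀ {n} → ℕ → EdgeSet n → Set
KColorable {n} k T =
  Σ (Edge n → Fin k) λ col →
    ∀ e f → e ∈E T → f ∈E T → Relevant k e → Relevant k f →
      Cross e f → col e ≢ col f

StarColorable : ∀ {n} → ℕ → EdgeSet n → Set
StarColorable {n} k T =
  Σ (Edge n → Fin k) λ col →
    ∀ (st : StarPoints n k) → StarIn st T →
      ¬ (Σ (Edge n) λ e₁ → Σ (Edge n) λ e₂ → Σ (Edge n) λ e₃ →
           e₁ ≢ e₂ × e₁ ≢ e₃ × e₂ ≢ e₃ ×
           InStar st e₁ × InStar st e₂ × InStar st e₃ ×
           Relevant k e₁ × Relevant k e₂ × Relevant k e₃ ×
           col e₁ ≡ col e₂ × col e₂ ≡ col e₃)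

-- k-accordions: edges [a_i,b_i], 0 ≤ i < n-2k-1 (0-indexed)

record Accordion (n k : ℕ) : Set where
  constructor accordion
  field
    a b   : ℕ → Fin n
    first : b 0 ≡ a 0 ⊕ (suc k)
    step  : ∀ i → suc i ℕ.< n ∸ suc (2 * k) →
              (a (suc i) ≡ a i × b (suc i) ≡ b i ⊕ 1) ⊎
              (a (suc i) ≡ a i ⊕ (n ∸ 1) × b (suc i) ≡ b i)

InAccordion : ∀ {n k} → Accordion n k → Edge n → Set
InAccordion {n} {k} A e =
  ∃[ i ] (i ℕ.< n ∸ suc (2 * k) × EdgeIs e (Accordion.a A i) (Accordion.b A i))

{-# OPTIONS --safe #-}
module Submission where

-- Everything follows from the star theorem: in a k-triangulation every angle
-- whose two edges have length at least k is an angle of a k-star.  Lift the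
-- polygon to its universal cover, so that crossing edges form chains for the
-- strict product order.  For an angle u < v < w the star is read off the
-- upper-left extremal (k-1)-chain (a_i , b_i) of edges crossing both sides of
-- the angle (short edges provide one such chain); if some (a_i , b_{i+1}) were
-- missing, maximality would give k edges crossing it, and exchanging parts of
-- these with the extremal chain would produce a (k+1)-crossing.
--
-- Stars correspond to the n - 2k possible middle vertices of their points.  An
-- external star has exactly one boundary edge [x , x+k] for which [x , x+k+1]
-- is not in T, so that the number of ears is 2k exactly when no star is
-- internal.  In that case each star, deprived of this boundary edge, pairs off
-- its other edges into consecutive edges of accordions; these pairings link
-- the 2k ears by 2k mutually reverse paths, that is, by k accordions.

-- Why n - 2k: read with labels in `[0,n)`, a star has k points on either side of its middle one,
-- and each remaining position v is taken, by the angle at v that faces the cut between n-1 and 0.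
-- Every boundary edge [x , x+k] lies in a star and is the last of its run of boundary edges there
-- iff [x , x+k+1] is missing. So the vertices that start no ear correspond to the external stars,
-- and n minus the number of ears is at most n - 2k, with equality iff no star is internal. Why the
-- edges pair off: the last boundary edge spans k+1 consecutive vertices, and each of the k other
-- points of the star is joined to two adjacent ones among them; two such edges are one step of an
-- accordion. The implications are (i) to (ii) to (iii) to (vi) to (i), and (iii) to (iv) and back.
-- The level k+1 of (v) is (iv), the levels below n/2 come from the paths, and each accordion has
-- one diameter. The assumption k > 1 is what (i) to (ii) rests on: edges of a star that do not
-- cross share an endpoint, and three edges of a cycle of length 2k+1 share endpoints pairwise only
-- if it is a triangle.

open import Defs

open import Axiom.UniquenessOfIdentityProofs using (module Decidable⇒UIP)
import Data.Bool as Bool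
open import Data.Bool using (Bool; true; _∧_; _∨_) renaming (T to IsTrue)
open import Data.Bool.Properties using (∨-zeroʳ; ∨-identityʳ)
open import Data.Empty using (⊥; ⊥-elim)
open import Data.Fin using (Fin; toℕ; fromℕ<; punchIn; combine) renaming (zero to fzero; suc to fsuc)
open import Data.Fin.Permutation using (↔⇒≡)
open import Data.Fin.Properties using (toℕ-fromℕ<; toℕ-injective; toℕ<n; punchInᵢ≢i; punchIn-injective; any?; injective⇒≤; pigeonhole; combine-injective) renaming (_≟_ to _≟ᶠ_; suc-injective to fsuc-injective)
import Data.Integer as ℤ
open import Data.Integer using (ℤ; _⊖_) renaming (+_ to pos; -[1+_] to negsuc)
import Data.List as List
open import Data.List using (List; []; _∷_; _++_)
open import Data.List.Relation.Unary.All using (All; []; _∷_)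
open import Data.List.Relation.Unary.All.Properties using (++⁺)
open import Data.Nat using (ℕ; zero; suc; _+_; _*_; _≤_; _<_; _∸_; z≤n; s≤s; _%_; _/_; _⊓_; ∣_-_∣)
open import Data.Nat.DivMod using (m%n<n; m≡m%n+[m/n]*n; [m+kn]%n≡m%n; m<n⇒m%n≡m; [m+n]%n≡m%n; m%n%n≡m%n)
open import Data.Nat.Properties
open import Data.Product using (Σ; ∃-syntax; _×_; _,_; proj₁; proj₂)
open import Data.Sum using (_⊎_; inj₁; inj₂)
open import Data.Unit using (tt)
open import Data.Vec using (Vec; []; _∷_; lookup; replicate; zipWith; map; allFin; toList)
open import Data.Vec.N-ary using (N-ary; _$ⁿ_; curryⁿ; ∀ⁿ)
open import Function.Bundles using (_⇔_; mk↔ₛ′; mk⇔; module Equivalence)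
open import Function.Properties.Inverse using (↔-sym; ↔-trans)
open import Relation.Binary using (tri<; tri≈; tri>)
open import Relation.Binary.PropositionalEquality using (_≡_; _≢_; refl; sym; trans; cong; cong₂; subst; subst₂; module ≡-Reasoning)
open import Relation.Nullary using (¬_; Dec; yes; no; does)
open import Relation.Nullary.Decidable using (_×-dec_)
open import Algebra.Properties.CommutativeSemigroup +-commutativeSemigroup using (interchange)

-- Linear arithmetic over ℕ

infixl 7 _⊠_
infixl 6 _⊹_
infix  4 _≼_ _≺_ _≐_ _≼ᶠ_
infixr 3 _⇒_
infix  3 ⊢_

data Lin (m : ℕ) : Set where
  var : Fin m → Lin m
  #_  : ℕ → Lin m
  _⊹_ : Lin m → Lin m → Lin m
  _⊠_ : ℕ → Lin m → Lin m

data Atom (m : ℕ) : Set where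
  _≼_ _≺_ _≐_ : Lin m → Lin m → Atom m

data Problem (m : ℕ) : Set where
  ⊢_  : Atom m → Problem m
  ⊢⊥  : Problem m
  _⇒_ : Atom m → Problem m → Problem m

module _ {m : ℕ} (ρ : Vec ℕ m) where

  ⟦_⟧ : Lin m → ℕ
  ⟦ var i ⟧ = lookup ρ i
  ⟦ # c ⟧   = c
  ⟦ e ⊹ f ⟧ = ⟦ e ⟧ + ⟦ f ⟧
  ⟦ c ⊠ e ⟧ = c * ⟦ e ⟧

  ⟦_⟧ᵃ : Atom m → Set
  ⟦ e ≼ f ⟧ᵃ = ⟦ e ⟧ ≤ ⟦ f ⟧
  ⟦ e ≺ f ⟧ᵃ = ⟦ e ⟧ < ⟦ f ⟧
  ⟦ e ≐ f ⟧ᵃ = ⟦ e ⟧ ≡ ⟦ f ⟧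

  ⟦_⟧ᵖ : Problem m → Set
  ⟦ ⊢ g ⟧ᵖ   = ⟦ g ⟧ᵃ
  ⟦ ⊢⊥ ⟧ᵖ    = ⊥
  ⟦ h ⇒ p ⟧ᵖ = ⟦ h ⟧ᵃ → ⟦ p ⟧ᵖ

-- A form is the constant term followed by the coefficients of the variables.
Form : ℕ → Set
Form m = Vec ℕ (suc m)

dot : ∀ {m} → Vec ℕ m → Vec ℕ m → ℕ
dot []       []       = 0
dot (c ∷ cs) (x ∷ xs) = c * x + dot cs xs

⟦_⟧ᶠ : ∀ {m} → Form m → Vec ℕ m → ℕ
⟦ f ⟧ᶠ ρ = dot f (1 ∷ ρ)

unit : ∀ {m} → Fin m → Vec ℕ m
unit {suc m} fzero    = 1 ∷ replicate m 0
unit {suc m} (fsuc i) = 0 ∷ unit i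

form : ∀ {m} → Lin m → Form m
form (var i) = 0 ∷ unit i
form (# c)   = c ∷ replicate _ 0
form (e ⊹ f) = zipWith _+_ (form e) (form f)
form (c ⊠ e) = map (c *_) (form e)

dot-zero : ∀ {m} (xs : Vec ℕ m) → dot (replicate m 0) xs ≡ 0
dot-zero []       = refl
dot-zero (x ∷ xs) = dot-zero xs

dot-unit : ∀ {m} (i : Fin m) xs → dot (unit i) xs ≡ lookup xs i
dot-unit fzero    (x ∷ xs) =
  trans (cong₂ _+_ (*-identityˡ x) (dot-zero xs)) (+-identityʳ x)
dot-unit (fsuc i) (x ∷ xs) = dot-unit i xs

dot-+ : ∀ {m} (cs ds xs : Vec ℕ m) →
        dot (zipWith _+_ cs ds) xs ≡ dot cs xs + dot ds xs
dot-+ []       []       []       = refl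
dot-+ (c ∷ cs) (d ∷ ds) (x ∷ xs) rewrite dot-+ cs ds xs | *-distribʳ-+ x c d =
  interchange (c * x) (d * x) (dot cs xs) (dot ds xs)

dot-* : ∀ {m} c (ds xs : Vec ℕ m) → dot (map (c *_) ds) xs ≡ c * dot ds xs
dot-* c []       []       = sym (*-zeroʳ c)
dot-* c (d ∷ ds) (x ∷ xs) rewrite dot-* c ds xs | *-assoc c d x =
  sym (*-distribˡ-+ c (d * x) (dot ds xs))

form-correct : ∀ {m} (e : Lin m) ρ → ⟦ form e ⟧ᶠ ρ ≡ ⟦ ρ ⟧ e
form-correct (var i) ρ = dot-unit i ρ
form-correct (# c)   ρ =
  trans (cong₂ _+_ (*-identityʳ c) (dot-zero ρ)) (+-identityʳ c)
form-correct (e ⊹ f) ρ =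
  trans (dot-+ (form e) (form f) (1 ∷ ρ)) (cong₂ _+_ (form-correct e ρ) (form-correct f ρ))
form-correct (c ⊠ e) ρ =
  trans (dot-* c (form e) (1 ∷ ρ)) (cong (c *_) (form-correct e ρ))

Ineq : ℕ → Set
Ineq m = Form m × Form m

Holds : ∀ {m} → Vec ℕ m → Ineq m → Set
Holds ρ (l , r) = ⟦ l ⟧ᶠ ρ ≤ ⟦ r ⟧ᶠ ρ

_≼ᶠ_ : ∀ {m} → Lin m → Lin m → Ineq m
e ≼ᶠ f = form e , form f

≼ᶠ-holds : ∀ {m} (e f : Lin m) ρ → ⟦ ρ ⟧ e ≤ ⟦ ρ ⟧ f → Holds ρ (e ≼ᶠ f)
≼ᶠ-holds e f ρ = subst₂ _≤_ (sym (form-correct e ρ)) (sym (form-correct f ρ))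

combination : ∀ {m} → List ℕ → List (Ineq m) → Ineq m
combination (c ∷ cs) ((l , r) ∷ is) =
  zipWith _+_ (map (c *_) l) (proj₁ (combination cs is)) ,
  zipWith _+_ (map (c *_) r) (proj₂ (combination cs is))
combination _ _ = replicate _ 0 , replicate _ 0

combination-holds : ∀ {m} ρ cs (is : List (Ineq m)) → All (Holds ρ) is → Holds ρ (combination cs is)
combination-holds ρ []       _              _        = ≤-refl
combination-holds ρ (c ∷ cs) []             _        = ≤-refl
combination-holds ρ (c ∷ cs) ((l , r) ∷ is) (h ∷ hs)
  rewrite dot-+ (map (c *_) l) (proj₁ (combination cs is)) (1 ∷ ρ)
        | dot-+ (map (c *_) r) (proj₂ (combination cs is)) (1 ∷ ρ)
        | dot-* c l (1 ∷ ρ) | dot-* c r (1 ∷ ρ) =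
  +-mono-≤ (*-monoʳ-≤ c h) (combination-holds ρ cs is hs)

_≤ᵛ_ : ∀ {m} → Vec ℕ m → Vec ℕ m → Bool
[]       ≤ᵛ []       = true
(x ∷ xs) ≤ᵛ (y ∷ ys) = does (x ≤? y) ∧ (xs ≤ᵛ ys)

-- The variables are natural numbers: a strictly larger constant and coefficients at least as large
-- on the left already force left > right. Nonnegativity is thus part of the test.
contradictory : ∀ {m} → Ineq m → Bool
contradictory (l ∷ ls , r ∷ rs) = does (suc r ≤? l) ∧ (rs ≤ᵛ ls)

IsTrue-∧ : ∀ {p q} → IsTrue (p ∧ q) → IsTrue p × IsTrue q
IsTrue-∧ {true} t = tt , t

IsTrue-does : ∀ {P : Set} (d : Dec P) → IsTrue (does d) → P
IsTrue-does (yes p) _ = p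

dot-mono : ∀ {m} (cs ds xs : Vec ℕ m) → IsTrue (cs ≤ᵛ ds) → dot cs xs ≤ dot ds xs
dot-mono []       []       []       _ = ≤-refl
dot-mono (c ∷ cs) (d ∷ ds) (x ∷ xs) t with IsTrue-∧ {does (c ≤? d)} t
... | p , q = +-mono-≤ (*-monoˡ-≤ x (IsTrue-does (c ≤? d) p)) (dot-mono cs ds xs q)

contradiction-sound : ∀ {m} ρ (i : Ineq m) → IsTrue (contradictory i) → ¬ Holds ρ i
contradiction-sound ρ (l ∷ ls , r ∷ rs) t h with IsTrue-∧ {does (suc r ≤? l)} t
... | p , q = <⇒≱ (+-mono-<-≤ (*-monoˡ-< 1 (IsTrue-does (suc r ≤? l) p)) (dot-mono rs ls ρ q)) h

-- Fourier–Motzkin elimination proposes the multipliers of a Farkas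
-- certificate; only the certificate is verified.  A row represents
-- "constant + Σ coefficient · variable ≤ 0" together with its origin.

record Row : Set where
  constructor row
  field
    coeffs : List ℤ
    const  : ℤ
    origin : List ℕ

addℤ : List ℤ → List ℤ → List ℤ
addℤ (x ∷ xs) (y ∷ ys) = x ℤ.+ y ∷ addℤ xs ys
addℤ _        _        = []

addℕ : List ℕ → List ℕ → List ℕ
addℕ (x ∷ xs) (y ∷ ys) = x + y ∷ addℕ xs ys
addℕ []       ys       = ys
addℕ xs       []       = xs

scale : ℕ → Row → Row
scale c (row cs d os) = row (List.map (pos c ℤ.*_) cs) (pos c ℤ.* d) (List.map (c *_) os)

addRow : Row → Row → Row
addRow (row cs d os) (row cs′ d′ os′) = row (addℤ cs cs′) (d ℤ.+ d′) (addℕ os os′)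

eliminate : List Row → List Row
eliminate rows = go rows [] [] []
  where
  pairs : List (ℕ × Row) → List (ℕ × Row) → List Row
  pairs []             _  = []
  pairs ((c , p) ∷ ps) ns =
    List.map (λ where (d , q) → addRow (scale d p) (scale c q)) ns ++ pairs ps ns

  go : List Row → List Row → List (ℕ × Row) → List (ℕ × Row) → List Row
  go [] zs ps ns = zs ++ pairs ps ns
  go (row []                  d os ∷ rs) zs ps ns = go rs zs ps ns
  go (row (pos zero    ∷ cs)  d os ∷ rs) zs ps ns = go rs (row cs d os ∷ zs) ps ns
  -- A positive coefficient also cancels against the tacit `0 ≤ x`, so this row survives with its
  -- variable dropped.
  go (row (pos (suc c) ∷ cs)  d os ∷ rs) zs ps ns =
    go rs (row cs d os ∷ zs) ((suc c , row cs d os) ∷ ps) ns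
  go (row (negsuc c    ∷ cs)  d os ∷ rs) zs ps ns = go rs zs ps ((suc c , row cs d os) ∷ ns)

certificate : List Row → List ℕ
certificate []                          = []
certificate (row _ (pos (suc _)) os ∷ rows) = os
certificate (_                  ∷ rows) = certificate rows

toRows : ∀ {m} → ℕ → List (Ineq m) → List Row
toRows i [] = []
toRows i ((l ∷ ls , r ∷ rs) ∷ is) =
  row (toList (zipWith _⊖_ ls rs)) (l ⊖ r) (List.replicate i 0 ++ 1 ∷ [])
    ∷ toRows (suc i) is

multipliers : ∀ {m} → List (Ineq m) → List ℕ
multipliers {m} is = certificate (iterate m (toRows 0 is))
  where
  iterate : ℕ → List Row → List Row
  iterate zero    rows = rows
  iterate (suc i) rows = iterate i (eliminate rows)

refutable : ∀ {m} → List (Ineq m) → Bool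
refutable is = contradictory (combination (multipliers is) is)

refute : ∀ {m} ρ (is : List (Ineq m)) → IsTrue (refutable is) → ¬ All (Holds ρ) is
refute ρ is t hs =
  contradiction-sound ρ (combination (multipliers is) is) t (combination-holds ρ (multipliers is) is hs)

hypothesis : ∀ {m} → Atom m → List (Ineq m)
hypothesis (e ≼ f) = (e ≼ᶠ f) ∷ []
hypothesis (e ≺ f) = (# 1 ⊹ e ≼ᶠ f) ∷ []
hypothesis (e ≐ f) = (e ≼ᶠ f) ∷ (f ≼ᶠ e) ∷ []

hypothesis-holds : ∀ {m} ρ (a : Atom m) → ⟦ ρ ⟧ᵃ a → All (Holds ρ) (hypothesis a)
hypothesis-holds ρ (e ≼ f) h = ≼ᶠ-holds e f ρ h ∷ []
hypothesis-holds ρ (e ≺ f) h = ≼ᶠ-holds (# 1 ⊹ e) f ρ h ∷ []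
hypothesis-holds ρ (e ≐ f) h =
  ≼ᶠ-holds e f ρ (≤-reflexive h) ∷ ≼ᶠ-holds f e ρ (≤-reflexive (sym h)) ∷ []

provable : ∀ {m} → List (Ineq m) → Problem m → Bool
provable is (⊢ (e ≼ f)) = refutable ((# 1 ⊹ f ≼ᶠ e) ∷ is)
provable is (⊢ (e ≺ f)) = refutable ((f ≼ᶠ e) ∷ is)
provable is (⊢ (e ≐ f)) = refutable ((# 1 ⊹ f ≼ᶠ e) ∷ is) ∧ refutable ((# 1 ⊹ e ≼ᶠ f) ∷ is)
provable is ⊢⊥          = refutable is
provable is (h ⇒ p)     = provable (hypothesis h ++ is) p

provable-sound : ∀ {m} ρ (is : List (Ineq m)) p →
                 IsTrue (provable is p) → All (Holds ρ) is → ⟦ ρ ⟧ᵖ p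
provable-sound ρ is (⊢ (e ≼ f)) t hs =
  ≮⇒≥ λ h → refute ρ _ t (≼ᶠ-holds (# 1 ⊹ f) e ρ h ∷ hs)
provable-sound ρ is (⊢ (e ≺ f)) t hs =
  ≰⇒> λ h → refute ρ _ t (≼ᶠ-holds f e ρ h ∷ hs)
provable-sound ρ is (⊢ (e ≐ f)) t hs
  with IsTrue-∧ {refutable ((# 1 ⊹ f ≼ᶠ e) ∷ is)} t
... | t₁ , t₂ = ≤-antisym
  (≮⇒≥ λ h → refute ρ _ t₁ (≼ᶠ-holds (# 1 ⊹ f) e ρ h ∷ hs))
  (≮⇒≥ λ h → refute ρ _ t₂ (≼ᶠ-holds (# 1 ⊹ e) f ρ h ∷ hs))
provable-sound ρ is ⊢⊥      t hs = refute ρ _ t hs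
provable-sound ρ is (h ⇒ p) t hs =
  λ q → provable-sound ρ _ p t (++⁺ (hypothesis-holds ρ h q) hs)

curry-∀ⁿ : ∀ m {P : Vec ℕ m → Set} → (∀ ρ → P ρ) → ∀ⁿ m (curryⁿ P)
curry-∀ⁿ zero    h = h []
curry-∀ⁿ (suc m) h = λ x → curry-∀ⁿ m (λ xs → h (x ∷ xs))

-- The implicit argument computes to the unit type when the certificate search succeeds and is then
-- inferred, so an application lists only the values of the variables and the proofs of the
-- hypotheses.
lia : ∀ m (f : N-ary m (Lin m) (Problem m)) →
      let p = f $ⁿ map var (allFin m) in
      {_ : IsTrue (provable [] p)} → ∀ⁿ m (curryⁿ λ ρ → ⟦ ρ ⟧ᵖ p)
lia m f {t} = curry-∀ⁿ m λ ρ → provable-sound ρ [] (f $ⁿ map var (allFin m)) t []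

-- Chains of edges

least : ∀ {P : ℕ → Set} → (∀ x → Dec (P x)) → ∀ {N} → P N →
        ∃[ x ] (P x × x ≤ N × (∀ y → y < x → ¬ P y))
least {P} P? {N} p = go N ≤-refl λ y y<0 → ⊥-elim (n≮0 (subst (y <_) (n∸n≡0 N) y<0))
  where
  go : ∀ d → d ≤ N → (∀ y → y < N ∸ d → ¬ P y) →
       ∃[ x ] (P x × x ≤ N × (∀ y → y < x → ¬ P y))
  go d d≤N none with P? (N ∸ d)
  go d       d≤N none | yes q = N ∸ d , q , m∸n≤m N d , none
  go zero    d≤N none | no ¬q = ⊥-elim (¬q p)
  go (suc d) d≤N none | no ¬q = go d (<⇒≤ d≤N) λ y y< → next y (subst (y <_) (+-∸-assoc 1 d≤N) y<)
    where
    next : ∀ y → y < suc (N ∸ suc d) → ¬ P y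
    next y y< with m≤n⇒m<n∨m≡n (m<1+n⇒m≤n y<)
    ... | inj₁ lt   = none y lt
    ... | inj₂ refl = ¬q

greatest : ∀ {P : ℕ → Set} → (∀ x → Dec (P x)) → ∀ {x} B → P x → x < B →
           ∃[ y ] (P y × x ≤ y × y < B × (∀ z → y < z → z < B → ¬ P z))
greatest P? {x} (suc B) p x<B with P? B
... | yes q = B , q , m<1+n⇒m≤n x<B , ≤-refl , λ z B<z z<B _ → <⇒≱ z<B B<z
... | no ¬q with m≤n⇒m<n∨m≡n (m<1+n⇒m≤n x<B)
...   | inj₂ refl = ⊥-elim (¬q p)
...   | inj₁ lt with greatest P? B p lt
...     | y , q , x≤y , y<B , none = y , q , x≤y , m<n⇒m<1+n y<B , next
  where
  next : ∀ z → y < z → z < suc B → ¬ _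
  next z y<z z<B with m≤n⇒m<n∨m≡n (m<1+n⇒m≤n z<B)
  ... | inj₁ lt′  = none z y<z lt′
  ... | inj₂ refl = ¬q

module Chains (T : ℕ → ℕ → Set) where

  -- Ch p q m x y : m edges of T, strictly increasing in both coordinates,
  -- in the rectangle [p,x) × [q,y).
  data Ch (p q : ℕ) : ℕ → ℕ → ℕ → Set where
    []   : ∀ {x y} → Ch p q 0 x y
    snoc : ∀ {m a b x y} → Ch p q m a b → T a b →
           p ≤ a → q ≤ b → a < x → b < y → Ch p q (suc m) x y

  grow : ∀ {p q m x y x′ y′} → x ≤ x′ → y ≤ y′ → Ch p q m x y → Ch p q m x′ y′
  grow x≤ y≤ []                    = []
  grow x≤ y≤ (snoc c t pa qb ax by) =
    snoc c t pa qb (<-≤-trans ax x≤) (<-≤-trans by y≤)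

  lower : ∀ {p q p′ q′ m x y} → p′ ≤ p → q′ ≤ q → Ch p q m x y → Ch p′ q′ m x y
  lower p≤ q≤ []                     = []
  lower p≤ q≤ (snoc c t pa qb ax by) =
    snoc (lower p≤ q≤ c) t (≤-trans p≤ pa) (≤-trans q≤ qb) ax by

  take : ∀ {p q m x y} m′ → m′ ≤ m → Ch p q m x y → Ch p q m′ x y
  take zero     _    _                      = []
  take (suc m′) m′≤m (snoc c t pa qb ax by) with m≤n⇒m<n∨m≡n m′≤m
  ... | inj₂ refl = snoc c t pa qb ax by
  ... | inj₁ lt   = grow (<⇒≤ ax) (<⇒≤ by) (take (suc m′) (m<1+n⇒m≤n lt) c)

  concat : ∀ {p q m x y m′ x′ y′} → p ≤ x → q ≤ y → x ≤ x′ → y ≤ y′ →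
           Ch p q m x y → Ch x y m′ x′ y′ → Ch p q (m′ + m) x′ y′
  concat px qy x≤ y≤ c []                     = grow x≤ y≤ c
  concat px qy x≤ y≤ c (snoc d t xa yb ax by) =
    snoc (concat px qy xa yb c d) t (≤-trans px xa) (≤-trans qy yb) ax by

  cons : ∀ {p q a b m x y} → T a b → p ≤ a → q ≤ b → a < x → b < y →
         Ch (suc a) (suc b) m x y → Ch p q (suc m) x y
  cons t pa qb ax by []                          = snoc [] t pa qb ax by
  cons t pa qb ax by (snoc c t′ pa′ qb′ ax′ by′) =
    snoc (cons t pa qb pa′ qb′ c) t′
      (≤-trans pa (<⇒≤ pa′)) (≤-trans qb (<⇒≤ qb′)) ax′ by′

  uncons : ∀ {p q m x y} → Ch p q (suc m) x y →
           ∃[ a ] ∃[ b ] (T a b × p ≤ a × q ≤ b × a < x × b < y × Ch (suc a) (suc b) m x y)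
  uncons (snoc [] t pa qb ax by) = _ , _ , t , pa , qb , ax , by , []
  uncons (snoc c@(snoc _ _ _ _ _ _) t pa qb ax by) with uncons c
  ... | a , b , t′ , pa′ , qb′ , ax′ , by′ , c′ =
    a , b , t′ , pa′ , qb′ , <-trans ax′ ax , <-trans by′ by , snoc c′ t ax′ by′ ax by

  nonempty : ∀ {p q m x y} → Ch p q (suc m) x y → p < x × q < y
  nonempty (snoc _ _ pa qb ax by) = ≤-<-trans pa ax , ≤-<-trans qb by

  nonempty⁺ : ∀ {p q m x y} → 0 < m → Ch p q m x y → p < x × q < y
  nonempty⁺ {m = suc _} _ = nonempty

  lengthˣ : ∀ {p q m x y} → p ≤ x → Ch p q m x y → m + p ≤ x
  lengthˣ px []                    = px
  lengthˣ px (snoc c _ pa _ ax _) = ≤-trans (s≤s (lengthˣ pa c)) ax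

  -- Ordinates increase along a chain, so the edges below `t` form an initial part. The abscissa `z`
  -- separates the two parts and lets each be glued to other chains by `concat`.
  splitʸ : ∀ {p q m x y} t → p ≤ x → Ch p q m x y →
           ∃[ m₁ ] ∃[ m₂ ] ∃[ z ] (m₁ + m₂ ≡ m × p ≤ z × z ≤ x × Ch p q m₁ z t × Ch z t m₂ x y)
  splitʸ t px [] = 0 , 0 , _ , refl , px , ≤-refl , [] , []
  splitʸ t px (snoc {b = b} c e pa qb ax by) with b <? t
  ... | yes b<t = _ , 0 , _ , +-identityʳ _ , px , ≤-refl , snoc c e pa qb ax b<t , []
  ... | no  b≮t with splitʸ t pa c
  ...   | m₁ , m₂ , z , refl , pz , za , c₁ , c₂ =
    m₁ , suc m₂ , z , +-suc m₁ m₂ , pz , ≤-trans za (<⇒≤ ax) , c₁ ,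
    snoc c₂ e za (≮⇒≥ b≮t) ax by

  splitˣ : ∀ {p q m x y} t → q ≤ y → Ch p q m x y →
           ∃[ m₁ ] ∃[ m₂ ] ∃[ z ] (m₁ + m₂ ≡ m × q ≤ z × z ≤ y × Ch p q m₁ t z × Ch t z m₂ x y)
  splitˣ t qy [] = 0 , 0 , _ , refl , qy , ≤-refl , [] , []
  splitˣ t qy (snoc {a = a} c e pa qb ax by) with a <? t
  ... | yes a<t = _ , 0 , _ , +-identityʳ _ , qy , ≤-refl , snoc c e pa qb a<t by , []
  ... | no  a≮t with splitˣ t qb c
  ...   | m₁ , m₂ , z , refl , qz , zb , c₁ , c₂ =
    m₁ , suc m₂ , z , +-suc m₁ m₂ , qz , ≤-trans zb (<⇒≤ by) , c₁ ,
    snoc c₂ e (≮⇒≥ a≮t) zb ax by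

  module _ (T? : ∀ x y → Dec (T x y)) where

    ch? : ∀ p q m x y → Dec (Ch p q m x y)
    ch? p q zero    x y = yes []
    ch? p q (suc m) x y with anyUpTo? (λ a → anyUpTo? (top? a) y) x
      where
      top? : ∀ a b → Dec (T a b × p ≤ a × q ≤ b × Ch p q m a b)
      top? a b = T? a b ×-dec p ≤? a ×-dec q ≤? b ×-dec ch? p q m a b
    ... | yes (a , ax , b , by , t , pa , qb , c) = yes (snoc c t pa qb ax by)
    ... | no none = no λ where
      (snoc c t pa qb ax by) → none (_ , ax , _ , by , t , pa , qb , c)

-- The star spanned by an angle

-- The future points of a star: in `levels`, `a` runs from u up to the middle point v and `b` from v
-- on to w. The extremality fields are to be read from the top down: given `b (suc i)`, `a i` is the
-- least abscissa at which an i-chain below that ordinate can end, and then `b i` is the highest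
-- partner of `a i` below it.
record Seq (H : ℕ → ℕ → ℕ → Set) (T : ℕ → ℕ → Set) (u v m A B : ℕ) : Set where
  field
    a b     : ℕ → ℕ
    a-bot   : a 0 ≡ u
    b-bot   : b 0 ≡ v
    a-top   : a m ≡ A
    b-top   : b m ≡ B
    a-inc   : ∀ i → i < m → a i < a (suc i)
    b-inc   : ∀ i → i < m → b i < b (suc i)
    rung    : ∀ i → 0 < i → i < m → T (a i) (b i)
    a-least : ∀ i → 0 < i → i < m → ¬ H i (a i) (b (suc i))
    b-most  : ∀ i → 0 < i → i < m → ∀ y → b i < y → y < b (suc i) → ¬ T (a i) y

extend : (ℕ → ℕ) → ℕ → ℕ → ℕ → ℕ
extend f m A i with i ≤? m
... | yes _ = f i
... | no  _ = A

extend-old : ∀ f m A {i} → i ≤ m → extend f m A i ≡ f i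
extend-old f m A {i} i≤m with i ≤? m
... | yes _ = refl
... | no ¬p = ⊥-elim (¬p i≤m)

extend-new : ∀ f m A → extend f m A (suc m) ≡ A
extend-new f m A with suc m ≤? m
... | yes p = ⊥-elim (<-irrefl refl p)
... | no _  = refl

module Kernel (k n : ℕ) (T : ℕ → ℕ → Set) where
  open Chains T public

  record KTri : Set where
    field
      T?     : ∀ x y → Dec (T x y)
      flip   : ∀ x y → T x y → T y (x + n)
      unflip : ∀ x y → T y (x + n) → T x y
      noCr   : ∀ x z → ¬ Ch x z (suc k) z (x + n)
      -- the k edges crossing (x , y), with endpoints lifted to (x,y) × (y,x+n)
      max    : ∀ x y → x < y → y < x + n → ¬ T x y → Ch (suc x) (suc y) k y (x + n)

  module Lifted (0<k : 0 < k) (2k<n : 2 * k < n) (tri : KTri) where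
    open KTri tri

    noCr-≤ : ∀ {x z m} → Ch x z m z (x + n) → m ≤ k
    noCr-≤ {x} {z} {m} c with m ≤? k
    ... | yes p = p
    ... | no ¬p = ⊥-elim (noCr x z (take (suc k) (≰⇒> ¬p) c))

    -- The k edges that cross a missing (x , y) have k distinct endpoints strictly between x and y,
    -- where fewer than k labels lie.
    short : ∀ x y → x < y → y ≤ x + k → T x y
    short x y x<y y≤ with T? x y
    ... | yes t = t
    ... | no ¬t = ⊥-elim (lia 4 (λ x y k n →
            y ≼ x ⊹ k ⇒ k ⊹ (# 1 ⊹ x) ≼ y ⇒ ⊢⊥) x y k n y≤ (lengthˣ x<y (max x y x<y y<x+n ¬t)))
      where
      y<x+n : y < x + n
      y<x+n = lia 4 (λ x y k n → y ≼ x ⊹ k ⇒ 2 ⊠ k ≺ n ⇒ ⊢ y ≺ x ⊹ n) x y k n y≤ 2k<n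

    module Angle (u v w : ℕ) (u+k≤v : u + k ≤ v) (v+k≤w : v + k ≤ w) (w<u+n : w < u + n)
                 (Tuv : T u v) (Tvw : T v w)
                 (empty : ∀ t → w < t → t < u + n → ¬ T v t) where

      H : ℕ → ℕ → ℕ → Set
      H m x y = Ch (suc u) (suc v) m x y

      u<v : u < v
      u<v = lia 3 (λ u k v → # 0 ≺ k ⇒ u ⊹ k ≼ v ⇒ ⊢ u ≺ v) u k v 0<k u+k≤v

      v<w : v < w
      v<w = lia 3 (λ u k v → # 0 ≺ k ⇒ u ⊹ k ≼ v ⇒ ⊢ u ≺ v) v k w 0<k v+k≤w

      -- Each edge of such a chain crosses (v , w), which would complete a (k+1)-crossing.
      noH : ¬ H k v w
      noH c = noCr (suc u) (suc v) (grow ≤-refl (s≤s (<⇒≤ w<u+n))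
                (snoc c Tvw u<v v<w ≤-refl ≤-refl))

      -- The edges of length k that start at the labels just above `v ∸ k`. For j = k-1 they show
      -- that the greedy construction has a chain to start from.
      base : ∀ j → j < k → H j (suc ((v ∸ k) + j)) (suc (v + j))
      base zero    _     = []
      base (suc j) 1+j<k =
        snoc (grow le₁ le₂ (base j (<-trans (n<1+n j) 1+j<k)))
             (short (z + suc j) (v + suc j) lt le) lo hi ≤-refl ≤-refl
        where
        z = v ∸ k
        z+k≡v : z + k ≡ v
        z+k≡v = m∸n+n≡m (≤-trans (m≤n+m k u) u+k≤v)
        le₁ = lia 2 (λ z j → ⊢ # 1 ⊹ (z ⊹ j) ≼ z ⊹ (# 1 ⊹ j)) z j
        le₂ = lia 2 (λ z j → ⊢ # 1 ⊹ (z ⊹ j) ≼ z ⊹ (# 1 ⊹ j)) v j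
        lt = lia 4 (λ z j k v → z ⊹ k ≐ v ⇒ # 0 ≺ k ⇒ ⊢ z ⊹ j ≺ v ⊹ j) z (suc j) k v z+k≡v 0<k
        le = lia 4 (λ z j k v → z ⊹ k ≐ v ⇒ ⊢ v ⊹ j ≼ z ⊹ j ⊹ k) z (suc j) k v z+k≡v
        lo = lia 5 (λ u z j k v → z ⊹ k ≐ v ⇒ u ⊹ k ≼ v ⇒ ⊢ # 1 ⊹ u ≼ z ⊹ (# 1 ⊹ j))
               u z j k v z+k≡v u+k≤v
        hi = lia 2 (λ v j → ⊢ # 1 ⊹ v ≼ v ⊹ (# 1 ⊹ j)) v j

      -- Greedy choice of the last rung, then recursion below it: first the smallest abscissa at
      -- which a chain of the required size can end, then the highest edge of `T` at that abscissa
      -- below `B`.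
      descend : ∀ m A B → H m A B → u < A → v < B → Seq H T u v (suc m) A B
      descend zero A B _ u<A v<B = record
        { a = λ { zero → u ; (suc _) → A } ; b = λ { zero → v ; (suc _) → B }
        ; a-bot = refl ; b-bot = refl ; a-top = refl ; b-top = refl
        ; a-inc = λ { zero _ → u<A ; (suc _) (s≤s ()) }
        ; b-inc = λ { zero _ → v<B ; (suc _) (s≤s ()) }
        ; rung = λ { (suc _) _ (s≤s ()) }
        ; a-least = λ { (suc _) _ (s≤s ()) }
        ; b-most = λ { (suc _) _ (s≤s ()) } }
      descend (suc m) A B h u<A v<B
        with least (λ x → ch? T? (suc u) (suc v) (suc m) x B) h
      ... | A′ , snoc {a = a₁} {b = b₁} c t u<a v<b a<A′ b<B , A′≤A , none
        with greatest (T? a₁) B t b<B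
      ... | b₂ , t′ , b₁≤b₂ , b₂<B , most = record
        { a = extend a (suc m) A ; b = extend b (suc m) B
        ; a-bot = trans (extend-old a (suc m) A z≤n) a-bot
        ; b-bot = trans (extend-old b (suc m) B z≤n) b-bot
        ; a-top = extend-new a (suc m) A ; b-top = extend-new b (suc m) B
        ; a-inc = inc a A a-inc (subst (_< A) (sym a-top) (<-≤-trans a<A′ A′≤A))
        ; b-inc = inc b B b-inc (subst (_< B) (sym b-top) b₂<B)
        ; rung = rung′ ; a-least = least′ ; b-most = most′ }
        where
        open Seq (descend m a₁ b₂ (grow ≤-refl b₁≤b₂ c) u<a (≤-trans v<b b₁≤b₂))

        inc : ∀ (f : ℕ → ℕ) F → (∀ i → i < suc m → f i < f (suc i)) → f (suc m) < F →
              ∀ i → i < suc (suc m) → extend f (suc m) F i < extend f (suc m) F (suc i)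
        inc f F h top i i< with m≤n⇒m<n∨m≡n (m<1+n⇒m≤n i<)
        ... | inj₁ lt = subst₂ _<_ (sym (extend-old f (suc m) F (<⇒≤ lt)))
                          (sym (extend-old f (suc m) F lt)) (h i lt)
        ... | inj₂ refl = subst₂ _<_ (sym (extend-old f (suc m) F ≤-refl))
                            (sym (extend-new f (suc m) F)) top

        rung′ : ∀ i → 0 < i → i < suc (suc m) → T (extend a (suc m) A i) (extend b (suc m) B i)
        rung′ i 0<i i<
          rewrite extend-old a (suc m) A (m<1+n⇒m≤n i<) | extend-old b (suc m) B (m<1+n⇒m≤n i<)
          with m≤n⇒m<n∨m≡n (m<1+n⇒m≤n i<)
        ... | inj₁ lt   = rung i 0<i lt
        ... | inj₂ refl = subst₂ T (sym a-top) (sym b-top) t′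

        least′ : ∀ i → 0 < i → i < suc (suc m) →
                 ¬ H i (extend a (suc m) A i) (extend b (suc m) B (suc i))
        least′ i 0<i i< c
          with m≤n⇒m<n∨m≡n (m<1+n⇒m≤n i<)
        ... | inj₁ lt   = a-least i 0<i lt (subst₂ (H i) (extend-old a (suc m) A (<⇒≤ lt))
                            (extend-old b (suc m) B lt) c)
        ... | inj₂ refl = none a₁ a<A′ (subst₂ (H (suc m))
                            (trans (extend-old a (suc m) A ≤-refl) a-top)
                            (extend-new b (suc m) B) c)

        most′ : ∀ i → 0 < i → i < suc (suc m) → ∀ y → extend b (suc m) B i < y →
                y < extend b (suc m) B (suc i) → ¬ T (extend a (suc m) A i) y
        most′ i 0<i i< y lo hi e
          with m≤n⇒m<n∨m≡n (m<1+n⇒m≤n i<)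
        ... | inj₁ lt = b-most i 0<i lt y
                (subst (_< y) (extend-old b (suc m) B (<⇒≤ lt)) lo)
                (subst (y <_) (extend-old b (suc m) B lt) hi)
                (subst (λ x → T x y) (extend-old a (suc m) A (<⇒≤ lt)) e)
        ... | inj₂ refl = most y
                (subst (_< y) (trans (extend-old b (suc m) B ≤-refl) b-top) lo)
                (subst (y <_) (extend-new b (suc m) B) hi)
                (subst (λ x → T x y) (trans (extend-old a (suc m) A ≤-refl) a-top) e)

      abstract
        levels : Seq H T u v k v w
        levels = subst (λ m → Seq H T u v m v w) 1+k′≡k (descend k′ v w h u<v v<w)
          where
          k′ : ℕ
          k′ = k ∸ 1
          1+k′≡k : suc k′ ≡ k
          1+k′≡k = m+[n∸m]≡n 0<k
          h : H k′ v w
          h = grow (lia 4 (λ z k k′ v → z ⊹ k ≐ v ⇒ # 1 ⊹ k′ ≐ k ⇒ ⊢ # 1 ⊹ (z ⊹ k′) ≼ v)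
                      (v ∸ k) k k′ v (m∸n+n≡m (≤-trans (m≤n+m k u) u+k≤v)) 1+k′≡k)
                   (lia 4 (λ v k k′ w → v ⊹ k ≼ w ⇒ # 1 ⊹ k′ ≐ k ⇒ ⊢ # 1 ⊹ (v ⊹ k′) ≼ w)
                      v k k′ w v+k≤w 1+k′≡k)
                   (base k′ (≤-reflexive 1+k′≡k))

      open Seq levels public

      growth : ∀ (f : ℕ → ℕ) → (∀ i → i < k → f i < f (suc i)) → ∀ d i → d + i ≤ k → d + f i ≤ f (d + i)
      growth f inc zero    i _ = ≤-refl
      growth f inc (suc d) i h = ≤-trans (s≤s (growth f inc d i (<⇒≤ h))) (inc (d + i) h)

      rung⁺ : ∀ i → i ≤ k → T (a i) (b i)
      rung⁺ zero    _ = subst₂ T (sym a-bot) (sym b-bot) Tuv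
      rung⁺ (suc i) h with m≤n⇒m<n∨m≡n h
      ... | inj₁ lt   = rung (suc i) (s≤s z≤n) lt
      ... | inj₂ refl = subst₂ T (sym a-top) (sym b-top) Tvw

      module _ {f : ℕ → ℕ} (inc : ∀ i → i < k → f i < f (suc i)) where

        above-bottom : ∀ {i} → i ≤ k → i + f 0 ≤ f i
        above-bottom {i} h = subst (λ j → i + f 0 ≤ f j) (+-identityʳ i)
          (growth f inc i 0 (subst (_≤ k) (sym (+-identityʳ i)) h))

        below-top : ∀ {i} d → d + i ≡ k → d + f i ≤ f k
        below-top {i} d refl = growth f inc d i ≤-refl

      u≤a : ∀ {i} → i ≤ k → u ≤ a i
      u≤a {i} h = ≤-trans (m≤n+m u i) (subst (λ x → i + x ≤ a i) a-bot (above-bottom a-inc h))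

      v+i≤b : ∀ {i} → i ≤ k → i + v ≤ b i
      v+i≤b {i} h = subst (λ x → i + x ≤ b i) b-bot (above-bottom b-inc h)

      a+d≤v : ∀ {i} d → d + i ≡ k → d + a i ≤ v
      a+d≤v {i} d h = subst (d + a i ≤_) a-top (below-top a-inc d h)

      b+d≤w : ∀ {i} d → d + i ≡ k → d + b i ≤ w
      b+d≤w {i} d h = subst (d + b i ≤_) b-top (below-top b-inc d h)

      seg : ∀ i d → d + i ≤ k → Ch (a i) (b i) (suc d) (suc (a (d + i))) (suc (b (d + i)))
      seg i zero    h = snoc [] (rung⁺ i h) ≤-refl ≤-refl ≤-refl ≤-refl
      seg i (suc d) h = snoc (grow (a-inc _ h) (b-inc _ h) (seg i d (<⇒≤ h))) (rung⁺ _ h)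
        (≤-trans (m≤n+m _ (suc d)) (growth a a-inc (suc d) i h))
        (≤-trans (m≤n+m _ (suc d)) (growth b b-inc (suc d) i h)) ≤-refl ≤-refl

      rungsH : ∀ i → i ≤ k → H i (suc (a i)) (suc (b i))
      rungsH zero    h = []
      rungsH (suc i) h = subst (λ j → H (suc i) (suc (a j)) (suc (b j))) (+-comm i 1)
        (lower (subst (λ x → suc x ≤ a 1) a-bot (above-bottom a-inc 0<k))
               (v+i≤b 0<k) (seg 1 i (subst (_≤ k) (+-comm 1 i) h)))

      -- The rungs are the upper-left extremal (k-1)-chain of (u,v) × (v,w).
      extremal : ∀ d i x y → suc d + suc i ≡ k → H i x y → T x y → u < x → v < y →
                 x < v → y < w → Ch (suc x) (suc y) d v w → a (suc i) ≤ x × y ≤ b (suc i)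
      extremal d i x y eq h t u<x v<y x<v y<w c = a≤x , y≤b
        where
        1+i<k : suc i < k
        1+i<k = lia 3 (λ d i k → # 1 ⊹ d ⊹ i ≐ k ⇒ ⊢ i ≺ k) d (suc i) k eq

        next : ∀ d → suc d + suc i ≡ k → Ch (suc x) (suc y) d v w → y < b (suc (suc i))
        next zero     eq′ _  = subst (λ j → y < b j) (sym eq′) (subst (y <_) (sym b-top) y<w)
        next (suc d′) eq′ c′ with uncons c′
        ... | x₁ , y₁ , t₁ , x<x₁ , y<y₁ , x₁<v , y₁<w , c₁ =
          <-≤-trans y<y₁ (proj₂ (extremal d′ (suc i) x₁ y₁
            (trans (cong suc (+-suc d′ (suc i))) eq′) (snoc h t u<x v<y x<x₁ y<y₁) t₁
            (<-trans u<x x<x₁) (<-trans v<y y<y₁) x₁<v y₁<w c₁))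

        y<b : y < b (suc (suc i))
        y<b = next d eq c

        a≤x : a (suc i) ≤ x
        a≤x = ≮⇒≥ λ x<a → a-least (suc i) (s≤s z≤n) 1+i<k (snoc h t u<x v<y x<a y<b)

        y≤b : y ≤ b (suc i)
        y≤b = ≮⇒≥ λ b<y → case b<y (m≤n⇒m<n∨m≡n a≤x)
          where
          case : b (suc i) < y → a (suc i) < x ⊎ a (suc i) ≡ x → ⊥
          case b<y (inj₂ refl) = b-most (suc i) (s≤s z≤n) 1+i<k y b<y y<b t
          case b<y (inj₁ a<x)  = noH (subst (λ m → H m v w)
            (trans (+-suc d (suc i)) eq)
            (concat (m≤n⇒m≤1+n u<x) (m≤n⇒m≤1+n v<y) x<v y<w
              (snoc (grow a<x b<y (rungsH (suc i) (<⇒≤ 1+i<k))) t u<x v<y ≤-refl ≤-refl) c))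

      -- Preceded by the rungs 1 to i, such a chain would have k-1 edges, with edge number i+1 above
      -- `b (suc i)`, against `extremal`.
      noUpper : ∀ d i → suc (suc d) + i ≡ k → ¬ Ch (suc (a i)) (suc (b (suc i))) (suc d) v w
      noUpper d i eq c with uncons c
      ... | x , y , t , a<x , b<y , x<v , y<w , c′ =
        <⇒≱ b<y (proj₂ (extremal d i x y (trans (+-suc (suc d) i) eq)
          (grow a<x (≤-trans (s≤s (<⇒≤ (b-inc i i<k))) b<y) (rungsH i (<⇒≤ i<k))) t
          (≤-<-trans (u≤a (<⇒≤ i<k)) a<x)
          (≤-<-trans (≤-trans (m≤n+m v _) (v+i≤b i<k)) b<y) x<v y<w c′))
        where
        i<k : i < k
        i<k = lia 3 (λ d i k → # 2 ⊹ d ⊹ i ≐ k ⇒ ⊢ i ≺ k) d i k eq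

      -- The top edge is compared with rung j. If it ends lower, the rung can follow it, which gains
      -- an edge. If not, and it starts beyond rung j-1, it extends the rungs 1 to j-1 to a j-chain.
      -- In the remaining case both it and rung j are put aside and the comparison continues one
      -- level down.
      exchange : ∀ j → j ≤ k → ∀ {z r x y} → j < r → x ≤ a j → Ch u z r x y →
                 H j x y ⊎ Ch u z (suc r) (suc (a j)) (suc (b j))
      exchange zero    _   _   _   _ = inj₁ []
      exchange (suc j) j≤k (s≤s j<r) x≤a (snoc {a = c} {b = d} ch@(snoc _ _ u≤c′ z≤d′ c′<c d′<d) t u≤c z≤d c<x d<y)
        with d <? b (suc j)
      ... | yes d<b = inj₂ (snoc (snoc ch t u≤c z≤d (<-≤-trans c<x x≤a) d<b) (rung⁺ (suc j) j≤k)
                        (u≤a j≤k) (≤-trans z≤d (<⇒≤ d<b)) ≤-refl ≤-refl)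
      ... | no  d≮b with a j <? c
      ...   | yes a<c = inj₁ (snoc (grow a<c (≤-trans (b-inc j j≤k) (≮⇒≥ d≮b)) (rungsH j (<⇒≤ j≤k))) t
                          (≤-<-trans u≤c′ c′<c)
                          (≤-trans (s≤s (m≤n+m v j)) (≤-trans (v+i≤b j≤k) (≮⇒≥ d≮b))) c<x d<y)
      ...   | no  a≮c with exchange j (<⇒≤ j≤k) j<r (≮⇒≥ a≮c) ch
      ...     | inj₁ h  = inj₁ (snoc h t (≤-<-trans u≤c′ c′<c)
                            (≤-trans (s≤s (m≤n+m v j)) (≤-trans (v+i≤b j≤k) (≮⇒≥ d≮b))) c<x d<y)
      ...     | inj₂ c₂ = inj₂ (snoc (grow (a-inc j j≤k) (b-inc j j≤k) c₂) (rung⁺ (suc j) j≤k)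
                            (u≤a j≤k) (<⇒≤ (<-≤-trans (proj₂ (nonempty c₂)) (b-inc j j≤k))) ≤-refl ≤-refl)

      -- The mirror image of `exchange`: it starts from the lowest edge, moves up through the rungs
      -- j, j+1, ..., and fills up with the rungs before (v , w).
      exchange′ : ∀ d j → d + j ≡ k → ∀ {z r x y} → d < r → b j < y → Ch x y r z (suc w) →
                  Ch x y d v w ⊎ Ch (a j) (b j) (suc r) z (suc w)
      exchange′ zero    j eq _ _ _ = inj₁ []
      exchange′ (suc d) j eq {z} (s≤s d<r) b<y ch with uncons ch
      ... | c , e , t , x≤c , y≤e , c<z , e<w , c′@(snoc _ _ _ e<e′ _ e′<w)
        with a j <? c
      ... | yes a<c = inj₂ (cons (rung⁺ j j≤k) ≤-refl ≤-refl (<-trans a<c c<z)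
                        (<-trans b<y (≤-<-trans y≤e e<w))
                        (cons t a<c (≤-trans b<y y≤e) c<z e<w c′))
        where
        j≤k : j ≤ k
        j≤k = lia 3 (λ d j k → d ⊹ j ≐ k ⇒ ⊢ j ≼ k) (suc d) j k eq
      ... | no a≮c with e <? b (suc j)
      ...   | yes e<b = inj₁ (cons t x≤c y≤e (≤-<-trans (≮⇒≥ a≮c) a<v)
                          (≤-trans e<e′ (m<1+n⇒m≤n e′<w)) (rest d eq))
        where
        a<v : a j < v
        a<v = ≤-trans (s≤s (m≤n+m (a j) d)) (a+d≤v (suc d) eq)
        rest : ∀ d → suc d + j ≡ k → Ch (suc c) (suc e) d v w
        rest zero    _  = []
        rest (suc d) eq = grow (lt a a-inc a-top) (lt b b-inc b-top)
          (lower (≤-<-trans (≮⇒≥ a≮c) (a-inc j j<k)) e<b (seg (suc j) d (<⇒≤ top)))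
          where
          top : suc (d + suc j) ≤ k
          top = ≤-reflexive (trans (cong suc (+-suc d j)) eq)
          j<k : j < k
          j<k = lia 3 (λ d j k → # 1 ⊹ d ⊹ j ≐ k ⇒ ⊢ j ≺ k) (suc d) j k eq
          lt : ∀ (f : ℕ → ℕ) → (∀ i → i < k → f i < f (suc i)) → ∀ {v} → f k ≡ v → f (d + suc j) < v
          lt f inc refl = subst (λ i → f (d + suc j) < f i)
                            (trans (cong suc (+-suc d j)) eq) (inc _ top)
      ...   | no e≮b with exchange′ d (suc j) (trans (+-suc d j) eq) d<r (s≤s (≮⇒≥ e≮b)) c′
      ...     | inj₁ c₁ = inj₁ (cons t x≤c y≤e
                            (≤-<-trans (≮⇒≥ a≮c) (≤-trans (s≤s (m≤n+m (a j) d)) (a+d≤v (suc d) eq)))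
                            (≤-trans e<e′ (m<1+n⇒m≤n e′<w)) c₁)
      ...     | inj₂ c₂ = inj₂ (cons (rung⁺ j (<⇒≤ j<k)) ≤-refl ≤-refl
                            (<-trans (a-inc j j<k) (proj₁ (nonempty c₂)))
                            (<-trans (b-inc j j<k) (proj₂ (nonempty c₂)))
                            (lower (a-inc j j<k) (b-inc j j<k) c₂))
        where
        j<k : j < k
        j<k = lia 3 (λ d j k → # 1 ⊹ d ⊹ j ≐ k ⇒ ⊢ j ≺ k) d j k eq

      unflipCh : ∀ {p q m x y} → Ch p (q + n) m x (y + n) → Ch q p m y x
      unflipCh [] = []
      unflipCh {q = q} (snoc {a = c} {b = d} ch t pc qd cx dy) =
        snoc (unflipCh (subst (Ch _ _ _ c) (sym d≡) ch)) (unflip (d ∸ n) c (subst (T c) (sym d≡) t))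
          (+-cancelʳ-≤ n _ _ (subst (q + n ≤_) (sym d≡) qd)) pc
          (+-cancelʳ-< n _ _ (subst (_< _) (sym d≡) dy)) cx
        where
        d≡ : d ∸ n + n ≡ d
        d≡ = m∸n+n≡m (≤-trans (m≤n+m n q) qd)

      -- An edge at v itself would lie in the gap that `empty` excludes, as all ordinates are
      -- between w and u + n.
      avoid-v : ∀ {t m x y} → w < t → y ≤ u + n → Ch v t m x y → Ch (suc v) t m x y
      avoid-v w<t y≤ [] = []
      avoid-v w<t y≤ (snoc {b = d} c e v≤a t≤b ax by) with m≤n⇒m<n∨m≡n v≤a
      ... | inj₁ v<a  = snoc (avoid-v w<t (≤-trans (<⇒≤ by) y≤) c) e v<a t≤b ax by
      ... | inj₂ refl = ⊥-elim (empty d (<-≤-trans w<t t≤b) (<-≤-trans by y≤) e)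

      -- The k edges that cross a missing edge are sorted by their far ends: up to w (r′ of them),
      -- between w and u + n (κ, of which κ₁ start before v), and from u + n on (r, turned round in
      -- `L`). Then r′ + κ₁ ≤ d = k-1-i and r + κ₂ ≤ i, which leaves at most k-1 edges.
      step : ∀ i → i < k → T (a i) (b (suc i))
      step i i<k with T? (a i) (b (suc i))
      ... | yes t = t
      ... | no ¬t = ⊥-elim absurd
        where
        d = k ∸ suc i
        d≡ : d + suc i ≡ k
        d≡ = m∸n+n≡m i<k
        i≤k = <⇒≤ i<k
        b≤w : b (suc i) ≤ w
        b≤w = ≤-trans (m≤n+m _ d) (b+d≤w d d≡)
        a<v : a i < v
        a<v = ≤-trans (s≤s (m≤n+m (a i) d)) (a+d≤v (suc d) (trans (sym (+-suc d i)) d≡))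
        v<b : v < b (suc i)
        v<b = ≤-trans (s≤s (m≤n+m v i)) (v+i≤b i<k)
        w<a+n : w < a i + n
        w<a+n = <-≤-trans w<u+n (+-monoˡ-≤ n (u≤a i≤k))

        F = max (a i) (b (suc i)) (<-trans a<v v<b) (≤-<-trans b≤w w<a+n) ¬t
        splitF = splitʸ (suc w) (<-trans a<v v<b) F

        absurd : ⊥
        absurd with splitF
        ... | r′ , m₂ , z₁ , r′+m₂ , a<z₁ , z₁≤b , G , R
          with splitʸ (u + n) z₁≤b R
        ... | κ , r , z₂ , κ+r , z₁≤z₂ , z₂≤b , K , Hi
          with splitˣ v w<u+n K
        ... | κ₁ , κ₂ , t , κ₁+κ₂ , w<t , t≤u+n , K₁ , K₂ = lia 9
              (λ r′ m₂ κ r κ₁ κ₂ d i k → r′ ⊹ m₂ ≐ k ⇒ κ ⊹ r ≐ m₂ ⇒ κ₁ ⊹ κ₂ ≐ κ ⇒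
                 d ⊹ (# 1 ⊹ i) ≐ k ⇒ r′ ⊹ κ₁ ≼ d ⇒ r ⊹ κ₂ ≼ i ⇒ ⊢⊥)
              r′ m₂ κ r κ₁ κ₂ d i k r′+m₂ κ+r κ₁+κ₂ d≡ (claim₁ κ₁ K₁) (claim₂ κ₂ K₂)
          where
          L : Ch u z₂ r (a i) (b (suc i))
          L = unflipCh Hi

          -- An excess is impossible by `exchange`: an i-chain would contradict the choice of `a i`,
          -- and a gained edge would make a (k+1)-crossing together with `G` and `K`.
          boundʳ : r ≤ i
          boundʳ = ≮⇒≥ λ i<r → case i i<r refl (exchange i i≤k i<r ≤-refl L)
            where
            case : ∀ j → j < r → j ≡ i → H j (a i) (b (suc i)) ⊎ Ch u z₂ (suc r) (suc (a i)) (suc (b i)) → ⊥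
            case zero 0<r refl (inj₁ _) = <-irrefl (sym a-bot) (proj₁ (nonempty⁺ 0<r L))
            case (suc j) _ refl (inj₁ h) = a-least i (s≤s z≤n) i<k h
            case _ _ refl (inj₂ c) = lia 5 (λ κ r r′ m₂ k → κ ⊹ (r′ ⊹ (# 1 ⊹ r)) ≼ k ⇒
                r′ ⊹ m₂ ≐ k ⇒ κ ⊹ r ≐ m₂ ⇒ ⊢⊥) κ r r′ m₂ k
              (noCr-≤ (concat (≤-trans (u≤a i≤k) (≤-trans (n≤1+n _) a<z₁)) z₂≤w z₁≤z₂ w<u+n
                (concat (m≤n⇒m≤1+n (u≤a i≤k)) (<⇒≤ (proj₂ (nonempty c))) a<z₁
                  (s≤s (≤-trans (<⇒≤ (b-inc i i<k)) b≤w)) c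
                  (lower ≤-refl (s≤s (<⇒≤ (b-inc i i<k))) G)) K))
                r′+m₂ κ+r
              where
              z₂≤w : z₂ ≤ suc w
              z₂≤w = ≤-trans z₂≤b (m≤n⇒m≤1+n b≤w)

          boundʳ′ : r′ ≤ d
          boundʳ′ = ≮⇒≥ λ d<r′ → case d d<r′ d≡ (exchange′ d (suc i) d≡ d<r′ ≤-refl G)
            where
            case : ∀ d → d < r′ → d + suc i ≡ k →
                   Ch (suc (a i)) (suc (b (suc i))) d v w ⊎ Ch (a (suc i)) (b (suc i)) (suc r′) z₁ (suc w) → ⊥
            case zero 0<r′ eq (inj₁ _) =
              <-irrefl (trans (cong b eq) b-top) (≤-pred (proj₂ (nonempty⁺ 0<r′ G)))
            case (suc d) _ eq (inj₁ c) = noUpper d i (trans (cong suc (sym (+-suc d i))) eq) c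
            case _ _ _ (inj₂ c) = lia 3 (λ m₂ r′ k → m₂ ⊹ (# 1 ⊹ r′) ≼ k ⇒ r′ ⊹ m₂ ≐ k ⇒ ⊢⊥) m₂ r′ k
              (noCr-≤ (grow ≤-refl (+-monoˡ-≤ n (<⇒≤ (a-inc i i<k)))
                (concat (<⇒≤ (proj₁ (nonempty c))) (m≤n⇒m≤1+n b≤w) z₁≤b w<a+n c R))) r′+m₂

          -- If κ₁ is positive, all these r′ + κ₁ edges start before v, and the rungs 0 to i precede
          -- them in a common crossing; otherwise the bound on r′ suffices.
          claim₁ : ∀ κ₁ → Ch z₁ (suc w) κ₁ v t → r′ + κ₁ ≤ d
          claim₁ zero     _   = subst (_≤ d) (sym (+-identityʳ r′)) boundʳ′
          claim₁ (suc κ′) K₁′ = lia 5 (λ κ r′ i d k → κ ⊹ (r′ ⊹ (# 1 ⊹ i)) ≼ k ⇒ d ⊹ (# 1 ⊹ i) ≐ k ⇒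
                ⊢ r′ ⊹ κ ≼ d) (suc κ′) r′ i d k (noCr-≤ crossing) d≡
            where
            z₁<v = proj₁ (nonempty K₁′)
            e₀ : Ch u v (suc i) (suc (a i)) (suc (b i))
            e₀ = subst₂ (λ x y → Ch x y (suc i) (suc (a i)) (suc (b i))) a-bot b-bot
                   (subst (λ j → Ch (a 0) (b 0) (suc i) (suc (a j)) (suc (b j))) (+-identityʳ i)
                     (seg 0 i (subst (_≤ k) (sym (+-identityʳ i)) i≤k)))
            v≤b : v ≤ b i
            v≤b = ≤-trans (m≤n+m v i) (v+i≤b i≤k)
            crossing : Ch u v (suc κ′ + (r′ + suc i)) v (u + n)
            crossing = grow ≤-refl t≤u+n
              (concat (≤-trans (u≤a i≤k) (≤-trans (n≤1+n _) a<z₁)) (m≤n⇒m≤1+n (<⇒≤ v<w))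
                 (<⇒≤ z₁<v) w<t
                 (concat (m≤n⇒m≤1+n (u≤a i≤k)) (m≤n⇒m≤1+n v≤b) a<z₁
                    (s≤s (≤-trans (<⇒≤ (b-inc i i<k)) b≤w)) e₀
                    (lower ≤-refl (s≤s (<⇒≤ (b-inc i i<k))) G)) K₁′)

          -- Dually, the rungs i+1 to k stand between the r reversed edges and the κ₂ edges;
          -- `avoid-v` makes the latter start after the last rung (v , w).
          claim₂ : ∀ κ₂ → Ch v t κ₂ z₂ (u + n) → r + κ₂ ≤ i
          claim₂ zero     _   = subst (_≤ i) (sym (+-identityʳ r)) boundʳ
          claim₂ (suc κ′) K₂′ = lia 5 (λ κ r i d k → κ ⊹ (# 1 ⊹ d ⊹ r) ≼ k ⇒ d ⊹ (# 1 ⊹ i) ≐ k ⇒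
                ⊢ r ⊹ κ ≼ i) (suc κ′) r i d k (noCr-≤ crossing) d≡
            where
            v<z₂ = proj₁ (nonempty K₂′)
            top : Ch (a (suc i)) (b (suc i)) (suc d) (suc v) (suc w)
            top = subst₂ (λ x y → Ch (a (suc i)) (b (suc i)) (suc d) (suc x) (suc y))
                    (trans (cong a d≡) a-top) (trans (cong b d≡) b-top)
                    (seg (suc i) d (≤-reflexive d≡))
            crossing : Ch u z₂ (suc κ′ + (suc d + r)) z₂ (u + n)
            crossing = concat (m≤n⇒m≤1+n (<⇒≤ u<v)) (≤-trans z₂≤b (m≤n⇒m≤1+n b≤w)) v<z₂ w<u+n
              (concat (u≤a i<k) z₂≤b
                 (m≤n⇒m≤1+n (≤-trans (m≤n+m _ d) (a+d≤v d d≡))) (m≤n⇒m≤1+n b≤w)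
                 (grow (<⇒≤ (a-inc i i<k)) ≤-refl L) top)
              (lower ≤-refl w<t (avoid-v w<t ≤-refl K₂′))

-- Residues modulo n = suc n′

module Residues (n′ : ℕ) where

  n : ℕ
  n = suc n′

  π : ℕ → Fin n
  π x = fromℕ< (m%n<n x n)

  toℕ-π : ∀ x → toℕ (π x) ≡ x % n
  toℕ-π x = toℕ-fromℕ< (m%n<n x n)

  π-cong : ∀ x y → x % n ≡ y % n → π x ≡ π y
  π-cong x y h = toℕ-injective (trans (toℕ-π x) (trans h (sym (toℕ-π y))))

  π-shift : ∀ x q → π (x + q * n) ≡ π x
  π-shift x q = π-cong (x + q * n) x ([m+kn]%n≡m%n x q n)

  π-+n : ∀ x → π (x + n) ≡ π x
  π-+n x = π-cong (x + n) x ([m+n]%n≡m%n x n)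

  π-toℕ : ∀ a → π (toℕ a) ≡ a
  π-toℕ a = toℕ-injective (trans (toℕ-π (toℕ a)) (m<n⇒m%n≡m (toℕ<n a)))

  π-lift : ∀ x → x ≡ toℕ (π x) + x / n * n
  π-lift x = trans (m≡m%n+[m/n]*n x n) (cong (_+ x / n * n) (sym (toℕ-π x)))

  π-⊕ : ∀ x m → π x ⊕ m ≡ π (x + m)
  π-⊕ x m = trans (sym (π-shift (toℕ (π x) + m) (x / n))) (cong π
    (trans (lia 3 (λ r m q → ⊢ r ⊹ m ⊹ q ≐ r ⊹ q ⊹ m) (toℕ (π x)) m (x / n * n))
      (cong (_+ m) (sym (π-lift x)))))

  ⊕-⊕ : ∀ (a : Fin n) l m → (a ⊕ l) ⊕ m ≡ a ⊕ (l + m)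
  ⊕-⊕ a l m = trans (π-⊕ (toℕ a + l) m) (cong π (+-assoc (toℕ a) l m))

  ⊕-n : ∀ (a : Fin n) → a ⊕ n ≡ a
  ⊕-n a = trans (π-+n (toℕ a)) (π-toℕ a)

  private
    π-far : ∀ x y a → π x ≡ π y → a ≤ x → y < a + n → ¬ (x / n < y / n)
    π-far x y a eq a≤x y<a+n q< = lia 7
      (λ a x y n r p q → a ≼ x ⇒ y ≺ a ⊹ n ⇒ x ≐ r ⊹ p ⇒ y ≐ r ⊹ q ⇒ n ⊹ p ≼ q ⇒ ⊢⊥)
      a x y n (toℕ (π x)) (x / n * n) (y / n * n) a≤x y<a+n (π-lift x)
      (trans (π-lift y) (cong (λ r → toℕ r + y / n * n) (sym eq))) (*-monoˡ-≤ n q<)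

  π-window : ∀ {x y} a → π x ≡ π y → a ≤ x → x < a + n → a ≤ y → y < a + n → x ≡ y
  π-window {x} {y} a eq a≤x x<a+n a≤y y<a+n with <-cmp (x / n) (y / n)
  ... | tri≈ _ q≡ _ = trans (π-lift x) (trans (cong₂ (λ r q → toℕ r + q * n) eq q≡) (sym (π-lift y)))
  ... | tri< q< _ _ = ⊥-elim (π-far x y a eq a≤x y<a+n q<)
  ... | tri> _ _ q> = ⊥-elim (π-far y x a (sym eq) a≤y x<a+n q>)

-- Periodic stars

module Stars (k n′ : ℕ) (T : ℕ → ℕ → Set) (0<k : 0 < k) (2k+3≤n : 2 * k + 3 ≤ suc n′)
             (tri : Kernel.KTri k (suc n′) T) where

  open Residues n′ public

  M : ℕ
  M = suc (2 * k)

  2k<n : 2 * k < n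
  2k<n = lia 2 (λ k n → 2 ⊠ k ⊹ # 3 ≼ n ⇒ ⊢ 2 ⊠ k ≺ n) k n 2k+3≤n

  M<n : M < n
  M<n = lia 2 (λ k n → 2 ⊠ k ⊹ # 3 ≼ n ⇒ ⊢ # 1 ⊹ 2 ⊠ k ≺ n) k n 2k+3≤n

  open Kernel k n T
  open KTri tri
  open Lifted 0<k 2k<n tri using (short; module Angle)

  -- The points of a star, repeated with period n; the edges of the star
  -- are then all the pairs (s j , s (k + j)).
  record Star : Set where
    field
      s     : ℕ → ℕ
      inc   : ∀ j → s j < s (suc j)
      per   : ∀ j → s (M + j) ≡ s j + n
      chord : ∀ j → T (s j) (s (k + j))

  shift : ∀ {x y} → T x y → T (x + n) (y + n)
  shift {x} {y} t = flip y (x + n) (flip x y t)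

  unshift : ∀ {x y} → T (x + n) (y + n) → T x y
  unshift {x} {y} t = unflip x y (unflip y (x + n) t)

  private
    +n-step : ∀ x q → x + suc q * n ≡ x + q * n + n
    +n-step x q = trans (cong (λ z → x + z) (+-comm n (q * n))) (sym (+-assoc x (q * n) n))

  shifts : ∀ q {x y} → T x y → T (x + q * n) (y + q * n)
  shifts zero    t = subst₂ T (sym (+-identityʳ _)) (sym (+-identityʳ _)) t
  shifts (suc q) t = subst₂ T (sym (+n-step _ q)) (sym (+n-step _ q)) (shift (shifts q t))

  unshifts : ∀ q {x y} → T (x + q * n) (y + q * n) → T x y
  unshifts zero    t = subst₂ T (+-identityʳ _) (+-identityʳ _) t
  unshifts (suc q) t = unshifts q (unshift (subst₂ T (+n-step _ q) (+n-step _ q) t))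

  module Unroll (f : ℕ → ℕ) (f-inc : ∀ j → j < 2 * k → f j < f (suc j))
                (f-wrap : f (2 * k) < f 0 + n)
                (f-chord : ∀ j → j ≤ k → T (f j) (f (k + j)))
                (f-chord′ : ∀ j → j < k → T (f j) (f (k + suc j))) where

    g : ℕ → ℕ
    g j = f (j % M) + (j / M) * n

    g-eq : ∀ r q → r < M → g (r + q * M) ≡ f r + q * n
    g-eq r q r<M = cong₂ (λ i p → f i + p * n) rem quot
      where
      rem : (r + q * M) % M ≡ r
      rem = trans ([m+kn]%n≡m%n r q M) (m<n⇒m%n≡m r<M)
      quot : (r + q * M) / M ≡ q
      quot = *-cancelʳ-≡ _ q M (+-cancelˡ-≡ r _ _
        (trans (cong (_+ (r + q * M) / M * M) (sym rem)) (sym (m≡m%n+[m/n]*n (r + q * M) M))))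

    g-init : ∀ j → j < M → g j ≡ f j
    g-init j j<M = trans (cong g (sym (+-identityʳ j))) (trans (g-eq j 0 j<M) (+-identityʳ _))

    decompose : ∀ {P : ℕ → Set} → (∀ r q → r < M → P (r + q * M)) → ∀ j → P j
    decompose {P} h j = subst P (sym (m≡m%n+[m/n]*n j M)) (h (j % M) (j / M) (m%n<n j M))

    unrolled : Star
    unrolled = record
      { s = g ; inc = decompose g-inc ; per = decompose g-per ; chord = decompose g-chord }
      where
      g-inc : ∀ r q → r < M → g (r + q * M) < g (suc (r + q * M))
      g-inc r q r<M with m≤n⇒m<n∨m≡n (m<1+n⇒m≤n r<M)
      ... | inj₁ lt   = subst₂ _<_ (sym (g-eq r q r<M)) (sym (g-eq (suc r) q (s≤s lt)))
                          (+-monoˡ-< (q * n) (f-inc r lt))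
      ... | inj₂ refl = subst₂ _<_ (sym (g-eq r q r<M)) (sym (g-eq 0 (suc q) (s≤s z≤n)))
                          (subst (f r + q * n <_) (+-assoc (f 0) n (q * n)) (+-monoˡ-< (q * n) f-wrap))

      g-per : ∀ r q → r < M → g (M + (r + q * M)) ≡ g (r + q * M) + n
      g-per r q r<M = trans (cong g (lia 3 (λ M r x → ⊢ M ⊹ (r ⊹ x) ≐ r ⊹ (M ⊹ x)) M r (q * M)))
        (trans (g-eq r (suc q) r<M) (trans (+n-step (f r) q) (cong (_+ n) (sym (g-eq r q r<M)))))

      g-chord : ∀ r q → r < M → T (g (r + q * M)) (g (k + (r + q * M)))
      g-chord r q r<M with r ≤? k
      ... | yes r≤k = subst₂ T (sym (g-eq r q r<M))
              (sym (trans (cong g (sym (+-assoc k r (q * M)))) (g-eq (k + r) q lt)))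
              (shifts q (f-chord r r≤k))
        where
        lt : k + r < M
        lt = lia 2 (λ k r → r ≼ k ⇒ ⊢ k ⊹ r ≺ # 1 ⊹ 2 ⊠ k) k r r≤k
      -- For r = k+1+t the chord runs past the end of the period and is the flip of the edge from
      -- `f t` to `f (k + suc t)`.
      ... | no r≰k = subst₂ T
              (sym (trans (g-eq r q r<M) (cong (λ i → f i + q * n) (sym k+1+t≡r))))
              (sym (trans (cong g idx) (trans (g-eq t (suc q) (<-trans t<k k<M))
                (sym (+-assoc (f t) n (q * n))))))
              (shifts q (flip (f t) (f (k + suc t)) (f-chord′ t t<k)))
        where
        t = r ∸ suc k
        1+k+t≡r : suc k + t ≡ r
        1+k+t≡r = m+[n∸m]≡n (≰⇒> r≰k)
        k+1+t≡r : k + suc t ≡ r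
        k+1+t≡r = trans (+-suc k t) 1+k+t≡r
        t<k : t < k
        t<k = lia 3 (λ k t r → # 1 ⊹ k ⊹ t ≐ r ⇒ r ≺ # 1 ⊹ 2 ⊠ k ⇒ ⊢ t ≺ k) k t r 1+k+t≡r r<M
        k<M : k < M
        k<M = lia 1 (λ k → ⊢ k ≺ # 1 ⊹ 2 ⊠ k) k
        idx : k + (r + q * M) ≡ t + suc q * M
        idx = lia 4 (λ k t r x → # 1 ⊹ k ⊹ t ≐ r ⇒ ⊢ k ⊹ (r ⊹ x) ≐ t ⊹ (# 1 ⊹ 2 ⊠ k ⊹ x))
                k t r (q * M) 1+k+t≡r

  abstract
    -- The points are a_0 < ... < a_k = b_0 < ... < b_k. Rung j of `Angle` joins the points j and
    -- k+j, and step j joins the points j and k+1+j.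
    angleStar : ∀ u v w → u + k ≤ v → v + k ≤ w → w < u + n → T u v → T v w →
                (∀ t → w < t → t < u + n → ¬ T v t) →
                Σ Star λ S → Star.s S 0 ≡ u × Star.s S k ≡ v × Star.s S (2 * k) ≡ w
    angleStar u v w u+k≤v v+k≤w w<u+n Tuv Tvw empty =
      unrolled ,
      trans (g-init 0 (s≤s z≤n)) (trans (f-lo 0 z≤n) a-bot) ,
      trans (g-init k (lia 1 (λ k → ⊢ k ≺ # 1 ⊹ 2 ⊠ k) k)) (trans (f-lo k ≤-refl) a-top) ,
      trans (g-init (2 * k) ≤-refl) (trans f-2k b-top)
      where
      open Angle u v w u+k≤v v+k≤w w<u+n Tuv Tvw empty

      f : ℕ → ℕ
      f j with j ≤? k
      ... | yes _ = a j
      ... | no  _ = b (j ∸ k)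

      f-lo : ∀ j → j ≤ k → f j ≡ a j
      f-lo j j≤k with j ≤? k
      ... | yes _ = refl
      ... | no ¬p = ⊥-elim (¬p j≤k)

      f-hi : ∀ j → f (k + j) ≡ b j
      f-hi zero    = trans (cong f (+-identityʳ k)) (trans (f-lo k ≤-refl) (trans a-top (sym b-bot)))
      f-hi (suc j) with (k + suc j) ≤? k
      ... | yes p = ⊥-elim (m+1+n≰m k p)
      ... | no  _ = cong b (m+n∸m≡n k (suc j))

      f-2k : f (2 * k) ≡ b k
      f-2k = trans (cong f (lia 1 (λ k → ⊢ 2 ⊠ k ≐ k ⊹ k) k)) (f-hi k)

      f-inc : ∀ j → j < 2 * k → f j < f (suc j)
      f-inc j j<2k with <-≤-connex j k
      ... | inj₁ j<k = subst₂ _<_ (sym (f-lo j (<⇒≤ j<k))) (sym (f-lo (suc j) j<k)) (a-inc j j<k)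
      ... | inj₂ k≤j = subst (λ i → f i < f (suc i)) k+t≡j (subst₂ _<_ (sym (f-hi t))
              (sym (trans (cong f (sym (+-suc k t))) (f-hi (suc t)))) (b-inc t t<k))
        where
        t : ℕ
        t = j ∸ k
        k+t≡j : k + t ≡ j
        k+t≡j = m+[n∸m]≡n k≤j
        t<k : t < k
        t<k = lia 3 (λ k t j → k ⊹ t ≐ j ⇒ j ≺ 2 ⊠ k ⇒ ⊢ t ≺ k) k t j k+t≡j j<2k

      open Unroll f f-inc
        (subst₂ _<_ (sym (trans f-2k b-top)) (cong (_+ n) (sym (trans (f-lo 0 z≤n) a-bot))) w<u+n)
        (λ j j≤k → subst₂ T (sym (f-lo j j≤k)) (sym (f-hi j)) (rung⁺ j j≤k))
        (λ j j<k → subst₂ T (sym (f-lo j (<⇒≤ j<k))) (sym (f-hi (suc j))) (step j j<k))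

  abstract
    -- The farthest neighbor w of y before x + n closes an empty angle; the short edge (y , y + k)
    -- shows that w is far enough.
    outer : ∀ x y → x + k ≤ y → y + k < x + n → T x y →
            Σ Star λ S → Star.s S 0 ≡ x × Star.s S k ≡ y
    outer x y x+k≤y y+k<x+n Txy
      with greatest (T? y) (x + n) (short y (y + k) (m<m+n y 0<k) ≤-refl) y+k<x+n
    ... | w , Tyw , y+k≤w , w<x+n , none
      with angleStar x y w x+k≤y y+k≤w w<x+n Txy Tyw none
    ... | S , s0 , sk , _ = S , s0 , sk

  abstract
    -- The angle at v across the cut between n-1 and 0, with sides to the least and the greatest
    -- neighbor of v in `[0,n)`. Thus each of the n - 2k possible middle points occurs.
    middle : ∀ v → k ≤ v → v + k < n →
             Σ Star λ S → Star.s S k ≡ v × Star.s S (2 * k) < n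
    middle v k≤v v+k<n
      with least (λ x → T? x v) (short (v ∸ k) v lt (≤-reflexive (sym v∸k+k≡v)))
         | greatest (T? v) n (short v (v + k) (m<m+n v 0<k) ≤-refl) v+k<n
      where
      v∸k+k≡v : v ∸ k + k ≡ v
      v∸k+k≡v = m∸n+n≡m k≤v
      lt : v ∸ k < v
      lt = lia 3 (λ z k v → z ⊹ k ≐ v ⇒ # 0 ≺ k ⇒ ⊢ z ≺ v) (v ∸ k) k v v∸k+k≡v 0<k
    ... | u , Tuv , u≤ , none₁ | w , Tvw , v+k≤w , w<n , none₂
      with angleStar u v w (≤-trans (+-monoˡ-≤ k u≤) (≤-reflexive (m∸n+n≡m k≤v))) v+k≤w
             (<-≤-trans w<n (m≤n+m n u)) Tuv Tvw empty
      where
      empty : ∀ t → w < t → t < u + n → ¬ T v t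
      empty t w<t t<u+n Tvt with t <? n
      ... | yes t<n = none₂ t w<t t<n Tvt
      ... | no  t≮n = none₁ (t ∸ n)
              (+-cancelʳ-< n (t ∸ n) u (subst (_< u + n) (sym eq) t<u+n))
              (unflip (t ∸ n) v (subst (T v) (sym eq) Tvt))
        where
        eq : t ∸ n + n ≡ t
        eq = m∸n+n≡m (≮⇒≥ t≮n)
    ... | S , _ , sk , s2k = S , sk , subst (_< n) (sym s2k) w<n

  module Points (S : Star) where
    open Star S

    s-growth : ∀ d j → d + s j ≤ s (d + j)
    s-growth zero    j = ≤-refl
    s-growth (suc d) j = ≤-trans (s≤s (s-growth d j)) (inc (d + j))

    s-mono : ∀ {i j} → i < j → s i < s j
    s-mono {i} {j} i<j = subst (λ m → s i < s m) (m∸n+n≡m i<j)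
      (≤-trans (inc i) (≤-trans (m≤n+m _ (j ∸ suc i)) (s-growth (j ∸ suc i) (suc i))))

    pers : ∀ q j → s (q * M + j) ≡ s j + q * n
    pers zero    j = sym (+-identityʳ _)
    pers (suc q) j = trans (cong s (+-assoc M (q * M) j))
      (trans (per (q * M + j)) (trans (cong (_+ n) (pers q j)) (sym (+n-step (s j) q))))

    s-gap : ∀ j → s (k + j) + suc k ≤ s j + n
    s-gap j = subst₂ _≤_ (+-comm (suc k) _)
      (trans (cong s (lia 2 (λ k j → ⊢ # 1 ⊹ k ⊹ (k ⊹ j) ≐ # 1 ⊹ 2 ⊠ k ⊹ j) k j)) (per j))
      (s-growth (suc k) (k + j))

    chord′ : ∀ j → T (s j) (s (suc k + j))
    chord′ j = unflip (s j) (s (suc k + j)) (subst (T (s (suc k + j)))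
      (trans (cong s (lia 2 (λ k j → ⊢ k ⊹ (# 1 ⊹ k ⊹ j) ≐ # 1 ⊹ 2 ⊠ k ⊹ j) k j)) (per j))
      (chord (suc k + j)))

    -- The angles of a star are empty: an edge inside one crosses the k chords that start at the
    -- next k points of the star, and these cross each other.
    noEdge : ∀ i t → s (k + (k + i)) < t → t < s i + n → ¬ T (s (k + i)) t
    noEdge i t lo hi e = noCr (s (k + i)) t (grow lo
        (≤-reflexive (trans (cong s (lia 3 (λ k M i → ⊢ k ⊹ (M ⊹ i) ≐ M ⊹ (k ⊹ i)) k M i)) (per (k + i))))
        (fan k))
      where
      t< : t < s (M + i)
      t< = subst (t <_) (sym (per i)) hi
      fan : ∀ j → Ch (s (k + i)) t (suc j) (suc (s (j + (k + i)))) (s (j + (M + i)))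
      fan zero    = snoc [] e ≤-refl ≤-refl ≤-refl t<
      fan (suc j) = snoc (grow (inc (j + (k + i))) ≤-refl (fan j))
        (subst (T (s (suc j + (k + i)))) (cong s (lia 3 (λ k j i →
           ⊢ k ⊹ (# 1 ⊹ j ⊹ (k ⊹ i)) ≐ j ⊹ (# 1 ⊹ 2 ⊠ k ⊹ i)) k j i)) (chord (suc j + (k + i))))
        (≤-trans (m≤n+m _ (suc j)) (s-growth (suc j) (k + i)))
        (<⇒≤ (<-≤-trans t< (≤-trans (m≤n+m _ j) (s-growth j (M + i)))))
        ≤-refl (inc (j + (M + i)))

  module Agreement (S S′ : Star) where
    open Star S using (s; per)
    open Star S′ using () renaming (s to s′; per to per′)
    module P = Points S
    module P′ = Points S′

    Pair : ℕ → ℕ → Set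
    Pair i i′ = s i ≡ s′ i′ × s (k + i) ≡ s′ (k + i′)

    -- Both stars have an empty angle at the common point `s (k + i)`, so neither can continue to an
    -- earlier point than the other. Hence a common oriented edge determines a star.
    next : ∀ {i i′} → Pair i i′ → Pair (k + i) (k + i′)
    next {i} {i′} (e₀ , e₁) = e₁ , e₂
      where
      lt : ∀ (A B : Star) i i′ → Star.s A i ≡ Star.s B i′ → Star.s A (k + i) ≡ Star.s B (k + i′) →
           ¬ Star.s A (k + (k + i)) < Star.s B (k + (k + i′))
      lt A B i i′ e₀ e₁ h = Points.noEdge A i _ h
        (subst₂ _<_ refl (trans (Star.per B i′) (cong (_+ n) (sym e₀)))
          (Points.s-mono B (≤-reflexive (lia 2 (λ k i → ⊢ # 1 ⊹ (k ⊹ (k ⊹ i)) ≐ # 1 ⊹ 2 ⊠ k ⊹ i) k i′))))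
        (subst (λ x → T x _) (sym e₁) (Star.chord B (k + i′)))
      e₂ : s (k + (k + i)) ≡ s′ (k + (k + i′))
      e₂ with <-cmp (s (k + (k + i))) (s′ (k + (k + i′)))
      ... | tri< h _ _ = ⊥-elim (lt S S′ i i′ e₀ e₁ h)
      ... | tri≈ _ e _ = e
      ... | tri> _ _ h = ⊥-elim (lt S′ S i′ i (sym e₀) (sym e₁) h)

    turn : ∀ {i i′} → Pair i i′ → Pair (M + i) (M + i′)
    turn {i} {i′} (e₀ , e₁) =
      trans (per i) (trans (cong (_+ n) e₀) (sym (per′ i′))) ,
      trans (cong s (swap i)) (trans (per (k + i)) (trans (cong (_+ n) e₁)
        (trans (sym (per′ (k + i′))) (cong s′ (sym (swap i′))))))
      where
      swap : ∀ i → k + (M + i) ≡ M + (k + i)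
      swap = lia 3 (λ k M i → ⊢ k ⊹ (M ⊹ i) ≐ M ⊹ (k ⊹ i)) k M

    unturn : ∀ {i i′} → Pair (M + i) (M + i′) → Pair i i′
    unturn {i} {i′} (e₀ , e₁) =
      +-cancelʳ-≡ n _ _ (trans (sym (per i)) (trans e₀ (per′ i′))) ,
      +-cancelʳ-≡ n _ _ (trans (sym (per (k + i))) (trans (cong s (sym (swap i)))
        (trans e₁ (trans (cong s′ (swap i′)) (per′ (k + i′))))))
      where
      swap : ∀ i → k + (M + i) ≡ M + (k + i)
      swap = lia 3 (λ k M i → ⊢ k ⊹ (M ⊹ i) ≐ M ⊹ (k ⊹ i)) k M

    -- Two k-steps along the star retreat by one point.
    down : ∀ {i i′} → Pair (suc i) (suc i′) → Pair i i′
    down {i} {i′} p = unturn (subst₂ Pair (idx i) (idx i′) (next (next p)))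
      where
      idx : ∀ i → k + (k + suc i) ≡ M + i
      idx = lia 2 (λ k i → ⊢ k ⊹ (k ⊹ (# 1 ⊹ i)) ≐ # 1 ⊹ 2 ⊠ k ⊹ i) k

    downs : ∀ d {i i′} → Pair (d + i) (d + i′) → Pair i i′
    downs zero    p = p
    downs (suc d) p = downs d (down p)

    up : ∀ {i i′} → Pair i i′ → Pair (suc i) (suc i′)
    up {i} {i′} p = downs (2 * k) (subst₂ Pair (idx i) (idx i′) (turn p))
      where
      idx : ∀ i → M + i ≡ 2 * k + suc i
      idx i = sym (+-suc (2 * k) i)

    ups : ∀ d {i i′} → Pair i i′ → Pair (d + i) (d + i′)
    ups zero    p = p
    ups (suc d) p = up (ups d p)

    agree : ∀ {i i′} → Pair i i′ → ∀ d → s (d + i) ≡ s′ (d + i′)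
    agree p d = proj₁ (ups d p)

    agree₀ : Pair 0 0 → ∀ j → s j ≡ s′ j
    agree₀ p j = subst (λ i → s i ≡ s′ i) (+-identityʳ j) (agree p j)

  Normal : Star → Set
  Normal S = Star.s S (2 * k) < n

  module _ {S S′ : Star} (nf : Normal S) (nf′ : Normal S′) where
    open Star S using (s)
    open Star S′ using () renaming (s to s′)
    open Agreement S S′

    private
      -- If point 0 of A were a later point of B, the last point of A would be beyond n.
      overtake : ∀ (A B : Star) → Normal A → ∀ d → ¬ Agreement.Pair A B 0 (suc d)
      overtake A B nfA d p = <⇒≱ nfA (subst (n ≤_)
        (sym (trans (cong (Star.s A) (sym (+-identityʳ (2 * k)))) (trans (Agreement.agree A B p (2 * k))
          (trans (cong (Star.s B) (+-suc (2 * k) d)) (Star.per B d))))) (m≤n+m n _))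

    normal-agree : ∀ i i′ → Pair i i′ → ∀ j → s j ≡ s′ j
    normal-agree zero    zero     p = agree₀ p
    normal-agree zero    (suc i′) p = ⊥-elim (overtake S S′ nf i′ p)
    normal-agree (suc i) zero     p =
      ⊥-elim (overtake S′ S nf′ i (sym (proj₁ p) , sym (proj₂ p)))
    normal-agree (suc i) (suc i′) p = normal-agree i i′ (down p)

    -- The first points agree too: an edge from the common middle point to a smaller first point,
    -- taken one turn later, would lie in the empty angle of the other star, across the cut at n.
    middle-agree : s k ≡ s′ k → ∀ j → s j ≡ s′ j
    middle-agree eq = agree₀ (first , subst (λ i → s i ≡ s′ i) (sym (+-identityʳ k)) eq)
      where
      le : ∀ (A B : Star) → Normal A → Star.s A k ≡ Star.s B k → ¬ Star.s B 0 < Star.s A 0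
      le A B nfA eq h = Points.noEdge A 0 (Star.s B 0 + n)
        (subst (λ j → Star.s A j < Star.s B 0 + n) (lia 1 (λ k → ⊢ 2 ⊠ k ≐ k ⊹ (k ⊹ # 0)) k)
          (<-≤-trans nfA (m≤n+m n _)))
        (+-monoˡ-< n h)
        (subst (λ x → T x (Star.s B 0 + n)) (sym (trans (cong (Star.s A) (+-identityʳ k)) eq))
          (flip _ _ (subst (λ j → T (Star.s B 0) (Star.s B j)) (+-identityʳ k) (Star.chord B 0))))
      first : s 0 ≡ s′ 0
      first = ≤-antisym (≮⇒≥ (le S S′ nf eq)) (≮⇒≥ (le S′ S nf′ (sym eq)))

  abstract
    -- The star is read from its first point at or beyond `q * n`. The choice q = 1 + s 0 puts point
    -- 0 below this bound, so there is a preceding point; one period later it is the last point of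
    -- the new star, still below `suc q * n`.
    normalise : ∀ (S : Star) → Σ Star λ S° → Normal S° ×
                ∃[ i ] ∃[ q ] (∀ j → Star.s S° j + q * n ≡ Star.s S (i + j))
    normalise S with least (λ j → q * n ≤? s j) reached
      where
      open Star S
      open Points S
      q : ℕ
      q = suc (s 0)
      reached : q * n ≤ s (q * n)
      reached = ≤-trans (m≤m+n (q * n) (s 0)) (subst (λ j → q * n + s 0 ≤ s j) (+-identityʳ _) (s-growth (q * n) 0))
    ... | zero , qn≤ , _ , _ = ⊥-elim (<⇒≱ (≤-trans (n<1+n _) (m≤m*n (suc (Star.s S 0)) n)) qn≤)
    ... | suc i , qn≤ , _ , below = S° , nf , suc i , q , s°-eq
      where
      open Star S
      open Points S
      q : ℕ
      q = suc (s 0)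
      s° : ℕ → ℕ
      s° j = s (suc i + j) ∸ q * n
      s°-eq : ∀ j → s° j + q * n ≡ s (suc i + j)
      s°-eq j = m∸n+n≡m (≤-trans qn≤ (≤-trans (m≤n+m _ j)
        (subst (λ m → j + s (suc i) ≤ s m) (+-comm j (suc i)) (s-growth j (suc i)))))
      S° : Star
      S° = record
        { s = s°
        ; inc = λ j → +-cancelʳ-< (q * n) _ _ (subst₂ _<_ (sym (s°-eq j))
                  (trans (cong s (sym (+-suc (suc i) j))) (sym (s°-eq (suc j)))) (inc (suc i + j)))
        ; per = λ j → +-cancelʳ-≡ (q * n) _ _ (trans (s°-eq (M + j))
                  (trans (cong s (lia 3 (λ a b c → ⊢ a ⊹ (b ⊹ c) ≐ b ⊹ (a ⊹ c)) (suc i) M j))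
                  (trans (per (suc i + j)) (trans (cong (_+ n) (sym (s°-eq j)))
                  (lia 3 (λ a b c → ⊢ a ⊹ b ⊹ c ≐ a ⊹ c ⊹ b) (s° j) (q * n) n)))))
        ; chord = λ j → unshifts q (subst₂ T (sym (s°-eq j))
                  (trans (cong s (lia 3 (λ a b c → ⊢ a ⊹ (b ⊹ c) ≐ b ⊹ (a ⊹ c)) k (suc i) j))
                    (sym (s°-eq (k + j)))) (chord (suc i + j)))
        }
      nf : s° (2 * k) < n
      nf = +-cancelʳ-< (q * n) _ _ (subst₂ _<_ (sym (trans (s°-eq (2 * k))
             (trans (cong s (lia 2 (λ i k → ⊢ # 1 ⊹ i ⊹ 2 ⊠ k ≐ # 1 ⊹ 2 ⊠ k ⊹ i) i k)) (per i))))
             (+-comm (q * n) n) (+-monoˡ-< n (≰⇒> (below i ≤-refl))))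

  -- External stars

  Boundary : Star → ℕ → Set
  Boundary S j = Star.s S (k + j) ≡ k + Star.s S j

  -- The last boundary edge of a maximal run of boundary edges.
  End : Star → ℕ → Set
  End S j = Boundary S j × Star.s S (suc k + j) ≢ suc k + Star.s S j

  module Ends (S : Star) where
    open Star S
    open Points S

    -- The k increments along the chord are at least 1 and add up to k.
    block : ∀ {j} → Boundary S j → ∀ t → t ≤ k → s (t + j) ≡ t + s j
    block {j} bd t t≤k = ≤-antisym (lia 5 (λ x y d t k → d ⊹ x ≼ k ⊹ y ⇒ d ⊹ t ≐ k ⇒ ⊢ x ≼ t ⊹ y)
        (s (t + j)) (s j) d t k
        (subst (d + s (t + j) ≤_) bd
          (subst (λ i → d + s (t + j) ≤ s i) (trans (sym (+-assoc d t j)) (cong (_+ j) d+t≡k))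
            (s-growth d (t + j)))) d+t≡k)
        (s-growth t j)
      where
      d = k ∸ t
      d+t≡k : d + t ≡ k
      d+t≡k = m∸n+n≡m t≤k

    consecutive : ∀ {j} → Boundary S j → ∀ i → j ≤ i → i < k + j → s (suc i) ≡ suc (s i)
    consecutive {j} bd i j≤i i<k+j = subst (λ m → s (suc m) ≡ suc (s m)) t+j≡i
      (trans (block bd (suc t) t<k) (cong suc (sym (block bd t (<⇒≤ t<k)))))
      where
      t = i ∸ j
      t+j≡i : t + j ≡ i
      t+j≡i = m∸n+n≡m j≤i
      t<k : t < k
      t<k = lia 4 (λ t j i k → t ⊹ j ≐ i ⇒ i ≺ k ⊹ j ⇒ ⊢ t ≺ k) t j i k t+j≡i i<k+j

    end-shift : ∀ q {j} → End S j → End S (q * M + j)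
    end-shift q {j} (bd , e) =
      trans (cong s (swap k)) (trans (pers q (k + j)) (trans (cong (_+ q * n) bd)
        (trans (+-assoc k (s j) (q * n)) (cong (k +_) (sym (pers q j)))))) ,
      λ h → e (+-cancelʳ-≡ (q * n) _ _ (trans (sym (pers q (suc k + j)))
        (trans (cong s (sym (swap (suc k)))) (trans h
          (trans (cong (suc k +_) (pers q j)) (sym (+-assoc (suc k) (s j) (q * n))))))))
      where
      swap : ∀ c → c + (q * M + j) ≡ q * M + (c + j)
      swap c = lia 3 (λ c x j → ⊢ c ⊹ (x ⊹ j) ≐ x ⊹ (c ⊹ j)) c (q * M) j

    end-unshift : ∀ q {j} → End S (q * M + j) → End S j
    end-unshift q {j} (bd , e) =
      +-cancelʳ-≡ (q * n) _ _ (trans (sym (pers q (k + j))) (trans (cong s (sym (swap k)))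
        (trans bd (trans (cong (k +_) (pers q j)) (sym (+-assoc k (s j) (q * n))))))) ,
      λ h → e (trans (cong s (swap (suc k))) (trans (pers q (suc k + j)) (trans (cong (_+ q * n) h)
        (trans (+-assoc (suc k) (s j) (q * n)) (cong (suc k +_) (sym (pers q j)))))))
      where
      swap : ∀ c → c + (q * M + j) ≡ q * M + (c + j)
      swap c = lia 3 (λ c x j → ⊢ c ⊹ (x ⊹ j) ≐ x ⊹ (c ⊹ j)) c (q * M) j

    abstract
      -- The run is followed while it lasts. A run of more than k steps would make all points of a
      -- period consecutive, that is, n = 2k+1.
      boundary⇒end : ∀ {j} → Boundary S j → ∃[ i ] End S i
      boundary⇒end {j} bd = go (suc k) 0 (+-identityʳ (suc k)) bd refl
        where
        go : ∀ fuel d → fuel + d ≡ suc k → Boundary S (d + j) → s (d + j) ≡ d + s j → ∃[ i ] End S i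
        go fuel d eq bd′ run with s (suc k + (d + j)) ≟ suc k + s (d + j)
        ... | no ne = d + j , bd′ , ne
        go zero d refl bd′ run | yes _ = ⊥-elim (lia 3 (λ x k n →
            x ⊹ n ≐ k ⊹ (# 1 ⊹ k ⊹ x) ⇒ 2 ⊠ k ⊹ # 3 ≼ n ⇒ ⊢⊥) (s j) k n
          (trans (sym (per j)) (trans (cong s (lia 2 (λ k j →
              ⊢ # 1 ⊹ 2 ⊠ k ⊹ j ≐ k ⊹ (# 1 ⊹ k ⊹ j)) k j)) (trans bd′ (cong (k +_) run)))) 2k+3≤n)
        go (suc fuel) d eq bd′ run | yes e = go fuel (suc d) (trans (+-suc fuel d) eq)
          (trans (cong s (+-suc k (d + j))) (trans e (trans (sym (+-suc k _)) (cong (k +_) (sym one)))))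
          (trans one (cong suc run))
          where
          one : s (suc (d + j)) ≡ suc (s (d + j))
          one = consecutive bd′ (d + j) ≤-refl (m<n+m (d + j) 0<k)

    abstract
      end-reduce : ∀ {j} → End S j → ∃[ r ] ∃[ q ] (r < M × End S r × s j ≡ s r + q * n)
      end-reduce {j} e = j % M , j / M , m%n<n j M ,
        end-unshift (j / M) (subst (End S) j≡ e) , trans (cong s j≡) (pers (j / M) (j % M))
        where
        j≡ : j ≡ j / M * M + j % M
        j≡ = trans (m≡m%n+[m/n]*n j M) (+-comm (j % M) _)

    -- Two blocks of k+1 among 2k+1 cyclic points meet, and so one of them continues past the last
    -- point of the other, which is then no end.
    end-unique : ∀ {i i′} → End S i → End S i′ → i < i′ → i′ < M + i → ⊥
    end-unique {i} {i′} (bd , e) (bd′ , e′) i<i′ i′<M+i with <-≤-connex (k + i) i′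
    ... | inj₂ i′≤k+i = e (trans (consecutive bd′ (k + i) i′≤k+i (+-monoʳ-< k i<i′)) (cong suc bd))
    ... | inj₁ k+i<i′ = e′ (trans (consecutive bd″ (k + i′)
            (lia 3 (λ k i i′ → # 1 ⊹ (k ⊹ i) ≼ i′ ⇒ ⊢ 1 ⊠ (# 1 ⊹ 2 ⊠ k) ⊹ i ≼ k ⊹ i′) k i i′ k+i<i′)
            (lia 3 (λ k i i′ → i′ ≺ # 1 ⊹ 2 ⊠ k ⊹ i ⇒ ⊢ k ⊹ i′ ≺ k ⊹ (1 ⊠ (# 1 ⊹ 2 ⊠ k) ⊹ i))
              k i i′ i′<M+i)) (cong suc bd′))
      where
      bd″ : Boundary S (1 * M + i)
      bd″ = proj₁ (end-shift 1 (bd , e))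

    -- The ear would lie strictly inside the empty angle at `s j`, whose sides go to the points k+j
    -- and k+1+j.
    end-nonear : ∀ {j} → End S j → ¬ T (s j) (suc k + s j)
    end-nonear {j} (bd , e) t = noEdge (suc k + j) (suc k + s j + n)
      (subst (λ x → x < suc k + s j + n)
        (sym (trans (cong s (lia 2 (λ k j → ⊢ k ⊹ (k ⊹ (# 1 ⊹ k ⊹ j)) ≐ # 1 ⊹ 2 ⊠ k ⊹ (k ⊹ j)) k j))
          (trans (per (k + j)) (cong (_+ n) bd)))) (n<1+n _))
      (+-monoˡ-< n (≤∧≢⇒< (s-growth (suc k) j) (λ h → e (sym h))))
      (subst (λ x → T x (suc k + s j + n))
        (sym (trans (cong s (lia 2 (λ k j → ⊢ k ⊹ (# 1 ⊹ k ⊹ j) ≐ # 1 ⊹ 2 ⊠ k ⊹ j) k j)) (per j)))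
        (shift t))

    nonear-end : ∀ {j} → Boundary S j → ¬ T (s j) (suc k + s j) → End S j
    nonear-end {j} bd ¬t = bd , λ h → ¬t (subst (T (s j)) h (chord′ j))

  module _ (S S′ : Star) where
    open Star S using (s)
    open Star S′ using () renaming (s to s′)
    open Agreement S S′

    -- Each star is advanced by the number of turns that the other has already made, which takes the
    -- equal residues to equal labels.
    lift-pair : ∀ {i i′} l → π (s i) ≡ π (s′ i′) → s (k + i) ≡ s i + l → s′ (k + i′) ≡ s′ i′ + l →
                ∃[ q ] ∃[ q′ ] Pair (q * M + i) (q′ * M + i′)
    lift-pair {i} {i′} l eq e e′ = q , q′ , same , (begin
        s (k + (q * M + i))    ≡⟨ cong s (swap (q * M) i) ⟩
        s (q * M + (k + i))    ≡⟨ P.pers q (k + i) ⟩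
        s (k + i) + q * n      ≡⟨ cong (_+ q * n) e ⟩
        s i + l + q * n        ≡⟨ swap₂ (s i) l (q * n) ⟩
        s i + q * n + l        ≡⟨ cong (_+ l) same° ⟩
        s′ i′ + q′ * n + l     ≡⟨ swap₂ (s′ i′) (q′ * n) l ⟩
        s′ i′ + l + q′ * n     ≡⟨ cong (_+ q′ * n) (sym e′) ⟩
        s′ (k + i′) + q′ * n   ≡⟨ sym (P′.pers q′ (k + i′)) ⟩
        s′ (q′ * M + (k + i′)) ≡⟨ cong s′ (sym (swap (q′ * M) i′)) ⟩
        s′ (k + (q′ * M + i′)) ∎)
      where
      open ≡-Reasoning
      q = s′ i′ / n
      q′ = s i / n
      swap : ∀ c i → k + (c + i) ≡ c + (k + i)
      swap = lia 3 (λ k c i → ⊢ k ⊹ (c ⊹ i) ≐ c ⊹ (k ⊹ i)) k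
      swap₂ : ∀ a b c → a + b + c ≡ a + c + b
      swap₂ = lia 3 (λ a b c → ⊢ a ⊹ b ⊹ c ≐ a ⊹ c ⊹ b)
      same° : s i + q * n ≡ s′ i′ + q′ * n
      same° = lia 5 (λ x y r p q → x ≐ r ⊹ p ⇒ y ≐ r ⊹ q ⇒ ⊢ x ⊹ q ≐ y ⊹ p)
        (s i) (s′ i′) (toℕ (π (s i))) (q′ * n) (q * n) (π-lift (s i))
        (trans (π-lift (s′ i′)) (cong (λ r → toℕ r + q * n) (sym eq)))
      same : s (q * M + i) ≡ s′ (q′ * M + i′)
      same = trans (P.pers q i) (trans same° (sym (P′.pers q′ i′)))

    end-transfer : ∀ {i i′} δ → Pair i i′ → End S (δ + i) → End S′ (δ + i′)
    end-transfer {i} {i′} δ p (bd , e) =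
      trans (sym (at k)) (trans bd (cong (k +_) (agree p δ))) ,
      λ h → e (trans (at (suc k)) (trans h (cong (suc k +_) (sym (agree p δ)))))
      where
      at : ∀ c → s (c + (δ + i)) ≡ s′ (c + (δ + i′))
      at c = subst₂ (λ x y → s x ≡ s′ y) (+-assoc c δ i) (+-assoc c δ i′) (agree p (c + δ))

-- Accordions of a triangulation all of whose stars are external

module Paths (k n′ : ℕ) (T : ℕ → ℕ → Set) (0<k : 0 < k) (2k+3≤n : 2 * k + 3 ≤ suc n′)
             (tri : Kernel.KTri k (suc n′) T)
             (external : ∀ (S : Stars.Star k n′ T 0<k 2k+3≤n tri) →
                         ∃[ j ] Stars.Boundary k n′ T 0<k 2k+3≤n tri S j) where

  open Stars k n′ T 0<k 2k+3≤n tri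
  open Kernel.KTri tri

  Dart : ℕ → Fin n → Set
  Dart l a = T (toℕ a) (toℕ a + l)

  private
    swap : ∀ a b c → a + b + c ≡ a + c + b
    swap = lia 3 (λ a b c → ⊢ a ⊹ b ⊹ c ≐ a ⊹ c ⊹ b)

  dart-π : ∀ x {y} l → y ≡ x + l → T x y → Dart l (π x)
  dart-π x l refl t = unshifts (x / n) (subst₂ T (π-lift x)
    (trans (cong (_+ l) (π-lift x)) (swap (toℕ (π x)) (x / n * n) l)) t)

  -- The dart (a , a + l) is the chord (i , k + i) of a star whose last boundary
  -- edge comes δ points later.
  record Toward (lo hi : ℕ) (a : Fin n) (l : ℕ) : Set where
    field
      S    : Star
      i δ  : ℕ
      at   : π (Star.s S i) ≡ a
      long : Star.s S (k + i) ≡ Star.s S i + l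
      lo<δ : lo < δ
      δ≤hi : δ ≤ hi
      end  : End S (δ + i)

  -- They tell the next edge of the accordion. The last boundary edge makes k+1 points consecutive.
  -- For 0 < δ ≤ k these include the points k+i and k+1+i, so the far end can move one vertex up;
  -- for k < δ ≤ 2k they include 2k+i and 2k+1+i, so the near end can move one vertex down.
  Up Down : Fin n → ℕ → Set
  Up   = Toward 0 k
  Down = Toward k (2 * k)

  Valid : Fin n → ℕ → Set
  Valid a l = k < l × l + k < n × Dart l a

  abstract
    choose : ∀ a l → Valid a l → Up a l ⊎ Down a l
    choose a l (k<l , l+k<n , d) with outer (toℕ a) (toℕ a + l)
        (+-monoʳ-≤ (toℕ a) (<⇒≤ k<l))
        (subst (_< toℕ a + n) (sym (+-assoc (toℕ a) l k)) (+-monoʳ-< (toℕ a) l+k<n)) d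
    ... | S , s0 , sk with Ends.boundary⇒end S (proj₂ (external S))
    ... | _ , e with Ends.end-reduce S e
    -- An offset 0 would make the dart itself the boundary edge, but its length exceeds k.
    ... | zero , _ , _ , (bd , _) , _ = ⊥-elim (lia 4 (λ a l k x → x ≐ a ⇒ a ⊹ l ≐ k ⊹ x ⇒ k ≺ l ⇒ ⊢⊥)
            (toℕ a) l k (Star.s S 0) s0
            (trans (sym sk) (trans (cong (Star.s S) (sym (+-identityʳ k))) bd)) k<l)
    ... | suc r , _ , r<M , e′ , _ with suc r ≤? k
    ...   | yes r≤k = inj₁ record
      { S = S ; i = 0 ; δ = suc r ; at = trans (cong π s0) (π-toℕ a)
      ; long = trans (cong (Star.s S) (+-identityʳ k)) (trans sk (cong (_+ l) (sym s0)))
      ; lo<δ = s≤s z≤n ; δ≤hi = r≤k ; end = subst (End S) (sym (+-identityʳ _)) e′ }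
    ...   | no r≰k = inj₂ record
      { S = S ; i = 0 ; δ = suc r ; at = trans (cong π s0) (π-toℕ a)
      ; long = trans (cong (Star.s S) (+-identityʳ k)) (trans sk (cong (_+ l) (sym s0)))
      ; lo<δ = ≰⇒> r≰k ; δ≤hi = m<1+n⇒m≤n r<M ; end = subst (End S) (sym (+-identityʳ _)) e′ }

  -- The dart determines its star by `lift-pair`, and the star has one end per period, so the offset
  -- δ is determined as well.
  exclusive : ∀ {a l} → Up a l → ¬ Down a l
  exclusive {a} {l} u d
    with lift-pair U.S D.S l (trans U.at (sym D.at)) U.long D.long
    where
    module U = Toward u
    module D = Toward d
  ... | q , q′ , p = Ends.end-unique D.S
      (end-transfer U.S D.S U.δ p (subst (End U.S) (swap′ (q * M) U.δ U.i) (Ends.end-shift U.S q U.end)))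
      (subst (End D.S) (swap′ (q′ * M) D.δ D.i) (Ends.end-shift D.S q′ D.end))
      (+-monoˡ-< (q′ * M + D.i) (≤-<-trans U.δ≤hi D.lo<δ))
      (lia 4 (λ k δ δ′ x → # 0 ≺ δ ⇒ δ′ ≼ 2 ⊠ k ⇒ ⊢ δ′ ⊹ x ≺ # 1 ⊹ 2 ⊠ k ⊹ (δ ⊹ x))
        k U.δ D.δ (q′ * M + D.i) U.lo<δ D.δ≤hi)
    where
    module U = Toward u
    module D = Toward d
    swap′ : ∀ a b c → a + (b + c) ≡ b + (a + c)
    swap′ = lia 3 (λ a b c → ⊢ a ⊹ (b ⊹ c) ≐ b ⊹ (a ⊹ c))

  valid? : ∀ a l → Dec (Valid a l)
  valid? a l = k <? l ×-dec l + k <? n ×-dec T? (toℕ a) (toℕ a + l)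

  -- The dart of length suc l that follows (a , a + l) in its accordion
  -- starts at succ a l.
  succ : Fin n → ℕ → Fin n
  succ a l with valid? a l
  ... | no _ = a
  ... | yes v with choose a l v
  ...   | inj₁ _ = a
  ...   | inj₂ _ = a ⊕ n′

  succ-cases : ∀ a l → Valid a l → (Up a l × succ a l ≡ a) ⊎ (Down a l × succ a l ≡ a ⊕ n′)
  succ-cases a l v with valid? a l
  ... | no ¬v = ⊥-elim (¬v v)
  ... | yes v′ with choose a l v′
  ...   | inj₁ u = inj₁ (u , refl)
  ...   | inj₂ d = inj₂ (d , refl)

  succ-up : ∀ {a l} → Valid a l → Up a l → succ a l ≡ a
  succ-up {a} {l} v u with succ-cases a l v
  ... | inj₁ (_ , e) = e
  ... | inj₂ (d , _) = ⊥-elim (exclusive u d)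

  succ-down : ∀ {a l} → Valid a l → Down a l → succ a l ≡ a ⊕ n′
  succ-down {a} {l} v d with succ-cases a l v
  ... | inj₂ (_ , e) = e
  ... | inj₁ (u , _) = ⊥-elim (exclusive u d)

  module _ {a : Fin n} {l l′ : ℕ} (l+l′ : l + suc l′ ≡ n) where

    -- In the same star, the chord from point k+1+i to point 2k+1+i is the reversal of the
    -- successor. The next copy of the end comes δ + k points after its start, so `Up` turns into
    -- `Down`.
    up-mate : Up a l → Dart (suc l) a × Down (a ⊕ suc l) l′
    up-mate u = subst (Dart (suc l)) at (dart-π (s i) (suc l) 1+long (chord′ i)) , record
      { S = S ; i = suc k + i ; δ = δ + k
      ; at = trans (cong π 1+long) (trans (sym (π-⊕ (s i) (suc l))) (cong (_⊕ suc l) at))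
      ; long = trans (cong s (lia 2 (λ k i → ⊢ k ⊹ (# 1 ⊹ k ⊹ i) ≐ # 1 ⊹ 2 ⊠ k ⊹ i) k i))
          (trans (per i) (lia 5 (λ x y l l′ n → y ≐ x ⊹ (# 1 ⊹ l) ⇒ l ⊹ (# 1 ⊹ l′) ≐ n ⇒ ⊢ x ⊹ n ≐ y ⊹ l′)
            (s i) (s (suc k + i)) l l′ n 1+long l+l′))
      ; lo<δ = m<n+m k lo<δ
      ; δ≤hi = lia 2 (λ δ k → δ ≼ k ⇒ ⊢ δ ⊹ k ≼ 2 ⊠ k) δ k δ≤hi
      ; end = subst (End S) (lia 3 (λ k δ i → ⊢ 1 ⊠ (# 1 ⊹ 2 ⊠ k) ⊹ (δ ⊹ i) ≐ δ ⊹ k ⊹ (# 1 ⊹ k ⊹ i)) k δ i)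
          (Ends.end-shift S 1 end) }
      where
      open Toward u
      open Star S
      open Points S
      1+long : s (suc k + i) ≡ s i + suc l
      1+long = trans (Ends.consecutive S (proj₁ end) (k + i) (+-monoˡ-≤ i δ≤hi)
                 (+-monoʳ-< k (m<n+m i lo<δ)))
               (trans (cong suc long) (sym (+-suc (s i) l)))

    -- Here the reversal of the successor is the chord from point k+i to point 2k+i, and the offset
    -- of the end drops by k.
    down-mate : Down a l → Dart (suc l) (a ⊕ n′) × Up ((a ⊕ n′) ⊕ suc l) l′
    down-mate d = subst (Dart (suc l)) (trans (cong π before) (trans (sym (π-⊕ (s i) n′)) (cong (_⊕ n′) at)))
        (dart-π (s (2 * k + i)) (suc l) reach (chord′ (2 * k + i))) , record
      { S = S ; i = k + i ; δ = δ ∸ k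
      ; at = trans (cong π long) (trans (sym (π-⊕ (s i) l)) (trans (cong (_⊕ l) at) around))
      ; long = trans (cong s (lia 2 (λ k i → ⊢ k ⊹ (k ⊹ i) ≐ 2 ⊠ k ⊹ i) k i)) (trans before
          (lia 5 (λ x y l l′ n′ → y ≐ x ⊹ l ⇒ l ⊹ (# 1 ⊹ l′) ≐ # 1 ⊹ n′ ⇒ ⊢ x ⊹ n′ ≐ y ⊹ l′)
            (s i) (s (k + i)) l l′ n′ long l+l′))
      ; lo<δ = lia 3 (λ d k δ → k ⊹ d ≐ δ ⇒ k ≺ δ ⇒ ⊢ # 0 ≺ d) (δ ∸ k) k δ k+[δ∸k] lo<δ
      ; δ≤hi = lia 3 (λ d k δ → k ⊹ d ≐ δ ⇒ δ ≼ 2 ⊠ k ⇒ ⊢ d ≼ k) (δ ∸ k) k δ k+[δ∸k] δ≤hi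
      ; end = subst (End S) (lia 4 (λ k d δ i → k ⊹ d ≐ δ ⇒ ⊢ δ ⊹ i ≐ d ⊹ (k ⊹ i)) k (δ ∸ k) δ i k+[δ∸k]) end }
      where
      open Toward d
      open Star S
      open Points S
      k+[δ∸k] : k + (δ ∸ k) ≡ δ
      k+[δ∸k] = m+[n∸m]≡n (<⇒≤ lo<δ)
      before : s (2 * k + i) ≡ s i + n′
      before = suc-injective (trans (sym (Ends.consecutive S (proj₁ end) (2 * k + i) (+-monoˡ-≤ i δ≤hi)
                 (lia 3 (λ k δ i → k ≺ δ ⇒ ⊢ 2 ⊠ k ⊹ i ≺ k ⊹ (δ ⊹ i)) k δ i lo<δ)))
               (trans (per i) (+-suc (s i) n′)))
      reach : s (suc k + (2 * k + i)) ≡ s (2 * k + i) + suc l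
      reach = trans (cong s (lia 2 (λ k i → ⊢ # 1 ⊹ k ⊹ (2 ⊠ k ⊹ i) ≐ # 1 ⊹ 2 ⊠ k ⊹ (k ⊹ i)) k i))
        (trans (per (k + i)) (lia 5 (λ x y z l n′ → y ≐ x ⊹ l ⇒ z ≐ x ⊹ n′ ⇒ ⊢ y ⊹ (# 1 ⊹ n′) ≐ z ⊹ (# 1 ⊹ l))
          (s i) (s (k + i)) (s (2 * k + i)) l n′ long before))
      around : a ⊕ l ≡ (a ⊕ n′) ⊕ suc l
      around = sym (trans (⊕-⊕ a n′ (suc l)) (trans (cong (a ⊕_) (lia 2 (λ n′ l →
          ⊢ n′ ⊹ (# 1 ⊹ l) ≐ l ⊹ (# 1 ⊹ n′)) n′ l))
        (trans (sym (⊕-⊕ a l n)) (⊕-n (a ⊕ l)))))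

  rev-dart : ∀ {a l l′} → l + l′ ≡ n → Dart l a → Dart l′ (a ⊕ l)
  rev-dart {a} {l} {l′} eq d = dart-π (toℕ a + l) l′
    (trans (cong (toℕ a +_) (sym eq)) (sym (+-assoc (toℕ a) l l′))) (flip _ _ d)

  rev-rev : ∀ (a : Fin n) {l l′} → l + l′ ≡ n → (a ⊕ l) ⊕ l′ ≡ a
  rev-rev a {l} {l′} eq = trans (⊕-⊕ a l l′) (trans (cong (a ⊕_) eq) (⊕-n a))

  -- The reversal of (a , a + l) follows the reversal of its successor.
  mate : ∀ {a l l′} → l + suc l′ ≡ n → k < l → k < l′ → Dart l a →
         Dart (suc l) (succ a l) × succ (succ a l ⊕ suc l) l′ ≡ a ⊕ l
  mate {a} {l} {l′} eq k<l k<l′ d with succ-cases a l (k<l , l+k<n , d)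
    where
    l+k<n : l + k < n
    l+k<n = lia 4 (λ l l′ k n → l ⊹ (# 1 ⊹ l′) ≐ n ⇒ k ≺ l′ ⇒ ⊢ l ⊹ k ≺ n) l l′ k n eq k<l′
  ... | inj₁ (u , e) rewrite e = proj₁ m , trans (succ-down
          (k<l′ , l′+k<n , rev-dart (trans (sym (+-suc l l′)) eq) (proj₁ m)) (proj₂ m))
        (trans (⊕-⊕ a (suc l) n′) (trans (cong (a ⊕_) (sym (+-suc l n′)))
          (trans (sym (⊕-⊕ a l n)) (⊕-n (a ⊕ l)))))
    where
    m = up-mate eq u
    l′+k<n : l′ + k < n
    l′+k<n = lia 4 (λ l l′ k n → l ⊹ (# 1 ⊹ l′) ≐ n ⇒ k ≺ l ⇒ ⊢ l′ ⊹ k ≺ n) l l′ k n eq k<l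
  ... | inj₂ (d′ , e) rewrite e = proj₁ m , trans (succ-up
          (k<l′ , l′+k<n , rev-dart (trans (sym (+-suc l l′)) eq) (proj₁ m)) (proj₂ m))
        (trans (⊕-⊕ a n′ (suc l)) (trans (cong (a ⊕_) (lia 2 (λ n′ l →
          ⊢ n′ ⊹ (# 1 ⊹ l) ≐ l ⊹ (# 1 ⊹ n′)) n′ l)) (trans (sym (⊕-⊕ a l n)) (⊕-n (a ⊕ l)))))
    where
    m = down-mate eq d′
    l′+k<n : l′ + k < n
    l′+k<n = lia 4 (λ l l′ k n → l ⊹ (# 1 ⊹ l′) ≐ n ⇒ k ≺ l ⇒ ⊢ l′ ⊹ k ≺ n) l l′ k n eq k<l

  path : Fin n → ℕ → ℕ → Fin n
  path a l zero    = a
  path a l (suc m) = succ (path a l m) (m + l)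

  private
    co : ℕ → ℕ
    co l = n ∸ suc l

    co-eq : ∀ {l} → l < n → l + suc (co l) ≡ n
    co-eq {l} l<n = trans (+-suc l (co l)) (m+[n∸m]≡n l<n)

    co-long : ∀ {l} → suc l + k < n → k < co l
    co-long {l} h = lia 4 (λ l c k n → l ⊹ (# 1 ⊹ c) ≐ n ⇒ # 1 ⊹ l ⊹ k ≺ n ⇒ ⊢ k ≺ c) l (co l) k n
      (co-eq (≤-trans (m≤m+n (suc l) k) (<⇒≤ h))) h

    mate′ : ∀ {a l} → k < l → suc l + k < n → Dart l a →
            Dart (suc l) (succ a l) × succ (succ a l ⊕ suc l) (co l) ≡ a ⊕ l
    mate′ {l = l} k<l h = mate (co-eq (≤-trans (m≤m+n (suc l) k) (<⇒≤ h))) k<l (co-long h)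

  path-dart : ∀ {a l} m → k < l → m + l + k < n → Dart l a → Dart (m + l) (path a l m)
  path-dart         zero    _   _ d = d
  path-dart {a} {l} (suc m) k<l h d =
    proj₁ (mate′ (≤-trans k<l (m≤n+m l m)) h (path-dart m k<l (<-trans (n<1+n _) h) d))

  -- Each of the i steps is one application of `mate`: from the reversal of the last dart, the path
  -- runs through the reversals of the earlier ones. So paths can be walked back although `succ`
  -- only increases lengths.
  path-reverse : ∀ {a l} i t L L′ → k < l → L + k < n → i + t + l ≡ L → L + L′ ≡ n → Dart l a →
                 path (path a l (i + t) ⊕ L) L′ i ≡ path a l t ⊕ (t + l)
  path-reverse {a} {l} zero    t L L′ k<l h refl _ d = refl
  path-reverse {a} {l} (suc i) t L L′ k<l h eq eq′ d = begin
    succ (path (path a l (suc i + t) ⊕ L) L′ i) (i + L′)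
      ≡⟨ cong₂ (λ m x → succ (path (path a l m ⊕ L) L′ i) x) (sym (+-suc i t)) co≡ ⟩
    succ (path (path a l (i + suc t) ⊕ L) L′ i) (co (t + l))
      ≡⟨ cong (λ x → succ x (co (t + l)))
           (path-reverse i (suc t) L L′ k<l h (trans (cong (_+ l) (+-suc i t)) eq) eq′ d) ⟩
    succ (path a l (suc t) ⊕ (suc t + l)) (co (t + l))
      ≡⟨ proj₂ (mate′ (≤-trans k<l (m≤n+m l t)) top (path-dart t k<l (<-trans (n<1+n _) top) d)) ⟩
    path a l t ⊕ (t + l) ∎
    where
    open ≡-Reasoning
    top : suc (t + l) + k < n
    top = lia 6 (λ i t l L k n → L ⊹ k ≺ n ⇒ # 1 ⊹ i ⊹ t ⊹ l ≐ L ⇒ ⊢ # 1 ⊹ (t ⊹ l) ⊹ k ≺ n) i t l L k n h eq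
    co≡ : i + L′ ≡ co (t + l)
    co≡ = lia 7 (λ i t l L L′ c n → # 1 ⊹ i ⊹ t ⊹ l ≐ L ⇒ L ⊹ L′ ≐ n ⇒ t ⊹ l ⊹ (# 1 ⊹ c) ≐ n ⇒ ⊢ i ⊹ L′ ≐ c)
      i t l L L′ (co (t + l)) n eq eq′ (co-eq (≤-trans (m≤m+n (suc (t + l)) k) (<⇒≤ top)))

  -- A step moves the start back by at most one vertex. This later shows that no path is its own
  -- reversal.
  path-retreat : ∀ a l m → ∃[ p ] (p ≤ m × path a l m ⊕ p ≡ a)
  path-retreat a l zero    = 0 , z≤n , trans (cong π (+-identityʳ (toℕ a))) (π-toℕ a)
  path-retreat a l (suc m) with path-retreat a l m
  ... | p , p≤m , eq with valid? (path a l m) (m + l)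
  ...   | no _ = p , m≤n⇒m≤1+n p≤m , eq
  ...   | yes v with choose (path a l m) (m + l) v
  ...     | inj₁ _ = p , m≤n⇒m≤1+n p≤m , eq
  ...     | inj₂ _ = suc p , s≤s p≤m , trans (⊕-⊕ x n′ (suc p)) (trans (cong (x ⊕_) (+-comm n′ (suc p)))
      (trans (cong (x ⊕_) (sym (+-suc p n′))) (trans (sym (⊕-⊕ x p n)) (trans (⊕-n (x ⊕ p)) eq))))
    where x = path a l m

  -- The alternatives are those of `Accordion.step`. They also cover invalid darts, where `succ`
  -- leaves the start in place.
  path-step : ∀ a l m → (path a l (suc m) ≡ path a l m × path a l (suc m) ⊕ (suc m + l) ≡ (path a l m ⊕ (m + l)) ⊕ 1)
                      ⊎ (path a l (suc m) ≡ path a l m ⊕ n′ × path a l (suc m) ⊕ (suc m + l) ≡ path a l m ⊕ (m + l))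
  path-step a l m with valid? (path a l m) (m + l)
  ... | no _ = inj₁ (refl , one)
    where
    one = sym (trans (⊕-⊕ (path a l m) (m + l) 1) (cong (path a l m ⊕_) (+-comm (m + l) 1)))
  ... | yes v with choose (path a l m) (m + l) v
  ...   | inj₁ _ = inj₁ (refl , sym (trans (⊕-⊕ (path a l m) (m + l) 1)
                     (cong (path a l m ⊕_) (+-comm (m + l) 1))))
  ...   | inj₂ _ = inj₂ (refl , trans (⊕-⊕ x n′ (suc m + l)) (trans (cong (x ⊕_) (lia 2 (λ n′ l →
          ⊢ n′ ⊹ (# 1 ⊹ l) ≐ l ⊹ (# 1 ⊹ n′)) n′ (m + l)))
        (trans (sym (⊕-⊕ x (m + l) n)) (⊕-n (x ⊕ (m + l))))))
    where x = path a l m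

-- Edges and their lifts

module Edges (n′ : ℕ) where
  open Residues n′ public

  edge-≡ : ∀ {e f : Edge n} → src e ≡ src f → tgt e ≡ tgt f → e ≡ f
  edge-≡ {edge u v p} {edge .u .v q} refl refl = cong (edge u v) (≤-irrelevant p q)

  EdgeIs-sym : ∀ {e : Edge n} {u v} → EdgeIs e u v → EdgeIs e v u
  EdgeIs-sym (inj₁ p) = inj₂ p
  EdgeIs-sym (inj₂ p) = inj₁ p

  EdgeIs-≡ : ∀ {e f : Edge n} {u v} → EdgeIs e u v → EdgeIs f u v → e ≡ f
  EdgeIs-≡ (inj₁ (a , b)) (inj₁ (c , d)) = edge-≡ (trans a (sym c)) (trans b (sym d))
  EdgeIs-≡ (inj₂ (a , b)) (inj₂ (c , d)) = edge-≡ (trans a (sym c)) (trans b (sym d))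
  EdgeIs-≡ {edge _ _ p} {edge _ _ q} (inj₁ (refl , refl)) (inj₂ (refl , refl)) = ⊥-elim (<-asym p q)
  EdgeIs-≡ {edge _ _ p} {edge _ _ q} (inj₂ (refl , refl)) (inj₁ (refl , refl)) = ⊥-elim (<-asym p q)

  EdgeIs-ends : ∀ {e : Edge n} {u v u′ v′} → EdgeIs e u v → EdgeIs e u′ v′ →
                (u ≡ u′ × v ≡ v′) ⊎ (u ≡ v′ × v ≡ u′)
  EdgeIs-ends (inj₁ (refl , refl)) (inj₁ (refl , refl)) = inj₁ (refl , refl)
  EdgeIs-ends (inj₁ (refl , refl)) (inj₂ (refl , refl)) = inj₂ (refl , refl)
  EdgeIs-ends (inj₂ (refl , refl)) (inj₁ (refl , refl)) = inj₂ (refl , refl)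
  EdgeIs-ends (inj₂ (refl , refl)) (inj₂ (refl , refl)) = inj₁ (refl , refl)

  EdgeIs-≢ : ∀ {e : Edge n} {u v} → EdgeIs e u v → u ≢ v
  EdgeIs-≢ {edge _ _ p} (inj₁ (refl , refl)) refl = <-irrefl refl p
  EdgeIs-≢ {edge _ _ p} (inj₂ (refl , refl)) refl = <-irrefl refl p

  orient : ∀ {e : Edge n} {u v} → EdgeIs e u v → toℕ u < toℕ v → src e ≡ u × tgt e ≡ v
  orient (inj₁ p) _ = p
  orient {edge _ _ p} (inj₂ (refl , refl)) u<v = ⊥-elim (<-asym p u<v)

  join : ∀ {u v : Fin n} → u ≢ v → Σ (Edge n) λ e → EdgeIs e u v
  join {u} {v} u≢v with <-cmp (toℕ u) (toℕ v)
  ... | tri< lt _ _ = edge u v lt , inj₁ (refl , refl)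
  ... | tri≈ _ eq _ = ⊥-elim (u≢v (toℕ-injective eq))
  ... | tri> _ _ gt = edge v u gt , inj₂ (refl , refl)

  infix 4 _≟ᴱ_
  _≟ᴱ_ : (e f : Edge n) → Dec (e ≡ f)
  e ≟ᴱ f with src e ≟ᶠ src f | tgt e ≟ᶠ tgt f
  ... | yes p | yes q = yes (edge-≡ p q)
  ... | no ¬p | _     = no λ { refl → ¬p refl }
  ... | _     | no ¬q = no λ { refl → ¬q refl }

  Cross-sym : ∀ {e f : Edge n} → Cross e f → Cross f e
  Cross-sym (inj₁ p) = inj₂ p
  Cross-sym (inj₂ p) = inj₁ p

  Cross-irrefl : ∀ {e : Edge n} → ¬ Cross e e
  Cross-irrefl (inj₁ (p , _)) = <-irrefl refl p
  Cross-irrefl (inj₂ (p , _)) = <-irrefl refl p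

  π-≢ : ∀ {x y} → x < y → y < x + n → π x ≢ π y
  π-≢ {x} x<y y<x+n eq = <-irrefl
    (π-window x eq ≤-refl (m<m+n x (s≤s z≤n)) (<⇒≤ x<y) y<x+n) x<y

  residue : ∀ y q → q * n ≤ y → y < suc q * n → toℕ (π y) + q * n ≡ y
  residue y q lo hi = π-window (q * n) (trans (π-shift (toℕ (π y)) q) (π-toℕ (π y)))
    (m≤n+m _ _) (subst (toℕ (π y) + q * n <_) (+-comm n (q * n)) (+-monoˡ-< (q * n) (toℕ<n (π y)))) lo
    (subst (y <_) (+-comm n (q * n)) hi)

  private
    interleave : ∀ {e f : Edge n} {u v w z} → EdgeIs e u v → EdgeIs f w z →
                 toℕ u < toℕ w → toℕ w < toℕ v → toℕ v < toℕ z → Cross e f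
    interleave {e} {f} eu fw u<w w<v v<z with orient {e} eu (<-trans u<w w<v) | orient {f} fw (<-trans w<v v<z)
    ... | refl , refl | refl , refl = inj₁ (u<w , w<v , v<z)

    below : ∀ {x y} p q P → p + P ≡ x → q + P ≡ y → x < y → p < q
    below {x} {y} p q P = lia 5 (λ p q P x y → p ⊹ P ≐ x ⇒ q ⊹ P ≐ y ⇒ x ≺ y ⇒ ⊢ p ≺ q) p q P x y

    -- y was lifted one turn further than x
    wrapped : ∀ {x y} p q P → p + P ≡ x → q + (n + P) ≡ y → y < x + n → q < p
    wrapped {x} {y} p q P = lia 6 (λ p q P n x y →
      p ⊹ P ≐ x ⇒ q ⊹ (n ⊹ P) ≐ y ⇒ y ≺ x ⊹ n ⇒ ⊢ q ≺ p) p q P n x y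

  -- The cases tell which labels lie beyond the first multiple of n after a. Passing it rotates the
  -- four residues, and interleaving is invariant under rotation.
  cross-lift : ∀ {e f : Edge n} a b c d → a < c → c < b → b < d → d < a + n →
               EdgeIs e (π a) (π b) → EdgeIs f (π c) (π d) → Cross e f
  cross-lift {e} {f} a b c d a<c c<b b<d d<a+n ie if = go
    where
    q = a / n
    P = q * n
    lo : P ≤ a
    lo = subst (P ≤_) (sym (π-lift a)) (m≤n+m _ _)
    ra : toℕ (π a) + P ≡ a
    ra = sym (π-lift a)
    a<Z : a < n + P
    a<Z = subst (_< n + P) ra (+-monoˡ-< P (toℕ<n (π a)))
    top : ∀ {y} → y < a + n → y < n + (n + P)
    top {y} h = lia 4 (λ y a n P → y ≺ a ⊹ n ⇒ a ≺ n ⊹ P ⇒ ⊢ y ≺ n ⊹ (n ⊹ P)) y a n P h a<Z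
    near : ∀ y → a < y → y < n + P → toℕ (π y) + P ≡ y
    near y a<y y<Z = residue y q (≤-trans lo (<⇒≤ a<y)) y<Z
    far : ∀ y → n + P ≤ y → y < a + n → toℕ (π y) + (n + P) ≡ y
    far y Z≤y h = residue y (suc q) Z≤y (top h)
    b<a+n = <-trans b<d d<a+n
    c<a+n = <-trans c<b b<a+n
    go : Cross e f
    go with <-≤-connex d (n + P) | <-≤-connex b (n + P) | <-≤-connex c (n + P)
    ... | inj₁ d<Z | _ | _ = interleave {e} {f} ie if
            (below _ _ P ra rc a<c) (below _ _ P rc rb c<b) (below _ _ P rb rd b<d)
      where
      rc = near c a<c (<-trans c<b (<-trans b<d d<Z))
      rb = near b (<-trans a<c c<b) (<-trans b<d d<Z)
      rd = near d (<-trans a<c (<-trans c<b b<d)) d<Z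
    ... | inj₂ Z≤d | inj₁ b<Z | _ = Cross-sym {f} {e} (interleave {f} {e} (EdgeIs-sym {f} if) ie
            (wrapped _ _ P ra (far d Z≤d d<a+n) d<a+n)
            (below _ _ P ra rc a<c) (below _ _ P rc rb c<b))
      where
      rc = near c a<c (<-trans c<b b<Z)
      rb = near b (<-trans a<c c<b) b<Z
    ... | inj₂ Z≤d | inj₂ Z≤b | inj₁ c<Z = interleave {e} {f} (EdgeIs-sym {e} ie) (EdgeIs-sym {f} if)
            (below _ _ (n + P) (far b Z≤b b<a+n) (far d Z≤d d<a+n) b<d)
            (wrapped _ _ P ra (far d Z≤d d<a+n) d<a+n)
            (below _ _ P ra (near c a<c c<Z) a<c)
    ... | inj₂ Z≤d | inj₂ Z≤b | inj₂ Z≤c = Cross-sym {f} {e} (interleave {f} {e} if (EdgeIs-sym {e} ie)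
            (below _ _ (n + P) (far c Z≤c c<a+n) (far b Z≤b b<a+n) c<b)
            (below _ _ (n + P) (far b Z≤b b<a+n) (far d Z≤d d<a+n) b<d)
            (wrapped _ _ P ra (far d Z≤d d<a+n) d<a+n))

  -- `f` has an end on either side of `e`. Each residue gets as many turns as x, or one more where
  -- the window from x to x + n has passed a multiple of n.
  cross-unlift : ∀ {e f : Edge n} x y → x < y → y < x + n → EdgeIs e (π x) (π y) → Cross e f →
                 ∃[ a ] ∃[ b ] (x < a × a < y × y < b × b < x + n × EdgeIs f (π a) (π b))
  cross-unlift {e} {edge s t s<t} x y x<y y<x+n ie cr = go (<-≤-connex y (n + P)) cr
    where
    q = x / n
    P = q * n
    r = toℕ (π x)
    r′ = toℕ (π y)
    S = toℕ s
    R = toℕ t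
    rx : r + P ≡ x
    rx = sym (π-lift x)
    R<n : R < n
    R<n = toℕ<n t
    at : ∀ (i : Fin n) p → i ≡ π (toℕ i + p * n)
    at i p = sym (trans (π-shift (toℕ i) p) (π-toℕ i))
    Goal = ∃[ a ] ∃[ b ] (x < a × a < y × y < b × b < x + n × EdgeIs (edge s t s<t) (π a) (π b))

    near : y < n + P → Cross e (edge s t s<t) → Goal
    near y<Z c = case c (orient {e} ie (below _ _ P rx ry x<y))
      where
      ry : r′ + P ≡ y
      ry = residue y q (≤-trans (subst (P ≤_) rx (m≤n+m P r)) (<⇒≤ x<y)) y<Z
      case : Cross e (edge s t s<t) → src e ≡ π x × tgt e ≡ π y → Goal
      case (inj₁ (c₁ , c₂ , c₃)) (refl , refl) = S + P , R + P ,
        lia 4 (λ r P x S → r ⊹ P ≐ x ⇒ r ≺ S ⇒ ⊢ x ≺ S ⊹ P) r P x S rx c₁ ,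
        lia 4 (λ r P y S → r ⊹ P ≐ y ⇒ S ≺ r ⇒ ⊢ S ⊹ P ≺ y) r′ P y S ry c₂ ,
        lia 4 (λ r P y R → r ⊹ P ≐ y ⇒ r ≺ R ⇒ ⊢ y ≺ R ⊹ P) r′ P y R ry c₃ ,
        lia 5 (λ r P x R n → r ⊹ P ≐ x ⇒ R ≺ n ⇒ ⊢ R ⊹ P ≺ x ⊹ n) r P x R n rx R<n ,
        inj₁ (at s q , at t q)
      case (inj₂ (c₁ , c₂ , c₃)) (refl , refl) = R + P , S + suc q * n ,
        lia 4 (λ r P x R → r ⊹ P ≐ x ⇒ r ≺ R ⇒ ⊢ x ≺ R ⊹ P) r P x R rx c₂ ,
        lia 4 (λ r P y R → r ⊹ P ≐ y ⇒ R ≺ r ⇒ ⊢ R ⊹ P ≺ y) r′ P y R ry c₃ ,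
        lia 5 (λ r P y S n → y ≺ n ⊹ P ⇒ ⊢ y ≺ S ⊹ (n ⊹ P)) r′ P y S n y<Z ,
        lia 5 (λ r P x S n → r ⊹ P ≐ x ⇒ S ≺ r ⇒ ⊢ S ⊹ (n ⊹ P) ≺ x ⊹ n) r P x S n rx c₁ ,
        inj₂ (at s (suc q) , at t q)

    far : n + P ≤ y → Cross e (edge s t s<t) → Goal
    far Z≤y c = case c (orient {e} (EdgeIs-sym {e} ie) (wrapped _ _ P rx ry y<x+n))
      where
      ry : r′ + (n + P) ≡ y
      ry = residue y (suc q) Z≤y (lia 5 (λ y x n P r → y ≺ x ⊹ n ⇒ r ⊹ P ≐ x ⇒ r ≺ n ⇒ ⊢ y ≺ n ⊹ (n ⊹ P))
             y x n P r y<x+n rx (toℕ<n (π x)))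
      case : Cross e (edge s t s<t) → src e ≡ π y × tgt e ≡ π x → Goal
      case (inj₁ (c₁ , c₂ , c₃)) (refl , refl) = R + P , S + suc q * n ,
        lia 4 (λ r P x R → r ⊹ P ≐ x ⇒ r ≺ R ⇒ ⊢ x ≺ R ⊹ P) r P x R rx c₃ ,
        lia 4 (λ P y R n → n ⊹ P ≼ y ⇒ R ≺ n ⇒ ⊢ R ⊹ P ≺ y) P y R n Z≤y R<n ,
        lia 5 (λ r P y S n → r ⊹ (n ⊹ P) ≐ y ⇒ r ≺ S ⇒ ⊢ y ≺ S ⊹ (n ⊹ P)) r′ P y S n ry c₁ ,
        lia 5 (λ r P x S n → r ⊹ P ≐ x ⇒ S ≺ r ⇒ ⊢ S ⊹ (n ⊹ P) ≺ x ⊹ n) r P x S n rx c₂ ,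
        inj₂ (at s (suc q) , at t q)
      case (inj₂ (c₁ , c₂ , c₃)) (refl , refl) = S + suc q * n , R + suc q * n ,
        lia 5 (λ r P x S n → r ⊹ P ≐ x ⇒ r ≺ n ⇒ ⊢ x ≺ S ⊹ (n ⊹ P)) r P x S n rx (toℕ<n (π x)) ,
        lia 5 (λ r P y S n → r ⊹ (n ⊹ P) ≐ y ⇒ S ≺ r ⇒ ⊢ S ⊹ (n ⊹ P) ≺ y) r′ P y S n ry c₁ ,
        lia 5 (λ r P y R n → r ⊹ (n ⊹ P) ≐ y ⇒ r ≺ R ⇒ ⊢ y ≺ R ⊹ (n ⊹ P)) r′ P y R n ry c₂ ,
        lia 5 (λ r P x R n → r ⊹ P ≐ x ⇒ R ≺ r ⇒ ⊢ R ⊹ (n ⊹ P) ≺ x ⊹ n) r P x R n rx c₃ ,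
        inj₁ (at s (suc q) , at t (suc q))

    go : y < n + P ⊎ n + P ≤ y → Cross e (edge s t s<t) → Goal
    go (inj₁ h) = near h
    go (inj₂ h) = far h

  nested : ∀ {e f : Edge n} a b c d → a ≤ c → c < d → d ≤ b → b < a + n →
           EdgeIs e (π a) (π b) → EdgeIs f (π c) (π d) → ¬ Cross e f
  nested {e} {f} a b c d a≤c c<d d≤b b<a+n ie if cr
    with cross-unlift {e} {f} a b (≤-<-trans a≤c (<-≤-trans c<d d≤b)) b<a+n ie cr
  ... | c′ , d′ , a<c′ , c′<b , b<d′ , d′<a+n , if′ with EdgeIs-ends {f} if if′
  ...   | inj₁ (_ , d≡d′) = <-irrefl (π-window a d≡d′ (≤-trans a≤c (<⇒≤ c<d)) (≤-<-trans d≤b b<a+n)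
            (<⇒≤ (<-trans a<c′ (<-trans c′<b b<d′))) d′<a+n) (≤-<-trans d≤b b<d′)
  ...   | inj₂ (c≡d′ , _) = <-irrefl (π-window a c≡d′ a≤c (<-trans c<d (≤-<-trans d≤b b<a+n))
            (<⇒≤ (<-trans a<c′ (<-trans c′<b b<d′))) d′<a+n) (<-trans (<-≤-trans c<d d≤b) b<d′)

  lifted : EdgeSet n → ℕ → ℕ → Set
  lifted T x y = Σ (Edge n) λ e → EdgeIs e (π x) (π y) × e ∈E T

  lifted? : ∀ T x y → Dec (lifted T x y)
  lifted? T x y with π x ≟ᶠ π y
  ... | yes eq = no λ where (e , ie , _) → EdgeIs-≢ {e} ie eq
  ... | no  ne with join ne
  ...   | e , ie with T e Bool.≟ true
  ...     | yes t = yes (e , ie , t)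
  ...     | no ¬t = no λ where (f , if , t) → ¬t (subst (_∈E T) (EdgeIs-≡ {f} {e} if ie) t)

  argmax : ∀ {m} (a : Fin (suc m) → ℕ) → ∃[ i ] (∀ j → a j ≤ a i)
  argmax {zero}  a = fzero , λ { fzero → ≤-refl }
  argmax {suc m} a with argmax (λ i → a (fsuc i))
  ... | i , max with ≤-total (a fzero) (a (fsuc i))
  ...   | inj₁ le = fsuc i , λ { fzero → le ; (fsuc j) → max j }
  ...   | inj₂ ge = fzero , λ { fzero → ≤-refl ; (fsuc j) → ≤-trans (max j) ge }

  module _ (T : EdgeSet n) where
    open Chains (lifted T)

    -- The unordered form of a chain, indexed like the crossings of `HasCrossing`.
    record Family (m p q x y : ℕ) : Set where
      field
        a b        : Fin m → ℕ
        e          : Fin m → Edge n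
        is         : ∀ i → EdgeIs (e i) (π (a i)) (π (b i))
        ∈T         : ∀ i → e i ∈E T
        p≤a        : ∀ i → p ≤ a i
        q≤b        : ∀ i → q ≤ b i
        a<x        : ∀ i → a i < x
        b<y        : ∀ i → b i < y
        comparable : ∀ i j → i ≢ j → (a i < a j × b i < b j) ⊎ (a j < a i × b j < b i)

    fromChain : ∀ {m p q x y} → Ch p q m x y → Family m p q x y
    fromChain [] = record
      { a = λ () ; b = λ () ; e = λ () ; is = λ () ; ∈T = λ () ; p≤a = λ () ; q≤b = λ ()
      ; a<x = λ () ; b<y = λ () ; comparable = λ () }
    fromChain {p = p} {q} {x} {y} (snoc {m} {a₀} {b₀} c (e₀ , ie , t) pa qb ax by) = record
      { a = λ { fzero → a₀ ; (fsuc i) → a i }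
      ; b = λ { fzero → b₀ ; (fsuc i) → b i }
      ; e = λ { fzero → e₀ ; (fsuc i) → e i }
      ; is = λ { fzero → ie ; (fsuc i) → is i }
      ; ∈T = λ { fzero → t ; (fsuc i) → ∈T i }
      ; p≤a = λ { fzero → pa ; (fsuc i) → p≤a i }
      ; q≤b = λ { fzero → qb ; (fsuc i) → q≤b i }
      ; a<x = λ { fzero → ax ; (fsuc i) → <-trans (a<x i) ax }
      ; b<y = λ { fzero → by ; (fsuc i) → <-trans (b<y i) by }
      ; comparable = λ where
          fzero    fzero    ne → ⊥-elim (ne refl)
          fzero    (fsuc j) _  → inj₂ (a<x j , b<y j)
          (fsuc i) fzero    _  → inj₁ (a<x i , b<y i)
          (fsuc i) (fsuc j) ne → comparable i j (λ eq → ne (cong fsuc eq)) }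
      where open Family (fromChain c)

    -- Selection sort: the member of greatest abscissa comes last, and comparability puts the others
    -- below it in both coordinates.
    toChain : ∀ m {p q x y} → Family m p q x y → Ch p q m x y
    toChain zero    F = []
    toChain (suc m) {p} {q} F with argmax (Family.a F)
    ... | i , a≤ = snoc (toChain m rest) (e i , is i , ∈T i) (p≤a i) (q≤b i) (a<x i) (b<y i)
      where
      open Family F
      under : ∀ j → a (punchIn i j) < a i × b (punchIn i j) < b i
      under j with comparable (punchIn i j) i (λ eq → punchInᵢ≢i i j eq)
      ... | inj₁ lt       = lt
      ... | inj₂ (gt , _) = ⊥-elim (<⇒≱ gt (a≤ (punchIn i j)))
      rest : Family m p q (a i) (b i)
      rest = record
        { a = λ j → a (punchIn i j) ; b = λ j → b (punchIn i j) ; e = λ j → e (punchIn i j)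
        ; is = λ j → is (punchIn i j) ; ∈T = λ j → ∈T (punchIn i j)
        ; p≤a = λ j → p≤a (punchIn i j) ; q≤b = λ j → q≤b (punchIn i j)
        ; a<x = λ j → proj₁ (under j) ; b<y = λ j → proj₂ (under j)
        ; comparable = λ j j′ ne →
            comparable (punchIn i j) (punchIn i j′) (λ eq → ne (punchIn-injective i j j′ eq)) }

    module _ {k : ℕ} (T-tri : IsKTriangulation k T) where

      private
        flip₀ : ∀ x y → lifted T x y → lifted T y (x + n)
        flip₀ x y (e , ie , t) = e , subst (EdgeIs e (π y)) (sym (π-+n x)) (EdgeIs-sym {e} ie) , t

        unflip₀ : ∀ x y → lifted T y (x + n) → lifted T x y
        unflip₀ x y (e , ie , t) = e , EdgeIs-sym {e} (subst (EdgeIs e (π y)) (π-+n x) ie) , t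

        noCr₀ : ∀ x z → ¬ Ch x z (suc k) z (x + n)
        noCr₀ x z c = proj₁ T-tri (e , ∈T , cross)
          where
          open Family (fromChain c)
          cross : ∀ i j → i ≢ j → Cross (e i) (e j)
          cross i j ne with comparable i j ne
          ... | inj₁ (a< , b<) = cross-lift {e i} {e j} _ _ _ _ a< (<-≤-trans (a<x j) (q≤b i)) b<
                  (<-≤-trans (b<y j) (+-monoˡ-≤ n (p≤a i))) (is i) (is j)
          ... | inj₂ (a> , b>) = Cross-sym {e j} {e i} (cross-lift {e j} {e i} _ _ _ _ a>
                  (<-≤-trans (a<x i) (q≤b j)) b> (<-≤-trans (b<y i) (+-monoˡ-≤ n (p≤a j))) (is j) (is i))

        -- Without such a chain, `T` with the edge (x , y) added has no (k+1)-crossing, so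
        -- maximality puts the edge into `T`: a crossing would have to use the new edge, and its k
        -- other members would lift to the chain.
        max₀ : ∀ x y → x < y → y < x + n → ¬ lifted T x y → Ch (suc x) (suc y) k y (x + n)
        max₀ x y x<y y<x+n ¬t with ch? (lifted? T) (suc x) (suc y) k y (x + n)
        ... | yes c = c
        ... | no ¬c = ⊥-elim (¬t (e₀ , ie₀ , proj₂ T-tri S T⊆S noS e₀ e₀∈S))
          where
          e₀ = proj₁ (join (π-≢ x<y y<x+n))
          ie₀ = proj₂ (join (π-≢ x<y y<x+n))
          S : EdgeSet n
          S e = T e ∨ does (e ≟ᴱ e₀)
          T⊆S : T ⊆E S
          T⊆S e t rewrite t = refl
          e₀∈S : e₀ ∈E S
          e₀∈S with e₀ ≟ᴱ e₀
          ... | yes _ = ∨-zeroʳ (T e₀)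
          ... | no ne = ⊥-elim (ne refl)
          S⊆ : ∀ e → e ∈E S → e ≢ e₀ → e ∈E T
          S⊆ e t ne with e ≟ᴱ e₀
          ... | yes eq = ⊥-elim (ne eq)
          ... | no _   = trans (sym (∨-identityʳ (T e))) t
          noS : ¬ HasCrossing (suc k) S
          noS (f , f∈S , cross) with any? (λ i → f i ≟ᴱ e₀)
          ... | no none = proj₁ T-tri (f , (λ i → S⊆ (f i) (f∈S i) (λ eq → none (i , eq))) , cross)
          ... | yes (i , eq) = ¬c (toChain k record
            { a = λ j → proj₁ (lift j) ; b = λ j → proj₁ (proj₂ (lift j)) ; e = g
            ; is = λ j → let (_ , _ , _ , _ , _ , _ , ig) = lift j in ig
            ; ∈T = λ j → S⊆ (g j) (f∈S (punchIn i j)) (λ g≡ → Cross-irrefl {e₀}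
                     (subst (Cross e₀) g≡ (crosses j)))
            ; p≤a = λ j → let (_ , _ , h , _) = lift j in h
            ; q≤b = λ j → let (_ , _ , _ , _ , h , _) = lift j in h
            ; a<x = λ j → let (_ , _ , _ , h , _) = lift j in h
            ; b<y = λ j → let (_ , _ , _ , _ , _ , h , _) = lift j in h
            ; comparable = comparable })
            where
            g : Fin k → Edge n
            g j = f (punchIn i j)
            crosses : ∀ j → Cross e₀ (g j)
            crosses j = subst (λ e → Cross e (g j)) eq
              (cross i (punchIn i j) (λ eq′ → punchInᵢ≢i i j (sym eq′)))
            lift : ∀ j → ∃[ a ] ∃[ b ] (x < a × a < y × y < b × b < x + n × EdgeIs (g j) (π a) (π b))
            lift j = cross-unlift {e₀} {g j} x y x<y y<x+n ie₀ (crosses j)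
            -- Two lifts that are not strictly comparable are nested, and nested edges do not cross.
            comparable : ∀ j j′ → j ≢ j′ →
              (proj₁ (lift j) < proj₁ (lift j′) × proj₁ (proj₂ (lift j)) < proj₁ (proj₂ (lift j′))) ⊎
              (proj₁ (lift j′) < proj₁ (lift j) × proj₁ (proj₂ (lift j′)) < proj₁ (proj₂ (lift j)))
            comparable j j′ ne with lift j | lift j′
                | cross (punchIn i j) (punchIn i j′) (λ e → ne (punchIn-injective i j j′ e))
            ... | a , b , x<a , a<y , y<b , b< , ig | a′ , b′ , x<a′ , a′<y , y<b′ , b′< , ig′ | cr
              with <-≤-connex a a′ | <-≤-connex b b′
            ... | inj₁ a<a′ | inj₁ b<b′ = inj₁ (a<a′ , b<b′)
            ... | inj₁ a<a′ | inj₂ b′≤b = ⊥-elim (nested {g j} {g j′} a b a′ b′ (<⇒≤ a<a′)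
                    (<-trans a′<y y<b′) b′≤b (<-trans b< (+-monoˡ-< n x<a)) ig ig′ cr)
            ... | inj₂ a′≤a | inj₁ b<b′ = ⊥-elim (nested {g j′} {g j} a′ b′ a b a′≤a
                    (<-trans a<y y<b) (<⇒≤ b<b′) (<-trans b′< (+-monoˡ-< n x<a′)) ig′ ig
                    (Cross-sym {g j} {g j′} cr))
            ... | inj₂ a′≤a | inj₂ b′≤b with m≤n⇒m<n∨m≡n a′≤a | m≤n⇒m<n∨m≡n b′≤b
            ...   | inj₁ a′<a | inj₁ b′<b = inj₂ (a′<a , b′<b)
            ...   | inj₂ refl | _ = ⊥-elim (nested {g j} {g j′} a b a′ b′ ≤-refl
                    (<-trans a′<y y<b′) b′≤b (<-trans b< (+-monoˡ-< n x<a)) ig ig′ cr)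
            ...   | _ | inj₂ refl = ⊥-elim (nested {g j′} {g j} a′ b′ a b a′≤a
                    (<-trans a<y y<b) ≤-refl (<-trans b′< (+-monoˡ-< n x<a′)) ig′ ig
                    (Cross-sym {g j} {g j′} cr))

      abstract
        kTri : Kernel.KTri k n (lifted T)
        kTri = record { T? = lifted? T ; flip = flip₀ ; unflip = unflip₀ ; noCr = noCr₀ ; max = max₀ }

-- Finite enumerations

record Enum {m : ℕ} (P : Fin m → Set) (c : ℕ) : Set where
  field
    at        : Fin c → Fin m
    sound     : ∀ i → P (at i)
    injective : ∀ {i j} → at i ≡ at j → i ≡ j
    index     : ∀ x → P x → Fin c
    at-index  : ∀ x p → at (index x p) ≡ x

module _ {m : ℕ} {Q : Fin (suc m) → Set} {c : ℕ} (E : Enum (λ x → Q (fsuc x)) c) where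
  open Enum E

  enum-add : Q fzero → Enum Q (suc c)
  enum-add q = record
    { at = λ { fzero → fzero ; (fsuc i) → fsuc (at i) }
    ; sound = λ { fzero → q ; (fsuc i) → sound i }
    ; injective = λ { {fzero}  {fzero}  _ → refl
                    ; {fsuc i} {fsuc j} h → cong fsuc (injective (fsuc-injective h)) }
    ; index = λ { fzero _ → fzero ; (fsuc x) q → fsuc (index x q) }
    ; at-index = λ { fzero _ → refl ; (fsuc x) q → cong fsuc (at-index x q) } }

  enum-skip : ¬ Q fzero → Enum Q c
  enum-skip ¬q = record
    { at = λ i → fsuc (at i) ; sound = sound ; injective = λ h → injective (fsuc-injective h)
    ; index = λ { fzero q → ⊥-elim (¬q q) ; (fsuc x) q → index x q }
    ; at-index = λ { fzero q → ⊥-elim (¬q q) ; (fsuc x) q → cong fsuc (at-index x q) } }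

count : ∀ {m} {P : Fin m → Set} → (∀ x → Dec (P x)) →
        ∃[ c ] ∃[ c′ ] (Enum P c × Enum (λ x → ¬ P x) c′ × c + c′ ≡ m)
count {zero}  P? = 0 , 0 , none , none , refl
  where
  none : ∀ {Q : Fin 0 → Set} → Enum Q 0
  none = record { at = λ () ; sound = λ () ; injective = λ { {()} }
                ; index = λ () ; at-index = λ () }
count {suc m} P? with count (λ x → P? (fsuc x))
... | c , c′ , E , E′ , eq with P? fzero
...   | yes p = suc c , c′ , enum-add E p , enum-skip E′ (λ ¬p → ¬p p) , cong suc eq
...   | no ¬p = c , suc c′ , enum-skip E ¬p , enum-add E′ ¬p , trans (+-suc c c′) (cong suc eq)

-- Fixed-point-free involutions and a threefold pigeonhole principle

module Orbits (k : ℕ) (τ : Fin (2 * k) → Fin (2 * k)) (ττ : ∀ i → τ (τ i) ≡ i) (τ≢ : ∀ i → τ i ≢ i) where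

  First : Fin (2 * k) → Set
  First i = toℕ i < toℕ (τ i)

  first-τ : ∀ {i} → First i → ¬ First (τ i)
  first-τ {i} p q = <-asym p (subst (λ j → toℕ (τ i) < toℕ j) (ττ i) q)

  ¬first-τ : ∀ {i} → ¬ First i → First (τ i)
  ¬first-τ {i} ¬p = subst (λ j → toℕ (τ i) < toℕ j) (sym (ττ i))
    (≤∧≢⇒< (≮⇒≥ ¬p) (λ h → τ≢ i (toℕ-injective h)))

  τ-injective : ∀ {i j} → τ i ≡ τ j → i ≡ j
  τ-injective {i} {j} h = trans (sym (ττ i)) (trans (cong τ h) (ττ j))

  abstract
    -- `τ` exchanges the elements that precede their image with those that do not, so each kind is
    -- half of the 2k elements.
    firsts : Enum First k
    firsts with count (λ i → toℕ i <? toℕ (τ i))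
    ... | c , c′ , E , E′ , eq = subst (Enum First) c≡k E
      where
      open Enum E
      open Enum E′ using () renaming (at to at′; sound to sound′; injective to injective′; index to index′; at-index to at-index′)
      c≤c′ : c ≤ c′
      c≤c′ = injective⇒≤ {f = λ i → index′ (τ (at i)) (first-τ (sound i))} λ {i} {j} h →
        injective (τ-injective (trans (sym (at-index′ _ _)) (trans (cong at′ h) (at-index′ _ _))))
      c′≤c : c′ ≤ c
      c′≤c = injective⇒≤ {f = λ i → index (τ (at′ i)) (¬first-τ (sound′ i))} λ {i} {j} h →
        injective′ (τ-injective (trans (sym (at-index _ _)) (trans (cong at h) (at-index _ _))))
      c≡k : c ≡ k
      c≡k = lia 3 (λ c c′ k → c ≼ c′ ⇒ c′ ≼ c ⇒ c ⊹ c′ ≐ 2 ⊠ k ⇒ ⊢ c ≐ k) c c′ k c≤c′ c′≤c eq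

-- The 2k boxes are the colors, doubled by a mark whether the color has occurred earlier. If x < y
-- share a box, then y is marked because of x, hence x is marked too, and its earlier companion is
-- the third element.
pigeonhole₃ : ∀ {k} (f : Fin (suc (2 * k)) → Fin k) →
              ¬ (∀ x y z → toℕ x < toℕ y → toℕ y < toℕ z → f x ≡ f y → f y ≡ f z → ⊥)
pigeonhole₃ {k} f noTriple = clash (pigeonhole (n<1+n (2 * k)) (λ x → combine (flag (earlier? x)) (f x)))
  where
  Earlier : Fin (suc (2 * k)) → Set
  Earlier x = ∃[ y ] (toℕ y < toℕ x × f y ≡ f x)
  earlier? : ∀ x → Dec (Earlier x)
  earlier? x = any? λ y → toℕ y <? toℕ x ×-dec f y ≟ᶠ f x
  flag : ∀ {P : Set} → Dec P → Fin 2
  flag (yes _) = fzero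
  flag (no _)  = fsuc fzero
  clash : ∃[ x ] ∃[ y ] (toℕ x < toℕ y × combine (flag (earlier? x)) (f x) ≡ combine (flag (earlier? y)) (f y)) → ⊥
  clash (x , y , x<y , h) with combine-injective (flag (earlier? x)) (f x) (flag (earlier? y)) (f y) h
  ... | same , fx≡fy with earlier? x | earlier? y
  ...   | yes (w , w<x , fw≡fx) | _ = noTriple w x y w<x x<y fw≡fx fx≡fy
  ...   | no _                  | no ¬p = ¬p (x , x<y , fx≡fy)

hasSize : ∀ {A : Set} {P : A → Set} {m} → (∀ {x} (p q : P x) → p ≡ q) → (f : Fin m → A) →
          (∀ i → P (f i)) → (∀ {i j} → f i ≡ f j → i ≡ j) → (∀ x → P x → ∃[ i ] f i ≡ x) →
          HasSize P m
hasSize {P = P} irr f sound inj complete = mk↔ₛ′ (λ i → f i , sound i) from to∘from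
    (λ i → inj (proj₂ (complete (f i) (sound i))))
  where
  from : Σ _ P → Fin _
  from (x , p) = proj₁ (complete x p)
  to∘from : ∀ y → (f (from y) , sound (from y)) ≡ y
  to∘from (x , p) with complete x p
  ... | i , refl = cong (f i ,_) (irr _ _)

hasSize-unique : ∀ {A : Set} {P : A → Set} {m m′} → HasSize P m → HasSize P m′ → m ≡ m′
hasSize-unique h h′ = ↔⇒≡ (↔-trans h (↔-sym h′))

-- Lengths

module Lengths (n′ : ℕ) where
  open Edges n′ public

  ⊓-swap : ∀ l → l ≤ n → (n ∸ l) ⊓ (n ∸ (n ∸ l)) ≡ l ⊓ (n ∸ l)
  ⊓-swap l l≤n = trans (cong ((n ∸ l) ⊓_) (m∸[m∸n]≡n l≤n)) (⊓-comm (n ∸ l) l)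

  dist-sym : ∀ (u v : Fin n) → dist u v ≡ dist v u
  dist-sym u v rewrite ∣-∣-comm (toℕ u) (toℕ v) = refl

  len-EdgeIs : ∀ {e : Edge n} {u v} → EdgeIs e u v → len e ≡ dist u v
  len-EdgeIs         (inj₁ (refl , refl)) = refl
  len-EdgeIs {e = e} (inj₂ (refl , refl)) = dist-sym (src e) (tgt e)

  dist-⊕ : ∀ x l → l < n → dist (π x) (π (x + l)) ≡ l ⊓ (n ∸ l)
  dist-⊕ x l l<n with <-≤-connex (x + l) (n + x / n * n)
  ... | inj₁ lt = cong (λ d → d ⊓ (n ∸ d)) (trans (cong (∣ toℕ (π x) -_∣) r′≡) (∣m-m+n∣≡n (toℕ (π x)) l))
    where
    r′≡ : toℕ (π (x + l)) ≡ toℕ (π x) + l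
    r′≡ = lia 5 (λ r r′ P x l → x ≐ r ⊹ P ⇒ r′ ⊹ P ≐ x ⊹ l ⇒ ⊢ r′ ≐ r ⊹ l)
      (toℕ (π x)) (toℕ (π (x + l))) (x / n * n) x l (π-lift x)
      (residue (x + l) (x / n) (≤-trans (subst (x / n * n ≤_) (sym (π-lift x)) (m≤n+m _ _)) (m≤m+n x l)) lt)
  ... | inj₂ ge = trans (cong (λ d → d ⊓ (n ∸ d))
                    (trans (cong (∣_- toℕ (π (x + l)) ∣) r≡) (trans (∣-∣-comm _ (toℕ (π (x + l))))
                      (∣m-m+n∣≡n (toℕ (π (x + l))) (n ∸ l)))))
                    (⊓-swap l (<⇒≤ l<n))
    where
    r≡ : toℕ (π x) ≡ toℕ (π (x + l)) + (n ∸ l)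
    r≡ = lia 7 (λ r r′ P x l n d → x ≐ r ⊹ P ⇒ r′ ⊹ (n ⊹ P) ≐ x ⊹ l ⇒ l ⊹ d ≐ n ⇒ ⊢ r ≐ r′ ⊹ d)
      (toℕ (π x)) (toℕ (π (x + l))) (x / n * n) x l n (n ∸ l) (π-lift x)
      (residue (x + l) (suc (x / n)) ge
        (lia 5 (λ x l n r P → x ≐ r ⊹ P ⇒ r ≺ n ⇒ l ≺ n ⇒ ⊢ x ⊹ l ≺ n ⊹ (n ⊹ P))
          x l n (toℕ (π x)) (x / n * n) (π-lift x) (toℕ<n (π x)) l<n))
      (m+[n∸m]≡n (<⇒≤ l<n))

  len-dart : ∀ {e : Edge n} {a} l → l < n → EdgeIs e a (a ⊕ l) → len e ≡ l ⊓ (n ∸ l)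
  len-dart {e} {a} l l<n ie = trans (len-EdgeIs {e} ie)
    (trans (cong (λ u → dist u (a ⊕ l)) (sym (π-toℕ a))) (dist-⊕ (toℕ a) l l<n))

  edge-dart : ∀ (e : Edge n) → ∃[ l ] (0 < l × l < n × EdgeIs e (src e) (src e ⊕ l))
  edge-dart e = l , m<n⇒0<n∸m (ord e) , ≤-<-trans (m∸n≤m _ (toℕ (src e))) (toℕ<n (tgt e)) ,
    inj₁ (refl , sym (trans (cong π (m+[n∸m]≡n (<⇒≤ (ord e)))) (π-toℕ (tgt e))))
    where
    l = toℕ (tgt e) ∸ toℕ (src e)

  ⊕-cancel : ∀ (a : Fin n) l m → l < n → m < n → a ⊕ l ≡ a ⊕ m → l ≡ m
  ⊕-cancel a l m l<n m<n h = +-cancelˡ-≡ (toℕ a) l m (π-window (toℕ a) h (m≤m+n _ l)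
    (+-monoʳ-< (toℕ a) l<n) (m≤m+n _ m) (+-monoʳ-< (toℕ a) m<n))

  ⊕-0 : ∀ (a : Fin n) → a ⊕ 0 ≡ a
  ⊕-0 a = trans (cong π (+-identityʳ (toℕ a))) (π-toℕ a)

  ⊕-≢ : ∀ (a : Fin n) l → 0 < l → l < n → a ⊕ l ≢ a
  ⊕-≢ a l 0<l l<n h = <-irrefl (⊕-cancel a 0 l (s≤s z≤n) l<n (trans (⊕-0 a) (sym h))) 0<l

  ⊕-full : ∀ (a : Fin n) x y → 0 < x → x < n → y < n → (a ⊕ x) ⊕ y ≡ a → x + y ≡ n
  ⊕-full a x y 0<x x<n y<n eq with <-cmp (x + y) n
  ... | tri< lt _ _ = ⊥-elim (⊕-≢ a (x + y) (<-≤-trans 0<x (m≤m+n x y)) lt (trans (sym (⊕-⊕ a x y)) eq))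
  ... | tri≈ _ h _  = h
  ... | tri> _ _ gt = ⊥-elim (⊕-≢ a d 0<d d<n (trans (sym (⊕-n (a ⊕ d)))
          (trans (⊕-⊕ a d n) (trans (cong (a ⊕_) d+n) (trans (sym (⊕-⊕ a x y)) eq)))))
    where
    d = x + y ∸ n
    d+n : d + n ≡ x + y
    d+n = m∸n+n≡m (<⇒≤ gt)
    0<d : 0 < d
    0<d = lia 3 (λ d n z → d ⊹ n ≐ z ⇒ n ≺ z ⇒ ⊢ # 0 ≺ d) d n (x + y) d+n gt
    d<n : d < n
    d<n = lia 4 (λ d n x y → d ⊹ n ≐ x ⊹ y ⇒ x ≺ n ⇒ y ≺ n ⇒ ⊢ d ≺ n) d n x y d+n x<n y<n

  dart-edge : ∀ (a : Fin n) l → 0 < l → l < n → Σ (Edge n) λ e → EdgeIs e a (a ⊕ l)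
  dart-edge a l 0<l l<n = join (λ h → ⊕-≢ a l 0<l l<n (sym h))

  -- Below n/2 an edge is a dart of length l from one of its ends only: from both, 2l would vanish
  -- modulo n.
  short-start : ∀ {e : Edge n} {a a′ : Fin n} l → 0 < l → 2 * l < n →
                EdgeIs e a (a ⊕ l) → EdgeIs e a′ (a′ ⊕ l) → a ≡ a′
  short-start {e} {a} {a′} l 0<l 2l<n ie ie′ with EdgeIs-ends {e} ie ie′
  ... | inj₁ (eq , _) = eq
  ... | inj₂ (refl , eq) = ⊥-elim (⊕-≢ a′ (l + l) (<-≤-trans 0<l (m≤m+n l l))
          (subst (_< n) (cong (λ x → l + x) (+-identityʳ l)) 2l<n) (trans (sym (⊕-⊕ a′ l l)) eq))

  short-edge : ∀ {e : Edge n} l → 0 < l → 2 * l < n → len e ≡ l → ∃[ a ] EdgeIs e a (a ⊕ l)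
  short-edge {e} l 0<l 2l<n eq with edge-dart e
  ... | d , 0<d , d<n , ie with ⊓-sel d (n ∸ d)
  ...   | inj₁ h = src e , subst (λ m → EdgeIs e (src e) (src e ⊕ m))
                     (trans (sym h) (trans (sym (len-dart {e} d d<n ie)) eq)) ie
  ...   | inj₂ h = src e ⊕ d , subst (EdgeIs e (src e ⊕ d)) (sym back) (EdgeIs-sym {e} ie)
    where
    n∸d≡l : n ∸ d ≡ l
    n∸d≡l = trans (sym h) (trans (sym (len-dart {e} d d<n ie)) eq)
    back : (src e ⊕ d) ⊕ l ≡ src e
    back = trans (⊕-⊕ (src e) d l) (trans (cong (src e ⊕_)
      (trans (cong (d +_) (sym n∸d≡l)) (m+[n∸m]≡n (<⇒≤ d<n)))) (⊕-n (src e)))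

  short-len : ∀ {e : Edge n} {a} l → 2 * l < n → EdgeIs e a (a ⊕ l) → len e ≡ l
  short-len {e} l 2l<n ie = trans (len-dart {e} l l<n ie) (m≤n⇒m⊓n≡m
      (lia 3 (λ l d n → l ⊹ d ≐ n ⇒ 2 ⊠ l ≺ n ⇒ ⊢ l ≼ d) l (n ∸ l) n (m+[n∸m]≡n (<⇒≤ l<n)) 2l<n))
    where
    l<n : l < n
    l<n = lia 2 (λ l n → 2 ⊠ l ≺ n ⇒ ⊢ l ≺ n) l n 2l<n

-- The equivalences

module Main (k n′ : ℕ) (1<k : 1 < k) (2k+3≤n : 2 * k + 3 ≤ suc n′)
            (T : EdgeSet (suc n′)) (T-tri : IsKTriangulation k T) where

  open Lengths n′

  T̂ : ℕ → ℕ → Set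
  T̂ = lifted T

  0<k : 0 < k
  0<k = <-trans (s≤s z≤n) 1<k

  tri : Kernel.KTri k n T̂
  tri = kTri T T-tri

  open Kernel.KTri tri
  open Stars k n′ T̂ 0<k 2k+3≤n tri
    using (Star; M; M<n; module Unroll; outer; middle; module Points; Normal; middle-agree;
           normal-agree; normalise; Boundary; End; module Ends; lift-pair; shifts)

  -- Indices of the points of a star are residues modulo M = 2k + 1.
  module R = Lengths (2 * k)

  k<M : k < M
  k<M = lia 1 (λ k → ⊢ k ≺ # 1 ⊹ 2 ⊠ k) k

  k<n : k < n
  k<n = <-trans k<M M<n

  cIII : Set
  cIII = ¬ (Σ (StarPoints n k) λ st → StarIn st T × Internal st)

  -- Chord lengths, and the passage from point sets to periodic stars

  Chord : Star → Edge n → ℕ → Set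
  Chord S e j = EdgeIs e (π (Star.s S j)) (π (Star.s S (k + j)))

  chord∈T : ∀ S {e} j → Chord S e j → e ∈E T
  chord∈T S {e} j ie with Star.chord S j
  ... | f , if , t = subst (_∈E T) (EdgeIs-≡ {f} {e} if ie) t

  module _ (S : Star) {e : Edge n} (j : ℕ) (ie : Chord S e j) where
    open Star S
    open Points S

    private
      l = s (k + j) ∸ s j

      s+l : s j + l ≡ s (k + j)
      s+l = m+[n∸m]≡n (≤-trans (m≤n+m _ k) (s-growth k j))

      k≤l : k ≤ l
      k≤l = lia 4 (λ k x y l → x ⊹ l ≐ y ⇒ k ⊹ x ≼ y ⇒ ⊢ k ≼ l) k (s j) (s (k + j)) l s+l (s-growth k j)

      l+k<n : l + suc k ≤ n
      l+k<n = lia 5 (λ k x y l n → x ⊹ l ≐ y ⇒ y ⊹ (# 1 ⊹ k) ≼ x ⊹ n ⇒ ⊢ l ⊹ (# 1 ⊹ k) ≼ n)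
        k (s j) (s (k + j)) l n s+l (s-gap j)

      l<n : l < n
      l<n = <-≤-trans (m<m+n l (s≤s z≤n)) l+k<n

      k<n∸l : k < n ∸ l
      k<n∸l = lia 4 (λ l k n d → l ⊹ (# 1 ⊹ k) ≼ n ⇒ l ⊹ d ≐ n ⇒ ⊢ k ≺ d) l k n (n ∸ l)
        l+k<n (m+[n∸m]≡n (<⇒≤ l<n))

      len≡ : len e ≡ l ⊓ (n ∸ l)
      len≡ = trans (len-EdgeIs {e} ie)
        (trans (cong (λ y → dist (π (s j)) (π y)) (sym s+l)) (dist-⊕ (s j) l l<n))

    chord-len≥k : k ≤ len e
    chord-len≥k = subst (k ≤_) (sym len≡) (⊓-glb k≤l (<⇒≤ k<n∸l))

    chord-boundary : len e ≡ k → Boundary S j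
    chord-boundary h with m≤n⇒m<n∨m≡n k≤l
    ... | inj₁ k<l = ⊥-elim (<-irrefl (sym (trans (sym len≡) h)) (⊓-glb k<l k<n∸l))
    ... | inj₂ k≡l = trans (sym s+l) (trans (cong (s j +_) (sym k≡l)) (+-comm (s j) k))

    boundary-chord : Boundary S j → len e ≡ k
    boundary-chord bd = trans len≡ (trans (cong (λ d → d ⊓ (n ∸ d)) l≡k)
        (m≤n⇒m⊓n≡m (subst (λ d → k ≤ n ∸ d) l≡k (<⇒≤ k<n∸l))))
      where
      l≡k : l ≡ k
      l≡k = lia 4 (λ k x y l → x ⊹ l ≐ y ⇒ y ≐ k ⊹ x ⇒ ⊢ l ≐ k) k (s j) (s (k + j)) l s+l bd

  pts-injective : ∀ (st : StarPoints n k) {i j} → StarPoints.pts st i ≡ StarPoints.pts st j → i ≡ j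
  pts-injective (star pts incr) {i} {j} h with <-cmp (toℕ i) (toℕ j)
  ... | tri< lt _ _ = ⊥-elim (<-irrefl (cong toℕ h) (incr i j lt))
  ... | tri≈ _ eq _ = toℕ-injective eq
  ... | tri> _ _ gt = ⊥-elim (<-irrefl (cong toℕ (sym h)) (incr j i gt))

  module FromPoints (st : StarPoints n k) (st∈T : StarIn st T) where
    open StarPoints st

    pt : ℕ → Fin n
    pt j = pts (R.π j)

    private
      f : ℕ → ℕ
      f j = toℕ (pt j)

    edgeAt : ∀ (i : Fin M) → Σ (Edge n) λ e → EdgeIs e (pts i) (pts (i ⊕ k))
    edgeAt i = join (λ h → R.⊕-≢ i k 0<k k<M (sym (pts-injective st h)))

    private
      chordT : ∀ j → T̂ (f j) (f (j + k))
      chordT j with edgeAt (R.π j)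
      ... | e , ie = e ,
        subst₂ (EdgeIs e) (sym (π-toℕ (pt j)))
          (trans (cong pts (R.π-⊕ j k)) (sym (π-toℕ (pt (j + k))))) ie ,
        st∈T e (R.π j , ie)

      sym-T̂ : ∀ {x y} → T̂ x y → T̂ y x
      sym-T̂ (e , ie , t) = e , EdgeIs-sym {e} ie , t

      f-inc : ∀ j → j < 2 * k → f j < f (suc j)
      f-inc j j<2k = incr (R.π j) (R.π (suc j)) (subst₂ _<_ (sym (idx j (m<n⇒m<1+n j<2k)))
          (sym (idx (suc j) (s≤s j<2k))) (n<1+n j))
        where
        idx : ∀ j → j < M → toℕ (R.π j) ≡ j
        idx j j<M = trans (R.toℕ-π j) (m<n⇒m%n≡m j<M)

      f-chord′ : ∀ j → T̂ (f j) (f (k + suc j))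
      f-chord′ j = sym-T̂ {f (k + suc j)} {f j} (subst (T̂ (f (k + suc j))) (cong (λ i → toℕ (pts i)) back)
          (chordT (k + suc j)))
        where
        back : R.π (k + suc j + k) ≡ R.π j
        back = trans (cong R.π (lia 2 (λ k j → ⊢ k ⊹ (# 1 ⊹ j) ⊹ k ≐ j ⊹ (# 1 ⊹ 2 ⊠ k)) k j)) (R.π-+n j)

    open Unroll f f-inc (<-≤-trans (toℕ<n (pt (2 * k))) (m≤n+m n (f 0)))
      (λ j _ → subst (λ i → T̂ (f j) (f i)) (+-comm j k) (chordT j)) (λ j _ → f-chord′ j)
      using (unrolled; g-init)

    S : Star
    S = unrolled

    normal : Normal S
    normal = subst (_< n) (sym (g-init (2 * k) ≤-refl)) (toℕ<n (pt (2 * k)))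

    at : ∀ j → π (Star.s S j) ≡ pt j
    at j = trans (π-shift (f (j % M)) (j / M)) (trans (π-toℕ (pt (j % M)))
      (cong pts (R.π-cong (j % M) j (m%n%n≡m%n j M))))

    chordAt : ∀ e (h : InStar st e) → Chord S e (toℕ (proj₁ h))
    chordAt e (i , ie) = subst₂ (EdgeIs e)
      (trans (cong pts (sym (R.π-toℕ i))) (sym (at (toℕ i))))
      (trans (cong pt (+-comm (toℕ i) k)) (sym (at (k + toℕ i)))) ie

    inStarAt : ∀ {e} j → Chord S e j → InStar st e
    inStarAt {e} j ie = R.π j , subst₂ (EdgeIs e) (at j)
      (trans (at (k + j)) (cong pts (trans (cong R.π (+-comm k j)) (sym (R.π-⊕ j k))))) ie

  abstract
    fromPoints : ∀ (st : StarPoints n k) → StarIn st T → Σ Star λ S → Normal S × (∀ e j → Chord S e j → InStar st e)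
    fromPoints st st∈T = S , normal , λ e j → inStarAt {e} j
      where open FromPoints st st∈T

  -- Colorings and internal stars

  i⇒ii : KColorable k T → StarColorable k T
  i⇒ii (col , proper) = col , λ where
      st st∈T (e₁ , e₂ , e₃ , ne₁₂ , ne₁₃ , ne₂₃ , in₁ , in₂ , in₃ , r₁ , r₂ , r₃ , c₁₂ , c₂₃) →
        let open Triple st st∈T (col e₃) in
        triple (item e₁ in₁ r₁ (trans c₁₂ c₂₃)) (item e₂ in₂ r₂ c₂₃) (item e₃ in₃ r₃ refl) ne₁₂ ne₁₃ ne₂₃
    where
    module Triple (st : StarPoints n k) (st∈T : StarIn st T) (c : Fin k) where
      open FromPoints st st∈T
      open Star S
      open Points S

      record Item : Set where
        constructor item
        field
          e   : Edge n
          in★ : InStar st e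
          rel : Relevant k e
          hue : col e ≡ c
        ix : ℕ
        ix = toℕ (proj₁ in★)
      open Item

      apart : ∀ x y → ¬ Cross (e x) (e y)
      apart x y cr = proper (e x) (e y) (st∈T (e x) (in★ x)) (st∈T (e y) (in★ y)) (rel x) (rel y) cr
        (trans (hue x) (sym (hue y)))

      -- Chords of a star that start fewer than k points apart, in either direction round the star,
      -- cross each other; the remaining ones have a common endpoint.
      share : ∀ x y → ix x < ix y → ix y ≡ k + ix x ⊎ ix y ≡ suc k + ix x
      share x y i<j with <-cmp (ix y) (k + ix x)
      ... | tri≈ _ eq _ = inj₁ eq
      ... | tri< j<k+i _ _ = ⊥-elim (apart x y (cross-lift {e x} {e y} _ _ _ _
              (s-mono i<j) (s-mono j<k+i) (s-mono (+-monoʳ-< k i<j))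
              (subst (s (k + ix y) <_) (per (ix x)) (s-mono (lia 3 (λ i j k → j ≺ k ⊹ i ⇒
                ⊢ k ⊹ j ≺ # 1 ⊹ 2 ⊠ k ⊹ i) (ix x) (ix y) k j<k+i)))
              (chordAt (e x) (in★ x)) (chordAt (e y) (in★ y))))
      ... | tri> _ _ k+i<j with m≤n⇒m<n∨m≡n k+i<j
      ...   | inj₂ eq = inj₂ (sym eq)
      ...   | inj₁ 1+k+i<j = ⊥-elim (apart y x (cross-lift {e y} {e x} _ _ (s (ix x) + n) (s (k + ix x) + n)
              (subst (s (ix y) <_) (per (ix x)) (s-mono (<-≤-trans (toℕ<n (proj₁ (in★ y))) (m≤m+n M (ix x)))))
              (subst (_< s (k + ix y)) (per (ix x)) (s-mono (lia 3 (λ i j k → # 1 ⊹ k ⊹ i ≺ j ⇒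
                ⊢ # 1 ⊹ 2 ⊠ k ⊹ i ≺ k ⊹ j) (ix x) (ix y) k 1+k+i<j)))
              (subst (s (k + ix y) <_) (per (k + ix x)) (s-mono (lia 3 (λ i j k → j ≺ # 1 ⊹ 2 ⊠ k ⇒
                ⊢ k ⊹ j ≺ # 1 ⊹ 2 ⊠ k ⊹ (k ⊹ i)) (ix x) (ix y) k (toℕ<n (proj₁ (in★ y))))))
              (+-monoˡ-< n (s-mono (<-trans (n<1+n _) (1+k+i<j))))
              (chordAt (e y) (in★ y))
              (subst₂ (EdgeIs (e x)) (sym (π-+n (s (ix x)))) (sym (π-+n (s (k + ix x)))) (chordAt (e x) (in★ x)))))

      -- Two gaps of at least k would have a sum of at most k+1, which k > 1 forbids.
      sorted : ∀ x y z → ix x < ix y → ix y < ix z → ⊥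
      sorted x y z x<y y<z = lia 4 (λ i j l k → k ⊹ i ≼ j ⇒ k ⊹ j ≼ l ⇒ l ≼ # 1 ⊹ k ⊹ i ⇒ # 1 ≺ k ⇒ ⊢⊥)
          (ix x) (ix y) (ix z) k (lo (share x y x<y)) (lo (share y z y<z)) (hi (share x z (<-trans x<y y<z))) 1<k
        where
        lo : ∀ {i j} → j ≡ k + i ⊎ j ≡ suc k + i → k + i ≤ j
        lo (inj₁ refl) = ≤-refl
        lo (inj₂ refl) = n≤1+n _
        hi : ∀ {i j} → j ≡ k + i ⊎ j ≡ suc k + i → j ≤ suc k + i
        hi (inj₁ refl) = n≤1+n _
        hi (inj₂ refl) = ≤-refl

      distinct : ∀ x y → e x ≢ e y → ix x ≢ ix y
      distinct x y ne h = ne (EdgeIs-≡ {e x} {e y} (chordAt (e x) (in★ x))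
        (subst (Chord S (e y)) (sym h) (chordAt (e y) (in★ y))))

      triple : ∀ x y z → e x ≢ e y → e x ≢ e z → e y ≢ e z → ⊥
      triple x y z xy xz yz with <-cmp (ix x) (ix y) | <-cmp (ix y) (ix z) | <-cmp (ix x) (ix z)
      ... | tri≈ _ h _ | _ | _ = distinct x y xy h
      ... | _ | tri≈ _ h _ | _ = distinct y z yz h
      ... | _ | _ | tri≈ _ h _ = distinct x z xz h
      ... | tri< a _ _ | tri< b _ _ | _          = sorted x y z a b
      ... | tri< a _ _ | tri> _ _ b | tri< c _ _ = sorted x z y c b
      ... | tri< a _ _ | tri> _ _ b | tri> _ _ c = sorted z x y c a
      ... | tri> _ _ a | tri< b _ _ | tri< c _ _ = sorted y x z a c
      ... | tri> _ _ a | tri< b _ _ | tri> _ _ c = sorted y z x b c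
      ... | tri> _ _ a | tri> _ _ b | _          = sorted z y x b a

  -- All 2k+1 edges of an internal star are relevant, since chords have length at least k, and k
  -- colors must repeat thrice on them.
  ii⇒iii : StarColorable k T → cIII
  ii⇒iii (col , few) (st , st∈T , int) = pigeonhole₃ (λ i → col (E i)) λ x y z x<y y<z c₁₂ c₂₃ →
      few st st∈T (E x , E y , E z , distinct (<⇒≢ x<y) , distinct (<⇒≢ (<-trans x<y y<z)) , distinct (<⇒≢ y<z) ,
        inS x , inS y , inS z , rel x , rel y , rel z , c₁₂ , c₂₃)
    where
    open FromPoints st st∈T
    open StarPoints st
    E : Fin M → Edge n
    E i = proj₁ (edgeAt i)
    inS : ∀ i → InStar st (E i)
    inS i = i , proj₂ (edgeAt i)
    rel : ∀ i → Relevant k (E i)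
    rel i = ≤∧≢⇒< (chord-len≥k S {E i} (toℕ i) (chordAt (E i) (inS i))) (λ h → int (E i) (inS i) (sym h))
    distinct : ∀ {i j} → toℕ i ≢ toℕ j → E i ≢ E j
    distinct {i} {j} ne h with EdgeIs-ends {E i} (proj₂ (edgeAt i))
                                 (subst (λ e → EdgeIs e (pts j) (pts (j ⊕ k))) (sym h) (proj₂ (edgeAt j)))
    ... | inj₁ (eq , _)   = ne (cong toℕ (pts-injective st eq))
    -- Equal edges with exchanged ends would give j + 2k = j modulo 2k+1.
    ... | inj₂ (eq , eq′) = R.⊕-≢ j (k + k) (<-≤-trans 0<k (m≤m+n k k))
            (lia 1 (λ k → ⊢ k ⊹ k ≺ # 1 ⊹ 2 ⊠ k) k)
            (trans (sym (R.⊕-⊕ j k k)) (trans (cong (_⊕ k) (sym (pts-injective st eq)))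
              (pts-injective st eq′)))

  toPoints : ∀ S → Normal S → Σ (StarPoints n k) λ st → StarIn st T ×
             (∀ e → InStar st e → ∃[ j ] (j < M × Chord S e j))
  toPoints S nf = st , (λ e h → chord∈T S {e} (toℕ (proj₁ h)) (chordAt e h)) ,
      λ e h → toℕ (proj₁ h) , toℕ<n (proj₁ h) , chordAt e h
    where
    open Star S
    open Points S
    val : ∀ (i : Fin M) → toℕ (π (s (toℕ i))) ≡ s (toℕ i)
    val i = trans (toℕ-π (s (toℕ i))) (m<n⇒m%n≡m (≤-<-trans
      (subst (λ m → s (toℕ i) ≤ s m) (m∸n+n≡m (m<1+n⇒m≤n (toℕ<n i)))
        (≤-trans (m≤n+m _ (2 * k ∸ toℕ i)) (s-growth (2 * k ∸ toℕ i) (toℕ i)))) nf))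
    st : StarPoints n k
    st = star (λ i → π (s (toℕ i))) λ i j i<j →
      subst₂ _<_ (sym (val i)) (sym (val j)) (s-mono i<j)
    wrap : ∀ j → π (s (toℕ (R.π j))) ≡ π (s j)
    wrap j = trans (cong (λ i → π (s i)) (R.toℕ-π j)) (trans (sym (π-shift (s (j % M)) (j / M)))
      (cong π (trans (sym (pers (j / M) (j % M))) (cong s (trans (+-comm (j / M * M) _)
        (sym (m≡m%n+[m/n]*n j M)))))))
    chordAt : ∀ e (h : InStar st e) → Chord S e (toℕ (proj₁ h))
    chordAt e (i , ie) = subst (EdgeIs e (π (s (toℕ i))))
      (trans (wrap (toℕ i + k)) (cong (λ j → π (s j)) (+-comm (toℕ i) k))) ie

  abstract
    external : cIII → ∀ S → ∃[ j ] Boundary S j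
    external h S with normalise S
    ... | S° , nf , i , q , eq with anyUpTo? (λ j → Star.s S° (k + j) ≟ k + Star.s S° j) M
    ...   | yes (j , _ , bd) = i + j , (begin
            Star.s S (k + (i + j))       ≡⟨ cong (Star.s S) (lia 3 (λ k i j → ⊢ k ⊹ (i ⊹ j) ≐ i ⊹ (k ⊹ j)) k i j) ⟩
            Star.s S (i + (k + j))       ≡⟨ sym (eq (k + j)) ⟩
            Star.s S° (k + j) + q * n    ≡⟨ cong (_+ q * n) bd ⟩
            k + Star.s S° j + q * n      ≡⟨ +-assoc k _ _ ⟩
            k + (Star.s S° j + q * n)    ≡⟨ cong (k +_) (eq j) ⟩
            k + Star.s S (i + j)         ∎)
      where open ≡-Reasoning
    ...   | no none with toPoints S° nf
    ...     | st , st∈T , chords = ⊥-elim (h (st , st∈T , λ e e∈ len≡k →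
              let (j , j<M , ie) = chords e e∈ in none (j , j<M , chord-boundary S° {e} j ie len≡k)))

  -- Counting ears

  Ear : Fin n → Set
  Ear a = T̂ (toℕ a) (toℕ a + suc k)

  ear? : ∀ a → Dec (Ear a)
  ear? a = T? (toℕ a) (toℕ a + suc k)

  level-irrelevant : ∀ {l} {e : Edge n} (p q : e ∈E T × len e ≡ l) → p ≡ q
  level-irrelevant (p , q) (p′ , q′) = cong₂ _,_ (Decidable⇒UIP.≡-irrelevant Bool._≟_ p p′) (≡-irrelevant q q′)

  level-size : ∀ l {c} → 0 < l → 2 * l < n → Enum (λ a → T̂ (toℕ a) (toℕ a + l)) c →
               HasSize (λ e → e ∈E T × len e ≡ l) c
  level-size l 0<l 2l<n E = hasSize level-irrelevant f
      (λ i → proj₂ (proj₂ (sound i)) , short-len {f i} l 2l<n (is i))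
      (λ {i} {j} h → injective (short-start {f i} l 0<l 2l<n (is i) (subst (λ e → EdgeIs e (at j) (at j ⊕ l)) (sym h) (is j))))
      complete
    where
    open Enum E
    f : Fin _ → Edge n
    f i = proj₁ (sound i)
    is : ∀ i → EdgeIs (f i) (at i) (at i ⊕ l)
    is i = subst (λ u → EdgeIs (f i) u (at i ⊕ l)) (π-toℕ (at i)) (proj₁ (proj₂ (sound i)))
    complete : ∀ e → e ∈E T × len e ≡ l → ∃[ i ] f i ≡ e
    complete e (t , h) with short-edge {e} l 0<l 2l<n h
    ... | a , ie = i , EdgeIs-≡ {f i} {e} (subst (λ u → EdgeIs (f i) u (u ⊕ l)) (at-index a d) (is i)) ie
      where
      d : T̂ (toℕ a) (toℕ a + l)
      d = e , subst (λ u → EdgeIs e u (a ⊕ l)) (sym (π-toℕ a)) ie , t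
      i = index a d

  2k<n : 2 * k < n
  2k<n = <-trans (n<1+n _) M<n

  open Kernel.Lifted k n T̂ 0<k 2k<n tri using (short)

  2[1+k]<n : 2 * suc k < n
  2[1+k]<n = lia 2 (λ k n → 2 ⊠ k ⊹ # 3 ≼ n ⇒ ⊢ 2 ⊠ (# 1 ⊹ k) ≺ n) k n 2k+3≤n

  ends-π : ∀ S {i j} → End S i → End S j → π (Star.s S i) ≡ π (Star.s S j)
  ends-π S ei ej with Ends.end-reduce S ei | Ends.end-reduce S ej
  ... | r , q , r<M , er , eq | r′ , q′ , r′<M , er′ , eq′ =
    trans (cong π eq) (trans (π-shift (Star.s S r) q) (trans (cong (λ i → π (Star.s S i)) r≡r′)
      (trans (sym (π-shift (Star.s S r′) q′)) (cong π (sym eq′)))))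
    where
    r≡r′ : r ≡ r′
    r≡r′ with <-cmp r r′
    ... | tri< lt _ _ = ⊥-elim (Ends.end-unique S er er′ lt (<-≤-trans r′<M (m≤m+n M r)))
    ... | tri≈ _ h _  = h
    ... | tri> _ _ gt = ⊥-elim (Ends.end-unique S er′ er gt (<-≤-trans r<M (m≤m+n M r′)))

  end-cong : ∀ {S S′} → (∀ j → Star.s S j ≡ Star.s S′ j) → ∀ {j} → End S j → End S′ j
  end-cong h {j} (bd , e) = trans (sym (h (k + j))) (trans bd (cong (k +_) (h j))) ,
    λ h′ → e (trans (h (suc k + j)) (trans h′ (cong (suc k +_) (sym (h j)))))

  record Site (x : Fin n) : Set where
    field
      S      : Star
      normal : Normal S
      j      : ℕ
      end    : End S j
      at     : π (Star.s S j) ≡ x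

  -- The boundary edge (x , x + k) lies in a star by `outer`, and without an ear at x it is the last
  -- of its run.
  site : ∀ x → ¬ Ear x → Site x
  site x ¬ear with outer (toℕ x) (toℕ x + k) ≤-refl
      (lia 3 (λ x k n → 2 ⊠ k ≺ n ⇒ ⊢ x ⊹ k ⊹ k ≺ x ⊹ n) (toℕ x) k n 2k<n)
      (short (toℕ x) (toℕ x + k) (m<m+n (toℕ x) 0<k) ≤-refl)
  ... | S₀ , s0 , sk with normalise S₀
  ... | S , nf , i , q , eq = record { S = S ; normal = nf ; j = j ; end = bd , ne ; at = at }
    where
    open Star S₀ using () renaming (s to s₀)
    open Star S
    -- Point i + i * 2k of the star before normalising is point `i * M`, a copy of point 0.
    j = i * (2 * k)
    end₀ : End S₀ 0
    end₀ = Ends.nonear-end S₀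
      (trans (cong s₀ (+-identityʳ k)) (trans sk (trans (+-comm (toℕ x) k) (cong (k +_) (sym s0)))))
      (λ t → ¬ear (subst₂ T̂ s0 (trans (cong (suc k +_) s0) (+-comm (suc k) (toℕ x))) t))
    idx : i * M + 0 ≡ i + j
    idx = trans (+-identityʳ _) (*-suc i (2 * k))
    endᵢ : End S₀ (i + j)
    endᵢ = subst (End S₀) idx (Ends.end-shift S₀ i end₀)
    move : ∀ c → s (c + j) + q * n ≡ s₀ (c + (i + j))
    move c = trans (eq (c + j)) (cong s₀ (lia 3 (λ c i j → ⊢ i ⊹ (c ⊹ j) ≐ c ⊹ (i ⊹ j)) c i j))
    bd : Boundary S j
    bd = +-cancelʳ-≡ (q * n) _ _ (trans (move k) (trans (proj₁ endᵢ)
           (trans (cong (k +_) (sym (eq j))) (sym (+-assoc k (s j) (q * n))))))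
    ne : s (suc k + j) ≢ suc k + s j
    ne h = proj₂ endᵢ (trans (sym (move (suc k))) (trans (cong (_+ q * n) h)
             (trans (+-assoc (suc k) (s j) (q * n)) (cong (suc k +_) (eq j)))))
    at : π (s j) ≡ x
    at = trans (sym (π-shift (s j) q)) (trans (cong π (trans (eq j) (trans (cong s₀ (sym idx))
           (trans (Points.pers S₀ i 0) (cong (_+ i * n) s0))))) (trans (π-shift (toℕ x) i) (π-toℕ x)))

  module _ (S : Star) (nf : Normal S) where
    open Star S
    open Points S

    k≤mid : k ≤ s k
    k≤mid = ≤-trans (m≤m+n k (s 0)) (subst (λ j → k + s 0 ≤ s j) (+-identityʳ k) (s-growth k 0))

    mid+k<n : s k + k < n
    mid+k<n = ≤-<-trans (subst₂ _≤_ (+-comm k (s k)) (cong (λ j → s (k + j)) (sym (+-identityʳ k)))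
      (s-growth k k)) nf

    -- Counted from k, since k points of the star precede the middle one and k follow it within
    -- `[0,n)`.
    mid : Fin (n ∸ 2 * k)
    mid = fromℕ< {s k ∸ k} (lia 5 (λ k x d n e → k ⊹ d ≐ x ⇒ x ⊹ k ≺ n ⇒ 2 ⊠ k ⊹ e ≐ n ⇒ ⊢ d ≺ e)
      k (s k) (s k ∸ k) n (n ∸ 2 * k) (m+[n∸m]≡n k≤mid) mid+k<n (m+[n∸m]≡n (<⇒≤ 2k<n)))

    toℕ-mid : k + toℕ mid ≡ s k
    toℕ-mid = trans (cong (k +_) (toℕ-fromℕ< _)) (m+[n∸m]≡n k≤mid)

  mid-agree : ∀ S S′ nf nf′ → mid S nf ≡ mid S′ nf′ → ∀ j → Star.s S j ≡ Star.s S′ j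
  mid-agree S S′ nf nf′ h = middle-agree {S} {S′} nf nf′
    (trans (sym (toℕ-mid S nf)) (trans (cong (λ i → k + toℕ i) h) (toℕ-mid S′ nf′)))

  site-mid : ∀ {x} → Site x → Fin (n ∸ 2 * k)
  site-mid s = mid (Site.S s) (Site.normal s)

  -- Equal middle points give equal stars, and a star has one end per period.
  site-injective : ∀ {x y} (s : Site x) (t : Site y) → site-mid s ≡ site-mid t → x ≡ y
  site-injective s t h = trans (sym s.at) (trans
      (ends-π s.S s.end (end-cong {t.S} {s.S} (λ j → sym (agree j)) t.end))
      (trans (cong π (agree t.j)) t.at))
    where
    module s = Site s
    module t = Site t
    agree : ∀ j → Star.s s.S j ≡ Star.s t.S j
    agree = mid-agree s.S t.S s.normal t.normal h

  -- By assumption n - 2k vertices start no ear. The sites at these vertices take up all n - 2k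
  -- middle points with external stars, so that an internal star would need one more.
  iv⇒iii : HasSize (λ e → e ∈E T × len e ≡ suc k) (2 * k) → cIII
  iv⇒iii size (st , st∈T , int) with count ear? | fromPoints st st∈T
  ... | c , c′ , E , E′ , c+c′ | S , normal , inStarAt =
      <-irrefl refl (subst (suc c′ ≤_) n∸2k≡c′ (injective⇒≤ {f = f} f-injective))
    where
    open Enum E′
    c≡2k : c ≡ 2 * k
    c≡2k = hasSize-unique (level-size (suc k) (s≤s z≤n) 2[1+k]<n E) size
    n∸2k≡c′ : n ∸ 2 * k ≡ c′
    n∸2k≡c′ = trans (cong₂ _∸_ (sym c+c′) (sym c≡2k)) (m+n∸m≡n c c′)
    s : ∀ i → Site (at i)
    s i = site (at i) (sound i)
    internal : ∀ j → ¬ Boundary S j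
    internal j bd = let (e , ie , _) = Star.chord S j in
      int e (inStarAt e j ie) (boundary-chord S {e} j ie bd)
    missed : ∀ i → site-mid (s i) ≢ mid S normal
    missed i h = internal (Site.j (s i)) (proj₁ (end-cong {Site.S (s i)} {S}
      (mid-agree (Site.S (s i)) S (Site.normal (s i)) normal h) (Site.end (s i))))
    f : Fin (suc c′) → Fin (n ∸ 2 * k)
    f fzero    = mid S normal
    f (fsuc i) = site-mid (s i)
    f-injective : ∀ {i j} → f i ≡ f j → i ≡ j
    f-injective {fzero}  {fzero}  _ = refl
    f-injective {fzero}  {fsuc j} h = ⊥-elim (missed j (sym h))
    f-injective {fsuc i} {fzero}  h = ⊥-elim (missed i h)
    f-injective {fsuc i} {fsuc j} h = cong fsuc (injective (site-injective (s i) (s j) h))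

  abstract
    -- Two injections compare the non-ears with the n - 2k middle points: a non-ear goes to its
    -- site, and a middle point to the end of the star through it, which is external by hypothesis.
    ears : cIII → Enum Ear (2 * k)
    ears h with count ear?
    ... | c , c′ , E , E′ , c+c′ = subst (Enum Ear) c≡2k E
      where
      open Enum E′
      s : ∀ i → Site (at i)
      s i = site (at i) (sound i)
      c′≤ : c′ ≤ n ∸ 2 * k
      c′≤ = injective⇒≤ {f = λ i → site-mid (s i)} λ {i} {j} eq → injective (site-injective (s i) (s j) eq)

      record Through (i : Fin (n ∸ 2 * k)) : Set where
        field
          S      : Star
          mid≡   : Star.s S k ≡ toℕ i + k
          normal : Normal S
          j      : ℕ
          end    : End S j

      through : ∀ i → Through i
      through i with middle (toℕ i + k) (m≤n+m k (toℕ i)) (lia 4 (λ i k n e →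
            i ≺ e ⇒ 2 ⊠ k ⊹ e ≐ n ⇒ ⊢ i ⊹ k ⊹ k ≺ n) (toℕ i) k n (n ∸ 2 * k) (toℕ<n i) (m+[n∸m]≡n (<⇒≤ 2k<n)))
      ... | S , eq , nf with Ends.boundary⇒end S (proj₂ (external h S))
      ... | j , end = record { S = S ; mid≡ = eq ; normal = nf ; j = j ; end = end }

      last : ∀ i → Through i → Fin n
      last i t = π (Star.s (Through.S t) (Through.j t))

      last-nonear : ∀ i t → ¬ Ear (last i t)
      last-nonear i t ear = Ends.end-nonear S end (subst₂ T̂ (sym (π-lift x))
          (trans (lia 3 (λ r m p → ⊢ r ⊹ m ⊹ p ≐ m ⊹ (r ⊹ p)) (toℕ (π x)) (suc k) (x / n * n))
            (cong (suc k +_) (sym (π-lift x))))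
          (shifts (x / n) {toℕ (π x)} {toℕ (π x) + suc k} ear))
        where
        open Through t
        x : ℕ
        x = Star.s S j

      last-injective : ∀ i i′ t t′ → last i t ≡ last i′ t′ → i ≡ i′
      last-injective i i′ t t′ eq
        with lift-pair t.S t′.S k eq (trans (proj₁ t.end) (+-comm k _)) (trans (proj₁ t′.end) (+-comm k _))
        where
        module t = Through t
        module t′ = Through t′
      ... | q , q′ , p = toℕ-injective (+-cancelʳ-≡ k _ _ (trans (sym t.mid≡)
            (trans (normal-agree {t.S} {t′.S} t.normal t′.normal _ _ p k) t′.mid≡)))
        where
        module t = Through t
        module t′ = Through t′

      ≤c′ : n ∸ 2 * k ≤ c′
      ≤c′ = injective⇒≤ {f = λ i → index (last i (through i)) (last-nonear i (through i))} λ {i} {i′} eq →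
        last-injective i i′ (through i) (through i′)
          (trans (sym (at-index _ _)) (trans (cong at eq) (at-index _ _)))

      c≡2k : c ≡ 2 * k
      c≡2k = lia 5 (λ c c′ k n e → c′ ≼ e ⇒ e ≼ c′ ⇒ c ⊹ c′ ≐ n ⇒ 2 ⊠ k ⊹ e ≐ n ⇒ ⊢ c ≐ 2 ⊠ k)
        c c′ k n (n ∸ 2 * k) c′≤ ≤c′ c+c′ (m+[n∸m]≡n (<⇒≤ 2k<n))

  iii⇒iv : cIII → HasSize (λ e → e ∈E T × len e ≡ suc k) (2 * k)
  iii⇒iv h = level-size (suc k) (s≤s z≤n) 2[1+k]<n (ears h)

  -- Accordions

  cV cVI : Set
  cV = (∀ l → suc k ≤ l → 2 * l < n → HasSize (λ e → e ∈E T × len e ≡ l) (2 * k))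
       × (∀ m → n ≡ 2 * m → HasSize (λ e → e ∈E T × len e ≡ m) k)
  cVI = Σ (Fin k → Accordion n k) λ acc →
          (∀ c c′ → c ≢ c′ → ∀ e → InAccordion (acc c) e → ¬ InAccordion (acc c′) e)
          × (∀ e → (e ∈E T × Relevant k e) ⇔ (∃[ c ] InAccordion (acc c) e))

  long-enough : ∀ {i} → i < n ∸ M → i + suc k + k < n
  long-enough {i} h = lia 4 (λ i k n d → i ≺ d ⇒ # 1 ⊹ 2 ⊠ k ⊹ d ≐ n ⇒ ⊢ i ⊹ (# 1 ⊹ k) ⊹ k ≺ n)
    i k n (n ∸ M) h (m+[n∸m]≡n (<⇒≤ M<n))

  relevant-dart : ∀ {e a} l → k < l → l + k < n → EdgeIs e a (a ⊕ l) → Relevant k e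
  relevant-dart {e} l k<l l+k<n ie = subst (k <_) (sym (len-dart {e} l l<n ie)) (⊓-glb k<l
      (lia 4 (λ l k n d → l ⊹ k ≺ n ⇒ l ⊹ d ≐ n ⇒ ⊢ k ≺ d) l k n (n ∸ l) l+k<n (m+[n∸m]≡n (<⇒≤ l<n))))
    where
    l<n : l < n
    l<n = ≤-<-trans (m≤m+n l k) l+k<n

  module Decomposition (h : cIII) where
    open Paths k n′ T̂ 0<k 2k+3≤n tri (external h)
      using (Dart; path; path-dart; path-reverse; path-retreat; path-step; rev-dart; rev-rev)

    back : ∀ {a l} m L L′ → k < l → L + k < n → m + l ≡ L → L + L′ ≡ n → Dart l a →
           path (path a l m ⊕ L) L′ m ≡ a ⊕ l
    back {a} {l} m L L′ k<l lt eq eq′ d = subst (λ i → path (path a l i ⊕ L) L′ m ≡ a ⊕ l) (+-identityʳ m)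
      (path-reverse {a} m 0 L L′ k<l lt (trans (cong (_+ l) (+-identityʳ m)) eq) eq′ d)

    dart∈T : ∀ {e a} l → EdgeIs e a (a ⊕ l) → Dart l a → e ∈E T
    dart∈T {e} {a} l ie (f , if , t) = subst (_∈E T)
      (EdgeIs-≡ {f} {e} (subst (λ u → EdgeIs f u (a ⊕ l)) (π-toℕ a) if) ie) t

    edge-Dart : ∀ {e a} l → EdgeIs e a (a ⊕ l) → e ∈E T → Dart l a
    edge-Dart {e} {a} l ie t = e , subst (λ u → EdgeIs e u (a ⊕ l)) (sym (π-toℕ a)) ie , t

    module _ (m : ℕ) (lt : m + suc k + k < n) where

      private
        L = m + suc k
        L′ = n ∸ L
        L+L′ : L + L′ ≡ n
        L+L′ = m+[n∸m]≡n (≤-trans (m≤m+n L k) (<⇒≤ lt))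
        k<L′ : k < L′
        k<L′ = lia 4 (λ L k n L′ → L ⊹ k ≺ n ⇒ L ⊹ L′ ≐ n ⇒ ⊢ k ≺ L′) L k n L′ lt L+L′
        mL′ : m + L′ + suc k ≡ n
        mL′ = lia 4 (λ m k L′ n → m ⊹ (# 1 ⊹ k) ⊹ L′ ≐ n ⇒ ⊢ m ⊹ L′ ⊹ (# 1 ⊹ k) ≐ n) m k L′ n L+L′
        mL′+k<n : m + L′ + k < n
        mL′+k<n = subst (m + L′ + k <_) mL′ (+-monoʳ-< (m + L′) (n<1+n k))

      path-injective : ∀ {a a′} → Dart (suc k) a → Dart (suc k) a′ →
                       path a (suc k) m ≡ path a′ (suc k) m → a ≡ a′
      path-injective {a} {a′} d d′ eq = trans (sym (rev-rev a (m+[n∸m]≡n k<n)))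
        (trans (cong (_⊕ (n ∸ suc k)) same) (rev-rev a′ (m+[n∸m]≡n k<n)))
        where
        same : a ⊕ suc k ≡ a′ ⊕ suc k
        same = trans (sym (back {a} m L L′ ≤-refl lt refl L+L′ d))
          (trans (cong (λ x → path (x ⊕ L) L′ m) eq) (back {a′} m L L′ ≤-refl lt refl L+L′ d′))

      -- The path of the reversed dart is followed up to length n - (k+1). Reversing its last dart
      -- gives an ear, from which `back` returns to the given dart.
      source : ∀ {a} → Dart L a → ∃[ a₀ ] (Dart (suc k) a₀ × path a₀ (suc k) m ≡ a)
      source {a} d = path (a ⊕ L) L′ m ⊕ (m + L′) , rev-dart {path (a ⊕ L) L′ m} mL′ (path-dart {a ⊕ L} m k<L′ mL′+k<n d′) ,
          trans (back {a ⊕ L} m (m + L′) (suc k) k<L′ mL′+k<n refl mL′ d′) (rev-rev a L+L′)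
        where
        d′ : Dart L′ (a ⊕ L)
        d′ = rev-dart {a} L+L′ d

      level-enum : Enum (Dart L) (2 * k)
      level-enum = record
        { at = λ i → path (at i) (suc k) m
        ; sound = λ i → path-dart {at i} m ≤-refl lt (sound i)
        ; injective = λ {i} {j} eq → injective (path-injective {at i} {at j} (sound i) (sound j) eq)
        ; index = λ a d → let (a₀ , d₀ , _) = source {a} d in index a₀ d₀
        ; at-index = λ a d → let (a₀ , d₀ , eq) = source {a} d in
            trans (cong (λ x → path x (suc k) m) (at-index a₀ d₀)) eq }
        where open Enum (ears h)

    iii⇒v₁ : ∀ l → suc k ≤ l → 2 * l < n → HasSize (λ e → e ∈E T × len e ≡ l) (2 * k)
    iii⇒v₁ l k<l 2l<n = level-size l (≤-trans (s≤s z≤n) k<l) 2l<n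
        (subst (λ L → Enum (Dart L) (2 * k)) m+1+k≡l (level-enum m (subst (λ x → x + k < n) (sym m+1+k≡l) l+k<n)))
      where
      m = l ∸ suc k
      m+1+k≡l : m + suc k ≡ l
      m+1+k≡l = m∸n+n≡m k<l
      l+k<n : l + k < n
      l+k<n = lia 3 (λ l k n → k ≺ l ⇒ 2 ⊠ l ≺ n ⇒ ⊢ l ⊹ k ≺ n) l k n k<l 2l<n

    private
      -- In `m₀` steps a path leads from an ear, of length k+1, to length `L₀` = n - (k+1), that of
      -- a reversed ear. Reversing its last dart yields the `opposite` ear.
      m₀ L₀ : ℕ
      m₀ = n ∸ 2 * suc k
      L₀ = m₀ + suc k

      L₀+1+k : L₀ + suc k ≡ n
      L₀+1+k = lia 3 (λ m k n → m ⊹ 2 ⊠ (# 1 ⊹ k) ≐ n ⇒ ⊢ m ⊹ (# 1 ⊹ k) ⊹ (# 1 ⊹ k) ≐ n) m₀ k n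
        (m∸n+n≡m (<⇒≤ 2[1+k]<n))

      L₀+k<n : L₀ + k < n
      L₀+k<n = subst (L₀ + k <_) L₀+1+k (+-monoʳ-< L₀ (n<1+n k))

      opposite : Fin n → Fin n
      opposite a = path a (suc k) m₀ ⊕ L₀

      opposite-dart : ∀ {a} → Dart (suc k) a → Dart (suc k) (opposite a)
      opposite-dart {a} d = rev-dart {path a (suc k) m₀} L₀+1+k (path-dart {a} m₀ ≤-refl L₀+k<n d)

      opposite-path : ∀ {a} i t → i + t ≡ m₀ → Dart (suc k) a →
                      path (opposite a) (suc k) i ≡ path a (suc k) t ⊕ (t + suc k)
      opposite-path {a} i t eq d = subst (λ m → path (path a (suc k) m ⊕ L₀) (suc k) i ≡ path a (suc k) t ⊕ (t + suc k))
        eq (path-reverse {a} i t L₀ (suc k) ≤-refl L₀+k<n (cong (_+ suc k) eq) L₀+1+k d)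

      opposite² : ∀ {a} → Dart (suc k) a → opposite (opposite a) ≡ a
      opposite² {a} d = trans (cong (_⊕ L₀) (back {a} m₀ L₀ (suc k) ≤-refl L₀+k<n refl L₀+1+k d))
        (rev-rev a (trans (+-comm (suc k) L₀) L₀+1+k))

      -- The last dart starts at most `m₀` vertices before a and spans `m₀` + k + 1 of them, so it
      -- ends strictly past a and less than one turn later.
      opposite≢ : ∀ a → opposite a ≢ a
      opposite≢ a eq with path-retreat a (suc k) m₀
      ... | p , p≤m , ret = ⊕-≢ a d 0<d d<n (trans (cong (_⊕ d) (sym ret))
              (trans (⊕-⊕ (path a (suc k) m₀) p d) (trans (cong (path a (suc k) m₀ ⊕_) p+d) eq)))
        where
        d = L₀ ∸ p
        p≤L₀ : p ≤ L₀
        p≤L₀ = ≤-trans p≤m (m≤m+n m₀ (suc k))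
        p+d : p + d ≡ L₀
        p+d = m+[n∸m]≡n p≤L₀
        0<d : 0 < d
        0<d = lia 4 (λ p d m k → p ⊹ d ≐ m ⊹ (# 1 ⊹ k) ⇒ p ≼ m ⇒ ⊢ # 0 ≺ d) p d m₀ k p+d p≤m
        d<n : d < n
        d<n = ≤-<-trans (m∸n≤m L₀ p) (≤-<-trans (m≤m+n L₀ k) L₀+k<n)

      open Enum (ears h)

      τ : Fin (2 * k) → Fin (2 * k)
      τ i = index (opposite (at i)) (opposite-dart {at i} (sound i))

      at-τ : ∀ i → at (τ i) ≡ opposite (at i)
      at-τ i = at-index _ _

      ττ : ∀ i → τ (τ i) ≡ i
      ττ i = injective (trans (at-τ (τ i)) (trans (cong opposite (at-τ i)) (opposite² {at i} (sound i))))

      τ≢ : ∀ i → τ i ≢ i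
      τ≢ i eq = opposite≢ (at i) (trans (sym (at-τ i)) (cong at eq))

      open Orbits k τ ττ τ≢ using (First; firsts; first-τ; ¬first-τ)
      module O = Enum firsts

      g : Fin k → Fin n
      g c = at (O.at c)

      g-dart : ∀ c → Dart (suc k) (g c)
      g-dart c = sound (O.at c)

    -- One path for each pair of opposite ears; the path from the other ear of the pair has the same
    -- edges.
    acc : Fin k → Accordion n k
    acc c = accordion (λ i → path (g c) (suc k) i) (λ i → path (g c) (suc k) i ⊕ (i + suc k)) refl
      (λ i _ → path-step (g c) (suc k) i)

    private
      acc-apart : ∀ c c′ → c ≢ c′ → ∀ e → InAccordion (acc c) e → ¬ InAccordion (acc c′) e
      acc-apart c c′ ne e (i , i< , ie) (j , j< , je) = clash (EdgeIs-ends {e} ie je)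
        where
        A = path (g c) (suc k) i
        B = path (g c′) (suc k) j
        li = i + suc k
        lj = j + suc k
        li<n : li < n
        li<n = ≤-<-trans (m≤m+n li k) (long-enough i<)
        lj<n : lj < n
        lj<n = ≤-<-trans (m≤m+n lj k) (long-enough j<)
        clash : (A ≡ B × A ⊕ li ≡ B ⊕ lj) ⊎ (A ≡ B ⊕ lj × A ⊕ li ≡ B) → ⊥
        clash (inj₁ (A≡B , eq)) = ne (O.injective (injective (path-injective i (long-enough i<) {g c} {g c′} (g-dart c) (g-dart c′)
            (trans A≡B (cong (path (g c′) (suc k)) (sym i≡j))))))
          where
          i≡j : i ≡ j
          i≡j = +-cancelʳ-≡ (suc k) i j (⊕-cancel A li lj li<n lj<n (trans eq (cong (_⊕ lj) (sym A≡B))))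
        -- The edge is read in opposite directions, so the two paths start at opposite ears, of
        -- which only one is `First`.
        clash (inj₂ (A≡ , eq)) = first-τ (O.sound c′) (subst First (injective (trans gc≡ (sym (at-τ (O.at c′))))) (O.sound c))
          where
          lj+li≡n : lj + li ≡ n
          lj+li≡n = ⊕-full B lj li (<-≤-trans (s≤s z≤n) (m≤n+m (suc k) j)) lj<n li<n
            (trans (cong (_⊕ li) (sym A≡)) eq)
          i+j≡m₀ : i + j ≡ m₀
          i+j≡m₀ = lia 5 (λ i j k n m → j ⊹ (# 1 ⊹ k) ⊹ (i ⊹ (# 1 ⊹ k)) ≐ n ⇒ m ⊹ (# 1 ⊹ k) ⊹ (# 1 ⊹ k) ≐ n ⇒ ⊢ i ⊹ j ≐ m)
            i j k n m₀ lj+li≡n L₀+1+k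
          gc≡ : g c ≡ opposite (g c′)
          gc≡ = path-injective i (long-enough i<) {g c} {opposite (g c′)} (g-dart c) (opposite-dart {g c′} (g-dart c′))
            (trans A≡ (sym (opposite-path {g c′} i j i+j≡m₀ (g-dart c′))))

      acc⇒T : ∀ e → (∃[ c ] InAccordion (acc c) e) → e ∈E T × Relevant k e
      acc⇒T e (c , i , i< , ie) =
        dart∈T {e} {path (g c) (suc k) i} (i + suc k) ie (path-dart {g c} i ≤-refl (long-enough i<) (g-dart c)) ,
        relevant-dart {e} {path (g c) (suc k) i} (i + suc k) (m≤n+m (suc k) i) (long-enough i<) ie

      locate : ∀ e l → l < n → EdgeIs e (src e) (src e ⊕ l) → e ∈E T → Relevant k e →
               ∃[ c ] InAccordion (acc c) e
      locate e l l<n ie t rel = find (source i lt {src e} (subst (λ L → Dart L (src e)) (sym i+1+k≡l) (edge-Dart {e} {src e} l ie t)))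
        where
        k<⊓ : k < l ⊓ (n ∸ l)
        k<⊓ = subst (k <_) (len-dart {e} l l<n ie) rel
        k<l : k < l
        k<l = <-≤-trans k<⊓ (m⊓n≤m l (n ∸ l))
        i = l ∸ suc k
        i+1+k≡l : i + suc k ≡ l
        i+1+k≡l = m∸n+n≡m k<l
        l+k<n : l + k < n
        l+k<n = lia 4 (λ l k n d → k ≺ d ⇒ l ⊹ d ≐ n ⇒ ⊢ l ⊹ k ≺ n) l k n (n ∸ l)
          (<-≤-trans k<⊓ (m⊓n≤n l (n ∸ l))) (m+[n∸m]≡n (<⇒≤ l<n))
        lt : i + suc k + k < n
        lt = subst (λ x → x + k < n) (sym i+1+k≡l) l+k<n
        within : ∀ {i} → i + suc k + k < n → i < n ∸ M
        within {i} h = lia 4 (λ i k n d → i ⊹ (# 1 ⊹ k) ⊹ k ≺ n ⇒ # 1 ⊹ 2 ⊠ k ⊹ d ≐ n ⇒ ⊢ i ≺ d) i k n (n ∸ M)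
          h (m+[n∸m]≡n (<⇒≤ M<n))
        find : ∃[ a₀ ] (Dart (suc k) a₀ × path a₀ (suc k) i ≡ src e) → ∃[ c ] InAccordion (acc c) e
        find (a₀ , d₀ , eq) = decide (toℕ x <? toℕ (τ x))
          where
          x = index a₀ d₀
          decide : Dec (First x) → ∃[ c ] InAccordion (acc c) e
          decide (yes p) = O.index x p , i , within lt ,
                  subst₂ (EdgeIs e) (sym here) (trans (cong (src e ⊕_) (sym i+1+k≡l)) (cong (_⊕ (i + suc k)) (sym here))) ie
            where
            here : path (g (O.index x p)) (suc k) i ≡ src e
            here = trans (cong (λ y → path y (suc k) i) (trans (cong at (O.at-index x p)) (at-index a₀ d₀))) eq
          -- The accordion starts at the opposite ear and contains the edge as a reversed dart, at
          -- step m₀ - i.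
          decide (no ¬p) = O.index y q , t′ , within t′-lt ,
                  EdgeIs-sym {e} (subst₂ (EdgeIs e) (sym there) (sym start) ie)
            where
            y = τ x
            q = ¬first-τ ¬p
            t′ = m₀ ∸ i
            i+t′ : i + t′ ≡ m₀
            i+t′ = m+[n∸m]≡n (lia 4 (λ i k n m → i ⊹ (# 1 ⊹ k) ⊹ k ≺ n ⇒ m ⊹ (# 1 ⊹ k) ⊹ (# 1 ⊹ k) ≐ n ⇒ ⊢ i ≼ m)
                     i k n m₀ lt L₀+1+k)
            t′-lt : t′ + suc k + k < n
            t′-lt = lia 5 (λ i t k n m → i ⊹ t ≐ m ⇒ m ⊹ (# 1 ⊹ k) ⊹ k ≺ n ⇒ ⊢ t ⊹ (# 1 ⊹ k) ⊹ k ≺ n)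
              i t′ k n m₀ i+t′ L₀+k<n
            a₀≡ : opposite (g (O.index y q)) ≡ a₀
            a₀≡ = trans (cong (λ z → opposite (at z)) (O.at-index y q))
              (trans (sym (at-τ y)) (trans (cong at (ττ x)) (at-index a₀ d₀)))
            there : path (g (O.index y q)) (suc k) t′ ⊕ (t′ + suc k) ≡ src e
            there = trans (sym (opposite-path {g (O.index y q)} i t′ i+t′ (g-dart (O.index y q))))
              (trans (cong (λ z → path z (suc k) i) a₀≡) eq)
            total : t′ + suc k + l ≡ n
            total = lia 6 (λ i t k l n m → i ⊹ t ≐ m ⇒ m ⊹ (# 1 ⊹ k) ⊹ (# 1 ⊹ k) ≐ n ⇒ i ⊹ (# 1 ⊹ k) ≐ l ⇒
              ⊢ t ⊹ (# 1 ⊹ k) ⊹ l ≐ n) i t′ k l n m₀ i+t′ L₀+1+k i+1+k≡l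
            start : path (g (O.index y q)) (suc k) t′ ≡ src e ⊕ l
            start = trans (sym (rev-rev (path (g (O.index y q)) (suc k) t′) total)) (cong (_⊕ l) there)

      T⇒acc : ∀ e → e ∈E T × Relevant k e → ∃[ c ] InAccordion (acc c) e
      T⇒acc e (t , rel) = let (l , _ , l<n , ie) = edge-dart e in locate e l l<n ie t rel

    iii⇒vi : cVI
    iii⇒vi = acc , acc-apart , λ e → mk⇔ (T⇒acc e) (acc⇒T e)

  -- Edges of an arbitrary accordion

  module AccordionProperties (A : Accordion n k) where
    open Accordion A

    b-length : ∀ i → i < n ∸ M → b i ≡ a i ⊕ (suc k + i)
    b-length zero    _ = trans first (cong (a 0 ⊕_) (sym (+-identityʳ (suc k))))
    b-length (suc i) h with step i h | b-length i (<-trans (n<1+n i) h)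
    ... | inj₁ (a≡ , b≡) | bi = trans b≡ (trans (cong (_⊕ 1) bi) (trans (⊕-⊕ (a i) (suc k + i) 1)
            (trans (cong (a i ⊕_) (lia 2 (λ k i → ⊢ # 1 ⊹ k ⊹ i ⊹ # 1 ≐ # 1 ⊹ k ⊹ (# 1 ⊹ i)) k i))
              (cong (_⊕ (suc k + suc i)) (sym a≡)))))
    ... | inj₂ (a≡ , b≡) | bi = trans b≡ (trans bi (sym (trans (cong (_⊕ (suc k + suc i)) a≡)
            (trans (⊕-⊕ (a i) n′ (suc k + suc i)) (trans (cong (a i ⊕_)
              (lia 3 (λ k i n′ → ⊢ n′ ⊹ (# 1 ⊹ k ⊹ (# 1 ⊹ i)) ≐ # 1 ⊹ k ⊹ i ⊹ (# 1 ⊹ n′)) k i n′))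
              (trans (sym (⊕-⊕ (a i) (suc k + i) n)) (⊕-n _)))))))

    retreat : ∀ i d → d + i < n ∸ M → ∃[ p ] (p ≤ d × a (d + i) ⊕ p ≡ a i)
    retreat i zero    _ = 0 , z≤n , ⊕-0 (a i)
    retreat i (suc d) h with step (d + i) h | retreat i d (<-trans (n<1+n _) h)
    ... | inj₁ (a≡ , _) | p , p≤d , eq = p , m≤n⇒m≤1+n p≤d , trans (cong (_⊕ p) a≡) eq
    ... | inj₂ (a≡ , _) | p , p≤d , eq = suc p , s≤s p≤d , trans (cong (_⊕ suc p) a≡)
            (trans (⊕-⊕ (a (d + i)) n′ (suc p)) (trans (cong (a (d + i) ⊕_) (trans (+-comm n′ (suc p)) (sym (+-suc p n′))))
              (trans (sym (⊕-⊕ (a (d + i)) p n)) (trans (⊕-n _) eq))))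

    in-dart : ∀ e → (in★ : InAccordion A e) → EdgeIs e (a (proj₁ in★)) (a (proj₁ in★) ⊕ (suc k + proj₁ in★))
    in-dart e (i , i< , ie) = subst (EdgeIs e (a i)) (b-length i i<) ie

    level< : ∀ {i} → i < n ∸ M → suc k + i + k < n
    level< {i} h = subst (λ x → x + k < n) (+-comm i (suc k)) (long-enough h)

    -- The arc of a later edge contains that of an earlier one: its start has moved back by p ≤ j -
    -- i vertices while its length has grown by j - i. Nested edges do not cross.
    noncrossing-≤ : ∀ e f → (x : InAccordion A e) (y : InAccordion A f) → proj₁ x ≤ proj₁ y → ¬ Cross f e
    noncrossing-≤ e f x@(i , i< , _) y@(j , j< , _) i≤j
      with retreat i (j ∸ i) (subst (_< n ∸ M) (sym (m∸n+n≡m i≤j)) j<)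
    ... | p , p≤ , eq = nested {f} {e} X (X + (suc k + j)) (X + p) (X + p + (suc k + i)) (m≤m+n X p)
            (m<m+n (X + p) (s≤s z≤n))
            (lia 6 (λ X p k i j d → p ≼ d ⇒ d ⊹ i ≐ j ⇒ ⊢ X ⊹ p ⊹ (# 1 ⊹ k ⊹ i) ≼ X ⊹ (# 1 ⊹ k ⊹ j))
              X p k i j (j ∸ i) p≤ (m∸n+n≡m i≤j))
            (+-monoʳ-< X (≤-<-trans (m≤m+n _ k) (level< j<)))
            (subst (λ u → EdgeIs f u (a j ⊕ (suc k + j))) (sym (π-toℕ (a j))) (in-dart f y))
            (subst₂ (EdgeIs e) (sym at-i) (trans (cong (_⊕ (suc k + i)) (sym at-i)) (π-⊕ (X + p) (suc k + i))) (in-dart e x))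
      where
      X = toℕ (a j)
      at-i : π (X + p) ≡ a i
      at-i = trans (cong (λ m → a m ⊕ p) (sym (m∸n+n≡m i≤j))) eq

    noncrossing : ∀ e f → InAccordion A e → InAccordion A f → ¬ Cross e f
    noncrossing e f x y cr with ≤-total (proj₁ x) (proj₁ y)
    ... | inj₁ le = noncrossing-≤ e f x y le (Cross-sym {e} {f} cr)
    ... | inj₂ ge = noncrossing-≤ f e y x ge cr

  vi⇒i : cVI → KColorable k T
  vi⇒i (acc , _ , cover) = col , λ e f te tf re rf cr eq →
      AccordionProperties.noncrossing (acc (col e)) e f (member e te re)
        (subst (λ c → InAccordion (acc c) f) (sym eq) (member f tf rf)) cr
    where
    colour : ∀ e → Dec (e ∈E T × Relevant k e) → Fin k
    colour e (yes p) = proj₁ (Equivalence.to (cover e) p)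
    -- An arbitrary color for the edges outside the relevant part of `T`.
    colour e (no _)  = fromℕ< 0<k
    colored? : ∀ e → Dec (e ∈E T × Relevant k e)
    colored? e = (T e Bool.≟ true) ×-dec (k <? len e)
    col : Edge n → Fin k
    col e = colour e (colored? e)
    member : ∀ e → e ∈E T → Relevant k e → InAccordion (acc (col e)) e
    member e t r with colored? e
    ... | yes p = proj₂ (Equivalence.to (cover e) p)
    ... | no ¬p = ⊥-elim (¬p (t , r))

  -- The darts of an accordion have the lengths k+1 to n-k-1, each once. So it contains one
  -- diameter, at step `i₀`, and disjointness makes the k diameters different.
  vi⇒v₂ : cVI → ∀ m → n ≡ 2 * m → HasSize (λ e → e ∈E T × len e ≡ m) k
  vi⇒v₂ (acc , apart , cover) m n≡2m = hasSize level-irrelevant f sound injective complete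
    where
    i₀ = m ∸ suc k
    1+k≤m : suc k ≤ m
    1+k≤m = lia 3 (λ k n m → 2 ⊠ k ⊹ # 3 ≼ n ⇒ n ≐ 2 ⊠ m ⇒ ⊢ # 1 ⊹ k ≼ m) k n m 2k+3≤n n≡2m
    lvl : suc k + i₀ ≡ m
    lvl = m+[n∸m]≡n 1+k≤m
    i₀< : i₀ < n ∸ M
    i₀< = lia 5 (λ i k m n d → # 1 ⊹ k ⊹ i ≐ m ⇒ n ≐ 2 ⊠ m ⇒ # 1 ⊹ 2 ⊠ k ⊹ d ≐ n ⇒ # 1 ⊹ k ≼ m ⇒ ⊢ i ≺ d)
      i₀ k m n (n ∸ M) lvl n≡2m (m+[n∸m]≡n (<⇒≤ M<n)) 1+k≤m
    m<n : m < n
    m<n = lia 3 (λ k m n → # 1 ⊹ k ≼ m ⇒ n ≐ 2 ⊠ m ⇒ ⊢ m ≺ n) k m n 1+k≤m n≡2m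
    0<m : 0 < m
    0<m = ≤-trans (s≤s z≤n) 1+k≤m
    n∸m≡m : n ∸ m ≡ m
    n∸m≡m = trans (cong (_∸ m) (trans n≡2m (cong (λ x → m + x) (+-identityʳ m)))) (m+n∸m≡n m m)
    a : Fin k → Fin n
    a c = Accordion.a (acc c) i₀
    f : Fin k → Edge n
    f c = proj₁ (dart-edge (a c) m 0<m m<n)
    is : ∀ c → EdgeIs (f c) (a c) (a c ⊕ m)
    is c = proj₂ (dart-edge (a c) m 0<m m<n)
    in★ : ∀ c → InAccordion (acc c) (f c)
    in★ c = i₀ , i₀< , subst (EdgeIs (f c) (a c))
      (sym (trans (AccordionProperties.b-length (acc c) i₀ i₀<) (cong (a c ⊕_) lvl))) (is c)
    sound : ∀ c → f c ∈E T × len (f c) ≡ m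
    sound c = proj₁ (Equivalence.from (cover (f c)) (c , in★ c)) ,
      trans (len-dart {f c} m m<n (is c)) (trans (cong (m ⊓_) n∸m≡m) (⊓-idem m))
    injective : ∀ {c c′} → f c ≡ f c′ → c ≡ c′
    injective {c} {c′} eq with c ≟ᶠ c′
    ... | yes h = h
    ... | no ne = ⊥-elim (apart c c′ ne (f c) (in★ c) (subst (InAccordion (acc c′)) (sym eq) (in★ c′)))
    complete : ∀ e → e ∈E T × len e ≡ m → ∃[ c ] f c ≡ e
    complete e (t , h) with Equivalence.to (cover e) (t , subst (k <_) (sym h) 1+k≤m)
    ... | c , x@(i , i< , _) = c , EdgeIs-≡ {f c} {e} (is c)
            (subst₂ (EdgeIs e) (cong (Accordion.a (acc c)) i≡i₀)
              (cong₂ _⊕_ (cong (Accordion.a (acc c)) i≡i₀) l≡m) (P.in-dart e x))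
      where
      module P = AccordionProperties (acc c)
      l = suc k + i
      l<n : l < n
      l<n = ≤-<-trans (m≤m+n l k) (P.level< i<)
      min : l ⊓ (n ∸ l) ≡ m
      min = trans (sym (len-dart {e} l l<n (P.in-dart e x))) h
      l≡m : l ≡ m
      l≡m = lia 4 (λ l d n m → m ≼ l ⇒ m ≼ d ⇒ l ⊹ d ≐ n ⇒ n ≐ 2 ⊠ m ⇒ ⊢ l ≐ m) l (n ∸ l) n m
        (subst (_≤ l) min (m⊓n≤m l (n ∸ l))) (subst (_≤ n ∸ l) min (m⊓n≤n l (n ∸ l)))
        (m+[n∸m]≡n (<⇒≤ l<n)) n≡2m
      i≡i₀ : i ≡ i₀
      i≡i₀ = +-cancelˡ-≡ (suc k) i i₀ (trans l≡m (sym lvl))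

  -- A diameter is two darts of the same length, so the middle level is counted by accordions
  -- instead of darts.
  iii⇒v : cIII → cV
  iii⇒v h = Decomposition.iii⇒v₁ h , vi⇒v₂ (Decomposition.iii⇒vi h)

  v⇒iii : cV → cIII
  v⇒iii (levels , _) = iv⇒iii (levels (suc k) ≤-refl 2[1+k]<n)

  i⇒iii : KColorable k T → cIII
  i⇒iii c = ii⇒iii (i⇒ii c)

  iii⇒i : cIII → KColorable k T
  iii⇒i h = vi⇒i (Decomposition.iii⇒vi h)

theorem6p7 : (k n : ℕ) → 1 < k → 2 * k + 3 ≤ n →
    (T : EdgeSet n) → IsKTriangulation k T →
    let
      cI = KColorable k T
      cII = StarColorable k T
      cIII = ¬ (Σ (StarPoints n k) λ st → StarIn st T × Internal st)
      cIV = HasSize (λ e → e ∈E T × len e ≡ suc k) (2 * k)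
      cV = (∀ l → suc k ≤ l → 2 * l < n →
              HasSize (λ e → e ∈E T × len e ≡ l) (2 * k))
           × (∀ m → n ≡ 2 * m → HasSize (λ e → e ∈E T × len e ≡ m) k)
      cVI = Σ (Fin k → Accordion n k) λ acc →
              (∀ c c′ → c ≢ c′ → ∀ e → InAccordion (acc c) e → ¬ InAccordion (acc c′) e)
              × (∀ e → (e ∈E T × Relevant k e) ⇔ (∃[ c ] InAccordion (acc c) e))
    in (cI ⇔ cII) × (cI ⇔ cIII) × (cI ⇔ cIV) × (cI ⇔ cV) × (cI ⇔ cVI)
theorem6p7 k zero    1<k 2k+3≤0 T T-tri =
  ⊥-elim (lia 1 (λ k → 2 ⊠ k ⊹ # 3 ≼ # 0 ⇒ ⊢⊥) k 2k+3≤0)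
theorem6p7 k (suc n′) 1<k 2k+3≤n T T-tri =
  mk⇔ i⇒ii (λ ii → iii⇒i (ii⇒iii ii)) ,
  mk⇔ i⇒iii iii⇒i ,
  mk⇔ (λ i → iii⇒iv (i⇒iii i)) (λ iv → iii⇒i (iv⇒iii iv)) ,
  mk⇔ (λ i → iii⇒v (i⇒iii i)) (λ v → iii⇒i (v⇒iii v)) ,
  mk⇔ (λ i → Decomposition.iii⇒vi (i⇒iii i)) vi⇒i
  where
  open Main k n′ 1<k 2k+3≤n T T-tri
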